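{- Let $b,c,d$ be nonzero complex numbers with $|q/(bcd)|<1$, such that no denominator below vanishes. Then the following hold. (1) $$\sum_{n=-\infty}^{\infty}\frac{(b,c,d;q)_n}{(q/b,q/c,q/d;q)_n}\left(\frac{q}{bcd}\right)^n=\frac{(q,\, q/(bc),\,q/(bd),\, q/(cd); q)_{\infty}}{(q/ b,\,q/ c,\, q/ d,\, q/(b c d) ; q)_{\infty}}.$$ (2) $$C_0+\sum_{n=2}^{\infty}\frac{1-q^{2n-1}}{(1-q^{n-1})(1-q^n)}\frac{(b,c,d;q)_n}{(1/b,1/c,1/d;q)_n}\left(\frac{1}{b c d}\right)^n=\frac{(q,\, 1/(bc),\, 1/(bd),\, 1/(cd); q)_{\infty}}{(1 / b,\, 1/ c,\, 1 / d,\, 1 /(b c d) ; q)_{\infty}},$$ where $$C_0:=\frac{2 b c d q-b c d-b c q-b d q-c d q+b+c+d+q-2}{(1-q)(1-b) (1-c) (1-d)}.$$ (3) In particular (the case $b=c=d$ of (2), and the limiting case $b,c,d\to\infty$ of (2), respectively), $$\sum_{n=2}^{\infty}\frac{1-q^{2n-1}}{(1-q^{n-1})(1-q^n)}\frac{(b;q)_n^3}{(1/b;q)_n^3}\left(\frac{1}{b}\right)^{3n}=(q;q)_\infty\frac{(-1 /b; q)_{\infty}^3\,(q/b^2;q^2)_\infty^3}{(1 /b^3; q)_{\infty}}+\frac{ -2 b q+b-q+2}{(1-b)(1-q)};$$ and $$\sum_{n=2}^{\infty}\frac{1-q^{2n-1}}{(1-q^{n-1})(1-q^n)}(-1)^nq^{3n(n-1)/2}=(q;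 q)_{\infty}-\frac{1-2q}{1-q}.$$
   Context: $q$ is a complex number with $0<|q|<1$. For $|p|<1$, $(a;p)_\infty=\prod_{j=0}^{\infty}(1-ap^j)$, and for every integer $n$ (possibly negative), $(a;q)_n=(a;q)_\infty/(aq^n;q)_\infty$. Multi-parameter notation: $(a_1,\dots,a_m;q)_n=\prod_{i=1}^m(a_i;q)_n$, also for $n=\infty$. The bilateral sum in (1) is the bilateral basic hypergeometric series ${}_3\psi_3$ with upper parameters $b,c,d$, lower parameters $q/b,q/c,q/d$, and argument $q/(bcd)$.
   Formalization: In (2) and the case b=c=d in (3), |q/(bcd)|<1 does not make the series converge (q=1/10, b=c=d=0.9 diverges); the identities are asserted when in addition |1/(bcd)|<1 or the series converges. -}

module Defs where

open import Level as Level using (Level; _⊔_)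
open import Algebra.Bundles using (CommutativeRing; Semiring)
open import Algebra.Apartness.Bundles using (HeytingField)
import Algebra.Apartness.Properties.HeytingCommutativeRing as HeytingProperties
import Algebra.Definitions.RawMonoid as RawMonoidDefinitions
import Algebra.Definitions.RawSemiring as RawSemiringDefinitions
import Algebra.Properties.Ring as RingProperties
import Algebra.Properties.Semiring.Mult.TCOptimised as SemiringMult
import Algebra.Properties.Semiring.Exp as SemiringExp
import Algebra.Solver.Ring as RingSolver
open import Algebra.Solver.Ring.AlmostCommutativeRing
  using (fromCommutativeRing; _-Raw-AlmostCommutative⟶_)
open import Data.Integer.Base as ℤ using (ℤ; +_; -[1+_])
import Data.Integer.Properties as ℤ
open import Data.List.Base using (List; []; _∷_)
open import Data.Maybe.Base using (Maybe; just; nothing)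
open import Data.Nat.Base as ℕ using (ℕ; zero; suc; _∸_)
import Data.Nat.DivMod as ℕ
import Data.Nat.Properties as ℕ
open import Data.Product.Base using (_×_; _,_; proj₁; proj₂; ∃; ∃-syntax)
import Data.Sign.Base as Sign
open import Data.Sum.Base as Sum using (_⊎_; inj₁; inj₂; [_,_]′)
open import Relation.Binary.Core using (Rel)
open import Relation.Binary.PropositionalEquality as ≡ using (_≡_)
open import Relation.Binary.Structures using (IsStrictPartialOrder)
import Relation.Binary.Reasoning.Setoid as SetoidReasoning
open import Relation.Nullary.Decidable.Core using (yes; no)
open import Relation.Nullary.Negation.Core using (¬_; contradiction)

private variable
  c ℓ ℓ₁ ℓ₂ : Level

-- The real numbers, axiomatised up to isomorphism as a Cauchy complete
-- Archimedean ordered field.  Distinctness is apartness and order is not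
-- assumed decidable, so that both the classical and the constructive reals
-- are models.
record RealNumbers c ℓ₁ ℓ₂ : Set (Level.suc (c ⊔ ℓ₁ ⊔ ℓ₂)) where
  infix 4 _<_
  field
    heytingField : HeytingField c ℓ₁ ℓ₂

  open HeytingField heytingField public

  commutativeRing : CommutativeRing c ℓ₁
  commutativeRing = record { isCommutativeRing = isCommutativeRing }

  open RawMonoidDefinitions (CommutativeRing.+-rawMonoid commutativeRing)
    using () renaming (_×_ to _·_)

  field
    _<_                  : Rel Carrier ℓ₂
    isStrictPartialOrder : IsStrictPartialOrder _≈_ _<_
    <⇒#                  : ∀ {x y} → x < y → x # y
    #⇒<                  : ∀ {x y} → x # y → x < y ⊎ y < x
    +-monoˡ-<            : ∀ {x y} z → x < y → x + z < y + z
    *-pos                : ∀ {x y} → 0# < x → 0# < y → 0# < x * y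
    archimedean          : ∀ x → ∃[ n ] x < n · 1#

  -- Both conditions are symmetric in the two indices, resp. two-sided, so no
  -- absolute value is needed.
  Cauchy : (ℕ → Carrier) → Set (c ⊔ ℓ₂)
  Cauchy s = ∀ {ε} → 0# < ε →
    ∃[ N ] (∀ {m n} → N ℕ.≤ m → N ℕ.≤ n → s m < s n + ε)

  ConvergesTo : (ℕ → Carrier) → Carrier → Set (c ⊔ ℓ₂)
  ConvergesTo s l = ∀ {ε} → 0# < ε →
    ∃[ N ] (∀ {n} → N ℕ.≤ n → s n < l + ε × l < s n + ε)

  field
    complete : ∀ s → Cauchy s → ∃[ l ] ConvergesTo s l

  open IsStrictPartialOrder isStrictPartialOrder public
    using (<-resp-≈; <-respʳ-≈; <-respˡ-≈)
    renaming (irrefl to <-irrefl; trans to <-trans; asym to <-asym)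

-- Ring solver with integer coefficients for an arbitrary commutative ring.
module ℤSolver (R : CommutativeRing c ℓ) where
  open CommutativeRing R
  open RingProperties ring
  open SemiringMult semiring using (1+×; ×-homo-+; ×1-homo-*) renaming (_×_ to _×′_)
  open SetoidReasoning setoid

  fromℤ : ℤ → Carrier
  fromℤ (+ n)    = n ×′ 1#
  fromℤ -[1+ n ] = - (suc n ×′ 1#)

  private
    ⊖-homo : ∀ m n → fromℤ (m ℤ.⊖ n) ≈ m ×′ 1# - n ×′ 1#
    ⊖-homo zero    zero    = sym (-‿inverseʳ 0#)
    ⊖-homo zero    (suc n) = sym (+-identityˡ _)
    ⊖-homo (suc m) zero    = sym (trans (+-congˡ -0#≈0#) (+-identityʳ _))
    ⊖-homo (suc m) (suc n) = begin
      fromℤ (suc m ℤ.⊖ suc n)            ≡⟨ ≡.cong fromℤ (ℤ.[1+m]⊖[1+n]≡m⊖n m n) ⟩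
      fromℤ (m ℤ.⊖ n)                    ≈⟨ ⊖-homo m n ⟩
      m ×′ 1# - n ×′ 1#                  ≈⟨ +-congʳ (+-identityˡ _) ⟨
      0# + m ×′ 1# - n ×′ 1#             ≈⟨ +-congʳ (+-congʳ (-‿inverseˡ 1#)) ⟨
      - 1# + 1# + m ×′ 1# - n ×′ 1#      ≈⟨ +-congʳ (+-assoc _ _ _) ⟩
      - 1# + (1# + m ×′ 1#) - n ×′ 1#    ≈⟨ +-congʳ (+-comm _ _) ⟩
      1# + m ×′ 1# + - 1# - n ×′ 1#      ≈⟨ +-assoc _ _ _ ⟩
      1# + m ×′ 1# + (- 1# - n ×′ 1#)    ≈⟨ +-congˡ (-‿+-comm 1# _) ⟩
      1# + m ×′ 1# - (1# + n ×′ 1#)      ≈⟨ +-cong (1+× m 1#) (-‿cong (1+× n 1#)) ⟨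
      suc m ×′ 1# - suc n ×′ 1#          ∎

    neg-homo : ∀ n → fromℤ (Sign.- ℤ.◃ n) ≈ - (n ×′ 1#)
    neg-homo zero    = sym -0#≈0#
    neg-homo (suc n) = refl

    +-homo : ∀ i j → fromℤ (i ℤ.+ j) ≈ fromℤ i + fromℤ j
    +-homo (+ m)    (+ n)    = ×-homo-+ 1# m n
    +-homo (+ m)    -[1+ n ] = ⊖-homo m (suc n)
    +-homo -[1+ m ] (+ n)    = trans (⊖-homo n (suc m)) (+-comm _ _)
    +-homo -[1+ m ] -[1+ n ] = begin
      - (suc (suc (m ℕ.+ n)) ×′ 1#)       ≡⟨ ≡.cong (λ k → - (suc k ×′ 1#)) (ℕ.+-suc m n) ⟨
      - ((suc m ℕ.+ suc n) ×′ 1#)         ≈⟨ -‿cong (×-homo-+ 1# (suc m) (suc n)) ⟩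
      - (suc m ×′ 1# + suc n ×′ 1#)       ≈⟨ -‿+-comm _ _ ⟨
      - (suc m ×′ 1#) - (suc n ×′ 1#)     ∎

    *-homo : ∀ i j → fromℤ (i ℤ.* j) ≈ fromℤ i * fromℤ j
    *-homo (+ m)    (+ n)    = trans (reflexive (≡.cong fromℤ (ℤ.+◃n≡+n (m ℕ.* n)))) (×1-homo-* m n)
    *-homo (+ m)    -[1+ n ] = trans (neg-homo (m ℕ.* suc n))
      (trans (-‿cong (×1-homo-* m (suc n))) (-‿distribʳ-* _ _))
    *-homo -[1+ m ] (+ n)    = trans (neg-homo (suc m ℕ.* n))
      (trans (-‿cong (×1-homo-* (suc m) n)) (-‿distribˡ-* _ _))
    *-homo -[1+ m ] -[1+ n ] = begin
      (suc m ℕ.* suc n) ×′ 1#              ≈⟨ ×1-homo-* (suc m) (suc n) ⟩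
      suc m ×′ 1# * (suc n ×′ 1#)          ≈⟨ -‿involutive _ ⟨
      - - (suc m ×′ 1# * (suc n ×′ 1#))    ≈⟨ -‿cong (-‿distribˡ-* _ _) ⟩
      - (- (suc m ×′ 1#) * (suc n ×′ 1#))  ≈⟨ -‿distribʳ-* _ _ ⟩
      - (suc m ×′ 1#) * - (suc n ×′ 1#)    ∎

    -‿homo : ∀ i → fromℤ (ℤ.- i) ≈ - fromℤ i
    -‿homo (+ zero)  = sym -0#≈0#
    -‿homo (+ suc n) = refl
    -‿homo -[1+ n ]  = sym (-‿involutive _)

    morphism : ℤ.+-*-rawRing -Raw-AlmostCommutative⟶ fromCommutativeRing R
    morphism = record
      { ⟦_⟧    = fromℤ
      ; +-homo = +-homo
      ; *-homo = *-homo
      ; -‿homo = -‿homo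
      ; 0-homo = refl
      ; 1-homo = refl
      }

    _≟_ : ∀ i j → Maybe (fromℤ i ≈ fromℤ j)
    i ≟ j with i ℤ.≟ j
    ... | yes i≡j = just (reflexive (≡.cong fromℤ i≡j))
    ... | no  _   = nothing

  open RingSolver ℤ.+-*-rawRing (fromCommutativeRing R) morphism _≟_ public
    using (solve; con; _:+_; _:*_; _:-_; :-_; _:=_; _:^_)

module OrderedField (ℛ : RealNumbers c ℓ₁ ℓ₂) where
  open RealNumbers ℛ
  open HeytingProperties heytingCommutativeRing using (invertibleˡ⇒#; 1#0)
  open ℤSolver commutativeRing
  open RingProperties (CommutativeRing.ring commutativeRing) using (-0#≈0#)
  open RawMonoidDefinitions (CommutativeRing.+-rawMonoid commutativeRing)
    using () renaming (_×_ to _·_)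
  open RawSemiringDefinitions (Semiring.rawSemiring (CommutativeRing.semiring commutativeRing))
    using (_^_)

  private variable
    u v w x y z : Carrier

  <-resp : x ≈ y → u ≈ v → x < u → y < v
  <-resp x≈y u≈v x<u = <-respˡ-≈ x≈y (<-respʳ-≈ u≈v x<u)

  x<y⇒0<y-x : x < y → 0# < y - x
  x<y⇒0<y-x {x} x<y = <-respˡ-≈ (-‿inverseʳ x) (+-monoˡ-< (- x) x<y)

  0<y-x⇒x<y : 0# < y - x → x < y
  0<y-x⇒x<y {y} {x} 0<y-x = <-resp (+-identityˡ x)
    (solve 2 (λ y x → y :- x :+ x := y) refl y x) (+-monoˡ-< x 0<y-x)

  x<0⇒0<-x : x < 0# → 0# < - x
  x<0⇒0<-x x<0 = <-respʳ-≈ (+-identityˡ _) (x<y⇒0<y-x x<0)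

  0<-x⇒x<0 : 0# < - x → x < 0#
  0<-x⇒x<0 0<-x = 0<y-x⇒x<y (<-respʳ-≈ (sym (+-identityˡ _)) 0<-x)

  +-pos : 0# < x → 0# < y → 0# < x + y
  +-pos {x} {y} 0<x 0<y = <-trans 0<y (<-respˡ-≈ (+-identityˡ y) (+-monoˡ-< y 0<x))

  +-mono-< : u < v → x < y → u + x < v + y
  +-mono-< {u} {v} {x} {y} u<v x<y = 0<y-x⇒x<y (<-respʳ-≈
    (solve 4 (λ u v x y → (v :- u) :+ (y :- x) := (v :+ y) :- (u :+ x)) refl u v x y)
    (+-pos (x<y⇒0<y-x u<v) (x<y⇒0<y-x x<y)))

  <-cotrans : x < y → ∀ z → x < z ⊎ z < y
  <-cotrans x<y z with #-cotrans (<⇒# x<y) z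
  ... | inj₁ x#z = [ inj₁ , (λ z<x → inj₂ (<-trans z<x x<y)) ]′ (#⇒< x#z)
  ... | inj₂ z#y = [ inj₂ , (λ y<z → inj₁ (<-trans x<y y<z)) ]′ (#⇒< z#y)

  ≮-<-trans : ¬ (y < x) → y < z → x < z
  ≮-<-trans {x = x} y≮x y<z with <-cotrans y<z x
  ... | inj₁ y<x = contradiction y<x y≮x
  ... | inj₂ x<z = x<z

  x*y#0⇒x#0 : x * y # 0# → x # 0#
  x*y#0⇒x#0 {x} {y} xy#0 with #⇒invertible xy#0
  ... | i , i*xy≈1 , _ = invertibleˡ⇒# (y * i , trans
    (solve 3 (λ x y i → y :* i :* (x :- con (+ 0)) := i :* (x :* y :- con (+ 0))) refl x y i)
    i*xy≈1)

  inv : x # 0# → Carrier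
  inv x#0 = proj₁ (#⇒invertible x#0)

  inv-inverse : (x#0 : x # 0#) → inv x#0 * x ≈ 1#
  inv-inverse {x} x#0 = trans
    (solve 2 (λ x i → i :* x := i :* (x :- con (+ 0))) refl x (inv x#0))
    (proj₁ (proj₂ (#⇒invertible x#0)))

  x#0⇒0<x*x : x # 0# → 0# < x * x
  x#0⇒0<x*x {x} x#0 with #⇒< x#0
  ... | inj₂ 0<x = *-pos 0<x 0<x
  ... | inj₁ x<0 = <-respʳ-≈ (solve 1 (λ x → :- x :* :- x := x :* x) refl x)
                     (*-pos (x<0⇒0<-x x<0) (x<0⇒0<-x x<0))

  x*x≮0 : ∀ x → ¬ (x * x < 0#)
  x*x≮0 x xx<0 = <-asym xx<0 (x#0⇒0<x*x (x*y#0⇒x#0 (<⇒# xx<0)))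

  0<1 : 0# < 1#
  0<1 = <-respʳ-≈ (*-identityˡ 1#) (x#0⇒0<x*x 1#0)

  *-cancelʳ-pos : 0# < x * y → 0# < y → 0# < x
  *-cancelʳ-pos {x} {y} 0<xy 0<y with #⇒< (x*y#0⇒x#0 (#-sym (<⇒# 0<xy)))
  ... | inj₂ 0<x = 0<x
  ... | inj₁ x<0 = contradiction 0<xy (<-asym (0<-x⇒x<0 (<-respʳ-≈
    (solve 2 (λ x y → :- x :* y := :- (x :* y)) refl x y) (*-pos (x<0⇒0<-x x<0) 0<y))))

  *-nonneg : ¬ (x < 0#) → 0# < y → ¬ (x * y < 0#)
  *-nonneg x≮0 0<y xy<0 with #⇒< (x*y#0⇒x#0 (<⇒# xy<0))
  ... | inj₁ x<0 = x≮0 x<0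
  ... | inj₂ 0<x = <-asym xy<0 (*-pos 0<x 0<y)

  pos+nonneg : 0# < x → ¬ (y < 0#) → 0# < x + y
  pos+nonneg {x} {y} 0<x y≮0 with <-cotrans 0<x (- y)
  ... | inj₁ 0<-y = contradiction (0<-x⇒x<0 0<-y) y≮0
  ... | inj₂ -y<x = <-respʳ-≈ (solve 2 (λ x y → x :- (:- y) := x :+ y) refl x y) (x<y⇒0<y-x -y<x)

  nonneg+nonneg : ¬ (x < 0#) → ¬ (y < 0#) → ¬ (x + y < 0#)
  nonneg+nonneg {x} {y} x≮0 y≮0 x+y<0 = x≮0 (0<-x⇒x<0 (<-respʳ-≈
    (solve 2 (λ x y → :- (x :+ y) :+ y := :- x) refl x y) (pos+nonneg (x<0⇒0<-x x+y<0) y≮0)))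

  *-mono-< : ¬ (u < 0#) → u < v → ¬ (x < 0#) → x < y → u * x < v * y
  *-mono-< {u} {v} {x} {y} u≮0 u<v x≮0 x<y = 0<y-x⇒x<y (<-respʳ-≈
    (solve 4 (λ u v x y → (v :- u) :* y :+ u :* (y :- x) := v :* y :- u :* x) refl u v x y)
    (pos+nonneg (*-pos (x<y⇒0<y-x u<v) (≮-<-trans x≮0 x<y)) (*-nonneg u≮0 (x<y⇒0<y-x x<y))))

  *-monoˡ-< : 0# < z → x < y → x * z < y * z
  *-monoˡ-< {z} {x} {y} 0<z x<y = 0<y-x⇒x<y (<-respʳ-≈
    (solve 3 (λ x y z → (y :- x) :* z := y :* z :- x :* z) refl x y z) (*-pos (x<y⇒0<y-x x<y) 0<z))

  *-cancelʳ-< : 0# < z → x * z < y * z → x < y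
  *-cancelʳ-< {z} {x} {y} 0<z xz<yz = 0<y-x⇒x<y (*-cancelʳ-pos (<-respʳ-≈
    (solve 3 (λ x y z → y :* z :- x :* z := (y :- x) :* z) refl x y z) (x<y⇒0<y-x xz<yz)) 0<z)

  x*x<y*y⇒x<y : 0# < y → x * x < y * y → x < y
  x*x<y*y⇒x<y {y} {x} 0<y xx<yy with <-cotrans 0<y x
  ... | inj₂ x<y = x<y
  ... | inj₁ 0<x = 0<y-x⇒x<y (*-cancelʳ-pos (<-respʳ-≈
    (solve 2 (λ x y → y :* y :- x :* x := (y :- x) :* (y :+ x)) refl x y) (x<y⇒0<y-x xx<yy))
    (+-pos 0<y 0<x))

  inv-pos : (0<x : 0# < x) → 0# < inv (#-sym (<⇒# 0<x))
  inv-pos 0<x = *-cancelʳ-pos (<-respʳ-≈ (sym (inv-inverse _)) 0<1) 0<x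

  ½ : Carrier
  ½ = inv (#-sym (<⇒# (+-pos 0<1 0<1)))

  ½-pos : 0# < ½
  ½-pos = inv-pos (+-pos 0<1 0<1)

  ½+½≈1 : ½ + ½ ≈ 1#
  ½+½≈1 = trans (solve 1 (λ h → h :+ h := h :* con (+ 2)) refl ½) (inv-inverse _)

  half+half : ∀ x → ½ * x + ½ * x ≈ x
  half+half x = trans (solve 2 (λ h x → h :* x :+ h :* x := (h :+ h) :* x) refl ½ x)
    (trans (*-congʳ ½+½≈1) (*-identityˡ x))

  ^-pos : 0# < x → ∀ n → 0# < x ^ n
  ^-pos 0<x zero    = 0<1
  ^-pos 0<x (suc n) = *-pos 0<x (^-pos 0<x n)

  private
    bernoulli : 0# < x → ∀ n → n · x < (1# + x) ^ n × 1# < (1# + x) ^ suc n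
    bernoulli {x} 0<x zero = 0<1 , <-resp (+-identityʳ 1#)
      (solve 1 (λ x → con (+ 1) :+ x := (con (+ 1) :+ x) :* con (+ 1)) refl x)
      (<-resp (+-comm 0# 1#) (+-comm x 1#) (+-monoˡ-< 1# 0<x))
    bernoulli {x} 0<x (suc n) with bernoulli 0<x n
    ... | nx<p , 1<p′ = step , <-trans 1<p′ (0<y-x⇒x<y (<-respʳ-≈
            (solve 2 (λ x p → x :* p := (con (+ 1) :+ x) :* p :- p) refl x ((1# + x) ^ suc n))
            (*-pos 0<x (<-trans 0<1 1<p′))))
      where
      1≮p : ∀ n → ¬ ((1# + x) ^ n - 1# < 0#)
      1≮p zero    p<0 = <-irrefl (-‿inverseʳ 1#) p<0
      1≮p (suc k) p<0 = <-asym p<0 (x<y⇒0<y-x (proj₂ (bernoulli 0<x k)))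

      step : suc n · x < (1# + x) ^ suc n
      step = 0<y-x⇒x<y (<-respʳ-≈
        (solve 3 (λ x p m → (p :- m) :+ (p :- con (+ 1)) :* x
                            := (con (+ 1) :+ x) :* p :- (x :+ m)) refl x ((1# + x) ^ n) (n · x))
        (pos+nonneg (x<y⇒0<y-x nx<p) (*-nonneg (1≮p n) 0<x)))

    ·-assoc : ∀ n x → n · 1# * x ≈ n · x
    ·-assoc zero    x = zeroˡ x
    ·-assoc (suc n) x = trans (distribʳ x 1# (n · 1#)) (+-cong (*-identityˡ x) (·-assoc n x))

    ^-inverse : x * y ≈ 1# → ∀ n → x ^ n * y ^ n ≈ 1#
    ^-inverse xy≈1 zero = *-identityˡ 1#
    ^-inverse {x} {y} xy≈1 (suc n) = trans
      (solve 4 (λ x y p q → x :* p :* (y :* q) := x :* y :* (p :* q)) refl x y (x ^ n) (y ^ n))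
      (trans (*-cong xy≈1 (^-inverse xy≈1 n)) (*-identityˡ 1#))

  geometric-null : 0# < x → x < 1# → 0# < y → 0# < z → ∃[ n ] y * x ^ n < z
  geometric-null {x} {y} {z} 0<x x<1 0<y 0<z = n , *-cancelʳ-< (^-pos 0<1+h n)
    (<-resp
      (sym (trans (solve 3 (λ y p q → y :* p :* q := y :* (p :* q)) refl y (x ^ n) ((1# + h) ^ n))
        (trans (*-congˡ (^-inverse x*[1+h]≈1 n)) (*-identityʳ y))))
      (*-comm _ _)
      (<-trans (<-resp
          (trans (solve 4 (λ y j k hz → y :* k :* hz := y :* (k :* hz)) refl y y (inv hz#0) (h * z))
            (trans (*-congˡ (inv-inverse hz#0)) (*-identityʳ y)))
          (trans (solve 3 (λ k h z → k :* (h :* z) := k :* h :* z) refl (n · 1#) h z)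
            (*-congʳ (·-assoc n h)))
          (*-monoˡ-< 0<hz (proj₂ (archimedean (y * inv hz#0)))))
        (*-monoˡ-< 0<z (proj₁ (bernoulli 0<h n)))))
    where
    x#0 = #-sym (<⇒# 0<x)
    h = inv x#0 - 1#
    0<h : 0# < h
    0<h = *-cancelʳ-pos (<-respʳ-≈
      (sym (trans (solve 2 (λ i x → (i :- con (+ 1)) :* x := i :* x :- x) refl (inv x#0) x)
        (+-congʳ (inv-inverse x#0)))) (x<y⇒0<y-x x<1)) 0<x
    0<1+h = +-pos 0<1 0<h
    x*[1+h]≈1 : x * (1# + h) ≈ 1#
    x*[1+h]≈1 = trans (solve 2 (λ i x → x :* (con (+ 1) :+ (i :- con (+ 1))) := i :* x) refl (inv x#0) x)
      (inv-inverse x#0)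
    0<hz = *-pos 0<h 0<z
    hz#0 = #-sym (<⇒# 0<hz)
    n = proj₁ (archimedean (y * inv hz#0))

module Complex (ℛ : RealNumbers c ℓ₁ ℓ₂) where
  private module ℝ where
    open RealNumbers ℛ public
    open OrderedField ℛ public
    open ℤSolver commutativeRing public

  infix  8 -_
  infixl 7 _*_
  infixl 6 _+_ _-_
  infix  4 _≈_ _,ⁱ_ _,ᵐ_ _≠0 ∣_∣<_
  infix  5 _+i_

  record ℂ : Set c where
    no-eta-equality
    constructor _+i_
    field
      re im : ℝ.Carrier

  open ℂ public

  record _≈_ (z w : ℂ) : Set ℓ₁ where
    constructor _,ⁱ_
    field
      re≈ : re z ℝ.≈ re w
      im≈ : im z ℝ.≈ im w

  open _≈_ public

  _+_ _*_ : ℂ → ℂ → ℂ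
  re (z + w) = re z ℝ.+ re w
  im (z + w) = im z ℝ.+ im w

  re (z * w) = re z ℝ.* re w ℝ.- im z ℝ.* im w
  im (z * w) = re z ℝ.* im w ℝ.+ im z ℝ.* re w

  -_ : ℂ → ℂ
  re (- z) = ℝ.- re z
  im (- z) = ℝ.- im z

  _-_ : ℂ → ℂ → ℂ
  z - w = z + - w

  0ℂ 1ℂ 2ℂ : ℂ
  0ℂ = ℝ.0# +i ℝ.0#
  1ℂ = ℝ.1# +i ℝ.0#
  2ℂ = 1ℂ + 1ℂ

  ℂ-commutativeRing : CommutativeRing c ℓ₁
  ℂ-commutativeRing = record
    { Carrier = ℂ ; _≈_ = _≈_ ; _+_ = _+_ ; _*_ = _*_ ; -_ = -_ ; 0# = 0ℂ ; 1# = 1ℂ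
    ; isCommutativeRing = record
      { isRing = record
        { +-isAbelianGroup = record
          { isGroup = record
            { isMonoid = record
              { isSemigroup = record
                { isMagma = record
                  { isEquivalence = record
                    { refl  = ℝ.refl ,ⁱ ℝ.refl
                    ; sym   = λ (p ,ⁱ q) → ℝ.sym p ,ⁱ ℝ.sym q
                    ; trans = λ (p ,ⁱ q) (r ,ⁱ s) → ℝ.trans p r ,ⁱ ℝ.trans q s
                    }
                  ; ∙-cong = λ (p ,ⁱ q) (r ,ⁱ s) → ℝ.+-cong p r ,ⁱ ℝ.+-cong q s
                  }
                ; assoc = λ x y z → ℝ.+-assoc _ _ _ ,ⁱ ℝ.+-assoc _ _ _
                }
              ; identity = (λ x → ℝ.+-identityˡ _ ,ⁱ ℝ.+-identityˡ _)
                         , (λ x → ℝ.+-identityʳ _ ,ⁱ ℝ.+-identityʳ _)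
              }
            ; inverse = (λ x → ℝ.-‿inverseˡ _ ,ⁱ ℝ.-‿inverseˡ _)
                      , (λ x → ℝ.-‿inverseʳ _ ,ⁱ ℝ.-‿inverseʳ _)
            ; ⁻¹-cong = λ (p ,ⁱ q) → ℝ.-‿cong p ,ⁱ ℝ.-‿cong q
            }
          ; comm = λ x y → ℝ.+-comm _ _ ,ⁱ ℝ.+-comm _ _
          }
        ; *-cong = λ (p ,ⁱ q) (r ,ⁱ s) →
            ℝ.+-cong (ℝ.*-cong p r) (ℝ.-‿cong (ℝ.*-cong q s)) ,ⁱ
            ℝ.+-cong (ℝ.*-cong p s) (ℝ.*-cong q r)
        ; *-assoc = *-assoc′
        ; *-identity = *-identityˡ′ , λ x → ≈-trans (*-comm′ x 1ℂ) (*-identityˡ′ x)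
        ; distrib = distribˡ′ , λ x y z → ≈-trans (*-comm′ (y + z) x) (≈-trans (distribˡ′ x y z)
            (ℝ.+-cong (re≈ (*-comm′ x y)) (re≈ (*-comm′ x z)) ,ⁱ
             ℝ.+-cong (im≈ (*-comm′ x y)) (im≈ (*-comm′ x z))))
        }
      ; *-comm = *-comm′
      }
    }
    where
    open ℝ using (solve; con; _:+_; _:*_; _:-_; _:=_)

    ≈-trans : ∀ {x y z} → x ≈ y → y ≈ z → x ≈ z
    ≈-trans (p ,ⁱ q) (r ,ⁱ s) = ℝ.trans p r ,ⁱ ℝ.trans q s

    *-comm′ : ∀ x y → x * y ≈ y * x
    *-comm′ x y =
      solve 4 (λ a b c d → a :* c :- b :* d := c :* a :- d :* b) ℝ.refl (re x) (im x) (re y) (im y) ,ⁱ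
      solve 4 (λ a b c d → a :* d :+ b :* c := c :* b :+ d :* a) ℝ.refl (re x) (im x) (re y) (im y)

    *-assoc′ : ∀ x y z → (x * y) * z ≈ x * (y * z)
    *-assoc′ x y z =
      solve 6 (λ a b c d e f →
        (a :* c :- b :* d) :* e :- (a :* d :+ b :* c) :* f :=
        a :* (c :* e :- d :* f) :- b :* (c :* f :+ d :* e)) ℝ.refl (re x) (im x) (re y) (im y) (re z) (im z) ,ⁱ
      solve 6 (λ a b c d e f →
        (a :* c :- b :* d) :* f :+ (a :* d :+ b :* c) :* e :=
        a :* (c :* f :+ d :* e) :+ b :* (c :* e :- d :* f)) ℝ.refl (re x) (im x) (re y) (im y) (re z) (im z)

    *-identityˡ′ : ∀ x → 1ℂ * x ≈ x
    *-identityˡ′ x =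
      solve 2 (λ a b → con (+ 1) :* a :- con (+ 0) :* b := a) ℝ.refl (re x) (im x) ,ⁱ
      solve 2 (λ a b → con (+ 1) :* b :+ con (+ 0) :* a := b) ℝ.refl (re x) (im x)

    distribˡ′ : ∀ x y z → x * (y + z) ≈ x * y + x * z
    distribˡ′ x y z =
      solve 6 (λ a b c d e f →
        a :* (c :+ e) :- b :* (d :+ f) :=
        a :* c :- b :* d :+ (a :* e :- b :* f)) ℝ.refl (re x) (im x) (re y) (im y) (re z) (im z) ,ⁱ
      solve 6 (λ a b c d e f →
        a :* (d :+ f) :+ b :* (c :+ e) :=
        a :* d :+ b :* c :+ (a :* f :+ b :* e)) ℝ.refl (re x) (im x) (re y) (im y) (re z) (im z)

  open RawSemiringDefinitions (Semiring.rawSemiring (CommutativeRing.semiring ℂ-commutativeRing)) public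
    using (_^_)
  open SemiringExp (CommutativeRing.semiring ℂ-commutativeRing) using (^-homo-*)

  private
    module ℂ-Ring = CommutativeRing ℂ-commutativeRing
    module ℂ-Solver = ℤSolver ℂ-commutativeRing

  normSq : ℂ → ℝ.Carrier
  normSq z = re z ℝ.* re z ℝ.+ im z ℝ.* im z

  -- z is apart from 0.
  record _≠0 (z : ℂ) : Set ℓ₂ where
    constructor nonzero
    field
      0<normSq : ℝ.0# ℝ.< normSq z

  -- The strict inequality |z| < r, with both sides squared.
  record ∣_∣<_ (z : ℂ) (r : ℝ.Carrier) : Set ℓ₂ where
    constructor _,ᵐ_
    field
      0<r       : ℝ.0# ℝ.< r
      normSq<r² : normSq z ℝ.< r ℝ.* r

  1ℝ : ℝ.Carrier
  1ℝ = ℝ.1#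

  normSq-cong : ∀ {z w} → z ≈ w → normSq z ℝ.≈ normSq w
  normSq-cong (p ,ⁱ q) = ℝ.+-cong (ℝ.*-cong p p) (ℝ.*-cong q q)

  normSq-* : ∀ z w → normSq (z * w) ℝ.≈ normSq z ℝ.* normSq w
  normSq-* x y = ℝ.solve 4 (λ a b c d →
    (a :* c :- b :* d) :* (a :* c :- b :* d) :+ (a :* d :+ b :* c) :* (a :* d :+ b :* c) :=
    (a :* a :+ b :* b) :* (c :* c :+ d :* d)) ℝ.refl (re x) (im x) (re y) (im y)
    where open ℝ using (_:+_; _:*_; _:-_; _:=_)

  normSq≮0 : ∀ z → ¬ (normSq z ℝ.< ℝ.0#)
  normSq≮0 z = ℝ.nonneg+nonneg (ℝ.x*x≮0 (re z)) (ℝ.x*x≮0 (im z))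

  *-≠0 : ∀ {z w} → z ≠0 → w ≠0 → z * w ≠0
  *-≠0 {z} {w} (nonzero z≠0) (nonzero w≠0) =
    nonzero (ℝ.<-respʳ-≈ (ℝ.sym (normSq-* z w)) (ℝ.*-pos z≠0 w≠0))

  1≠0 : 1ℂ ≠0
  1≠0 = nonzero (ℝ.<-respʳ-≈
    (ℝ.solve 0 (con (+ 1) := con (+ 1) :* con (+ 1) :+ con (+ 0) :* con (+ 0)) ℝ.refl) ℝ.0<1)
    where open ℝ using (con; _:+_; _:*_; _:=_)

  ^-≠0 : ∀ {z} → z ≠0 → ∀ n → z ^ n ≠0
  ^-≠0 z≠0 zero    = 1≠0
  ^-≠0 z≠0 (suc n) = *-≠0 z≠0 (^-≠0 z≠0 n)

  recip : (z : ℂ) → z ≠0 → ℂ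
  recip z z≠0 = (re z ℝ.* n⁻¹) +i (ℝ.- im z ℝ.* n⁻¹)
    where n⁻¹ = ℝ.inv (ℝ.#-sym (ℝ.<⇒# (_≠0.0<normSq z≠0)))

  recip-inverse : ∀ z (z≠0 : z ≠0) → recip z z≠0 * z ≈ 1ℂ
  recip-inverse z z≠0 =
    ℝ.trans (ℝ.solve 3 (λ a b n → a :* n :* a :- :- b :* n :* b := n :* (a :* a :+ b :* b))
              ℝ.refl (re z) (im z) _)
            (ℝ.inv-inverse _) ,ⁱ
    ℝ.solve 3 (λ a b n → a :* n :* b :+ :- b :* n :* a := con (+ 0)) ℝ.refl (re z) (im z) _
    where open ℝ using (con; _:+_; _:*_; _:-_; :-_; _:=_)

  recip-≠0 : ∀ {z} (z≠0 : z ≠0) → recip z z≠0 ≠0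
  recip-≠0 {z} z≠0 = nonzero (ℝ.*-cancelʳ-pos
    (ℝ.<-respʳ-≈ (ℝ.trans (normSq-cong (ℂ-Ring.sym (recip-inverse z z≠0))) (normSq-* (recip z z≠0) z))
      (_≠0.0<normSq 1≠0))
    (_≠0.0<normSq z≠0))

  infixl 7 _/_[_]
  _/_[_] : (z w : ℂ) → w ≠0 → ℂ
  z / w [ w≠0 ] = z * recip w w≠0

  infixr 8 _^ℤ_[_]
  _^ℤ_[_] : (z : ℂ) → ℤ → z ≠0 → ℂ
  z ^ℤ + n [ z≠0 ]      = z ^ n
  z ^ℤ -[1+ n ] [ z≠0 ] = recip z z≠0 ^ suc n

  infix 4 _⟶_
  _⟶_ : (ℕ → ℂ) → ℂ → Set (c ⊔ ℓ₂)
  s ⟶ l = ∀ {ε} → ℝ.0# ℝ.< ε → ∃[ N ] (∀ {n} → N ℕ.≤ n → ∣ s n - l ∣< ε)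

  partialSum : (ℕ → ℂ) → ℕ → ℂ
  partialSum f zero    = 0ℂ
  partialSum f (suc n) = partialSum f n + f n

  HasSum : (ℕ → ℂ) → ℂ → Set (c ⊔ ℓ₂)
  HasSum f S = partialSum f ⟶ S

  Summable : (ℕ → ℂ) → Set (c ⊔ ℓ₂)
  Summable f = ∃[ S ] HasSum f S

  -- ∑_{n ∈ ℤ} f n = S: both halves of the bilateral series converge.
  HasBilateralSum : (ℤ → ℂ) → ℂ → Set (c ⊔ ℓ₁ ⊔ ℓ₂)
  HasBilateralSum f S = ∃[ S₊ ] ∃[ S₋ ]
    HasSum (λ n → f (+ n)) S₊ × HasSum (λ n → f -[1+ n ]) S₋ × S₊ + S₋ ≈ S

  module Modulus where
    private
      module ℂS = ℂ-Solver
    open ℝ using (con; _:+_; _:*_; _:-_; :-_; _:=_)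

    ∣∣-cong : ∀ {z w r s} → z ≈ w → r ℝ.≈ s → ∣ z ∣< r → ∣ w ∣< s
    ∣∣-cong z≈w r≈s (0<r ,ᵐ z<r) =
      ℝ.<-respʳ-≈ r≈s 0<r ,ᵐ ℝ.<-resp (normSq-cong z≈w) (ℝ.*-cong r≈s r≈s) z<r

    ∣∣-weaken : ∀ {z r s} → r ℝ.< s → ∣ z ∣< r → ∣ z ∣< s
    ∣∣-weaken r<s (0<r ,ᵐ z<r) = ℝ.<-trans 0<r r<s ,ᵐ
      ℝ.<-trans z<r (ℝ.*-mono-< (ℝ.<-asym 0<r) r<s (ℝ.<-asym 0<r) r<s)

    ∣∣-* : ∀ {z w r s} → ∣ z ∣< r → ∣ w ∣< s → ∣ z * w ∣< r ℝ.* s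
    ∣∣-* {z} {w} {r} {s} (0<r ,ᵐ z<r) (0<s ,ᵐ w<s) = ℝ.*-pos 0<r 0<s ,ᵐ
      ℝ.<-resp (ℝ.sym (normSq-* z w))
        (ℝ.solve 2 (λ r s → r :* r :* (s :* s) := r :* s :* (r :* s)) ℝ.refl r s)
        (ℝ.*-mono-< (normSq≮0 z) z<r (normSq≮0 w) w<s)

    ∣∣-neg : ∀ {z r} → ∣ z ∣< r → ∣ - z ∣< r
    ∣∣-neg {z} (0<r ,ᵐ z<r) = 0<r ,ᵐ ℝ.<-respˡ-≈
      (ℝ.solve 2 (λ a b → a :* a :+ b :* b := :- a :* :- a :+ :- b :* :- b) ℝ.refl (re z) (im z)) z<r

    ∣∣-+ : ∀ {z w r s} → ∣ z ∣< r → ∣ w ∣< s → ∣ z + w ∣< r ℝ.+ s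
    ∣∣-+ {z} {w} {r} {s} (0<r ,ᵐ z<r) (0<s ,ᵐ w<s) = ℝ.+-pos 0<r 0<s ,ᵐ
      ℝ.<-resp
        (ℝ.solve 4 (λ a b c d →
          (a :* a :+ b :* b) :+ (c :* c :+ d :* d)
            :+ ((a :* c :+ b :* d) :+ (a :* c :+ b :* d)) :=
          (a :+ c) :* (a :+ c) :+ (b :+ d) :* (b :+ d)) ℝ.refl (re z) (im z) (re w) (im w))
        (ℝ.solve 2 (λ r s →
          r :* r :+ s :* s :+ (r :* s :+ r :* s) := (r :+ s) :* (r :+ s)) ℝ.refl r s)
        (ℝ.+-mono-< (ℝ.+-mono-< z<r w<s) (ℝ.+-mono-< inner<rs inner<rs))
      where
      inner = re z ℝ.* re w ℝ.+ im z ℝ.* im w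
      outer = re z ℝ.* im w ℝ.- im z ℝ.* re w

      inner<rs : inner ℝ.< r ℝ.* s
      inner<rs = ℝ.x*x<y*y⇒x<y (ℝ.*-pos 0<r 0<s) (ℝ.≮-<-trans
        (λ lt → ℝ.x*x≮0 outer (ℝ.<-resp
          (ℝ.solve 4 (λ a b c d →
            (a :* a :+ b :* b) :* (c :* c :+ d :* d) :- (a :* c :+ b :* d) :* (a :* c :+ b :* d) :=
            (a :* d :- b :* c) :* (a :* d :- b :* c)) ℝ.refl (re z) (im z) (re w) (im w))
          (ℝ.-‿inverseʳ _)
          (ℝ.+-monoˡ-< (ℝ.- (inner ℝ.* inner)) lt)))
        (ℝ.<-respʳ-≈
          (ℝ.solve 2 (λ r s → r :* r :* (s :* s) := r :* s :* (r :* s)) ℝ.refl r s)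
          (ℝ.*-mono-< (normSq≮0 z) z<r (normSq≮0 w) w<s)))

    re< : ∀ {z r} → ∣ z ∣< r → re z ℝ.< r
    re< {z} (0<r ,ᵐ z<r) = ℝ.x*x<y*y⇒x<y 0<r (ℝ.≮-<-trans
      (λ lt → ℝ.x*x≮0 (im z) (ℝ.<-resp
        (ℝ.solve 2 (λ a b → a :+ b :- a := b) ℝ.refl (re z ℝ.* re z) (im z ℝ.* im z))
        (ℝ.-‿inverseʳ _) (ℝ.+-monoˡ-< (ℝ.- (re z ℝ.* re z)) lt))) z<r)

    im< : ∀ {z r} → ∣ z ∣< r → im z ℝ.< r
    im< {z} (0<r ,ᵐ z<r) = re< {im z +i re z} (0<r ,ᵐ ℝ.<-respˡ-≈ (ℝ.+-comm _ _) z<r)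

    ∣z∣<1+normSq : ∀ z → ∣ z ∣< 1ℝ ℝ.+ normSq z
    ∣z∣<1+normSq z = ℝ.pos+nonneg ℝ.0<1 (normSq≮0 z) ,ᵐ ℝ.0<y-x⇒x<y (ℝ.<-respʳ-≈
      (ℝ.solve 1 (λ n → con (+ 1) :+ (n :+ n :* n) :=
        (con (+ 1) :+ n) :* (con (+ 1) :+ n) :- n) ℝ.refl (normSq z))
      (ℝ.pos+nonneg ℝ.0<1 (ℝ.nonneg+nonneg (normSq≮0 z) (ℝ.x*x≮0 (normSq z)))))

    ∣0∣< : ∀ {r} → ℝ.0# ℝ.< r → ∣ 0ℂ ∣< r
    ∣0∣< 0<r = 0<r ,ᵐ ℝ.<-respˡ-≈
      (ℝ.solve 0 (con (+ 0) := con (+ 0) :* con (+ 0) :+ con (+ 0) :* con (+ 0)) ℝ.refl)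
      (ℝ.*-pos 0<r 0<r)

    ∣1∣< : ∀ {r} → 1ℝ ℝ.< r → ∣ 1ℂ ∣< r
    ∣1∣< 1<r = ℝ.<-trans ℝ.0<1 1<r ,ᵐ ℝ.<-respˡ-≈
      (ℝ.solve 0 (con (+ 1) :* con (+ 1) :=
        con (+ 1) :* con (+ 1) :+ con (+ 0) :* con (+ 0)) ℝ.refl)
      (ℝ.*-mono-< (ℝ.<-asym ℝ.0<1) 1<r (ℝ.<-asym ℝ.0<1) 1<r)

    ∣z∣<1⇒∣z^1+n∣<1 : ∀ {z} → ∣ z ∣< 1ℝ → ∀ n → ∣ z ^ suc n ∣< 1ℝ
    ∣z∣<1⇒∣z^1+n∣<1 {z} z<1 zero    = ∣∣-cong (ℂ-Ring.sym (ℂ-Ring.*-identityʳ z)) ℝ.refl z<1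
    ∣z∣<1⇒∣z^1+n∣<1 {z} z<1 (suc n) =
      ∣∣-cong ℂ-Ring.refl (ℝ.*-identityˡ 1ℝ) (∣∣-* z<1 (∣z∣<1⇒∣z^1+n∣<1 z<1 n))

    ∣z∣<1⇒1-z≠0 : ∀ {z} → ∣ z ∣< 1ℝ → 1ℂ - z ≠0
    ∣z∣<1⇒1-z≠0 z<1 = nonzero (ℝ.pos+nonneg (ℝ.*-pos 0<1-re 0<1-re) (ℝ.x*x≮0 _))
      where 0<1-re = ℝ.x<y⇒0<y-x (re< z<1)

    ½ε<ε : ∀ {ε} → ℝ.0# ℝ.< ε → ℝ.½ ℝ.* ε ℝ.< ε
    ½ε<ε {ε} 0<ε = ℝ.<-resp (ℝ.+-identityˡ _) (ℝ.half+half ε)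
      (ℝ.+-monoˡ-< (ℝ.½ ℝ.* ε) (ℝ.*-pos ℝ.½-pos 0<ε))

    componentwise : ∀ s l → ℝ.ConvergesTo (λ n → re (s n)) (re l) →
                    ℝ.ConvergesTo (λ n → im (s n)) (im l) → s ⟶ l
    componentwise s l limʳ limⁱ {ε} 0<ε =
      let 0<½ε     = ℝ.*-pos ℝ.½-pos 0<ε
          (M , hM) = limʳ 0<½ε
          (N , hN) = limⁱ 0<½ε
      in M ℕ.⊔ N , λ M⊔N≤n → 0<ε ,ᵐ ℝ.<-trans
           (ℝ.+-mono-< (sq< (hM (ℕ.≤-trans (ℕ.m≤m⊔n M N) M⊔N≤n)))
                       (sq< (hN (ℕ.≤-trans (ℕ.m≤n⊔m M N) M⊔N≤n))))
           (ℝ.<-respˡ-≈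
             (ℝ.trans (ℝ.*-congˡ (ℝ.sym (ℝ.half+half ε))) (ℝ.distribˡ _ _ _))
             (ℝ.*-monoˡ-< 0<ε (½ε<ε 0<ε)))
      where
      sq< : ∀ {x l e} → x ℝ.< l ℝ.+ e × l ℝ.< x ℝ.+ e → (x ℝ.- l) ℝ.* (x ℝ.- l) ℝ.< e ℝ.* e
      sq< {x} {l} {e} (x<l+e , l<x+e) = ℝ.0<y-x⇒x<y (ℝ.<-respʳ-≈
        (ℝ.solve 3 (λ x l e → (l :+ e :- x) :* (x :+ e :- l) := e :* e :- (x :- l) :* (x :- l))
          ℝ.refl x l e)
        (ℝ.*-pos (ℝ.x<y⇒0<y-x x<l+e) (ℝ.x<y⇒0<y-x l<x+e)))

    complete : ∀ s → (∀ {ε} → ℝ.0# ℝ.< ε → ∃[ N ] (∀ {n} → N ℕ.≤ n → ∣ s n - s N ∣< ε)) →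
               ∃[ l ] s ⟶ l
    complete s cauchy = combine
      (ℝ.complete (λ n → re (s n)) λ 0<ε →
        let (N , h) = diff 0<ε in N , λ N≤m N≤n → shift (re< (h N≤m N≤n)))
      (ℝ.complete (λ n → im (s n)) λ 0<ε →
        let (N , h) = diff 0<ε in N , λ N≤m N≤n → shift (im< (h N≤m N≤n)))
      where
      combine : ∃[ l ] ℝ.ConvergesTo (λ n → re (s n)) l →
                ∃[ l ] ℝ.ConvergesTo (λ n → im (s n)) l → ∃[ l ] s ⟶ l
      combine (lʳ , limʳ) (lⁱ , limⁱ) = (lʳ +i lⁱ) , componentwise s (lʳ +i lⁱ) limʳ limⁱ

      diff : ∀ {ε} → ℝ.0# ℝ.< ε → ∃[ N ] (∀ {m n} → N ℕ.≤ m → N ℕ.≤ n → ∣ s m - s n ∣< ε)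
      diff {ε} 0<ε = let (N , h) = cauchy (ℝ.*-pos ℝ.½-pos 0<ε) in N , λ {m} {n} N≤m N≤n → ∣∣-cong
        (ℂS.solve 3 (λ x y z → (x ℂS.:- z) ℂS.:+ ℂS.:- (y ℂS.:- z) ℂS.:= x ℂS.:- y)
          ℂ-Ring.refl (s m) (s n) (s N))
        (ℝ.half+half ε) (∣∣-+ (h N≤m) (∣∣-neg (h N≤n)))

      shift : ∀ {x y ε} → x ℝ.- y ℝ.< ε → x ℝ.< y ℝ.+ ε
      shift {x} {y} {ε} lt = ℝ.<-resp
        (ℝ.solve 2 (λ x y → x :- y :+ y := x) ℝ.refl x y) (ℝ.+-comm ε y) (ℝ.+-monoˡ-< y lt)

  -- (a; p)_n for n ∈ ℕ
  poch : ℂ → ℂ → ℕ → ℂ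
  poch a p zero    = 1ℂ
  poch a p (suc n) = poch a p n * (1ℂ - a * p ^ n)

  module PochConvergence (a p : ℂ) (∣p∣<1 : ∣ p ∣< 1ℝ) where
    open Modulus
    open ℝ using (con; _:+_; _:*_; _:-_; :-_; _:=_)
    private
      module ℂS = ℂ-Solver
    open RawSemiringDefinitions
      (Semiring.rawSemiring (CommutativeRing.semiring ℝ.commutativeRing))
      using () renaming (_^_ to _^ʳ_)

    private
      ½ = ℝ.½

      x : ℕ → ℂ
      x j = a * p ^ j

      P : ℕ → ℂ
      P = poch a p

      0<1-normSq : ℝ.0# ℝ.< 1ℝ ℝ.- normSq p
      0<1-normSq = ℝ.x<y⇒0<y-x (ℝ.<-respʳ-≈ (ℝ.*-identityˡ 1ℝ) (∣_∣<_.normSq<r² ∣p∣<1))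

      one : ½ ℝ.+ ½ ℝ.≈ 1ℝ
      one = ℝ.½+½≈1

      mean<1 : ∀ {y} → ℝ.0# ℝ.< 1ℝ ℝ.- y → ℝ.0# ℝ.< 1ℝ ℝ.- ½ ℝ.* (1ℝ ℝ.+ y)
      mean<1 {y} 0<1-y = ℝ.<-respʳ-≈
        (ℝ.trans
          (ℝ.solve 2 (λ h y → h :* (con (+ 1) :- y) := h :+ h :- h :* (con (+ 1) :+ y)) ℝ.refl ½ y)
          (ℝ.+-congʳ one))
        (ℝ.*-pos ℝ.½-pos 0<1-y)

      r ρ : ℝ.Carrier
      r = ½ ℝ.* (1ℝ ℝ.+ normSq p)
      ρ = ½ ℝ.* (1ℝ ℝ.+ r)

      0<r : ℝ.0# ℝ.< r
      0<r = ℝ.*-pos ℝ.½-pos (ℝ.pos+nonneg ℝ.0<1 (normSq≮0 p))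

      0<ρ : ℝ.0# ℝ.< ρ
      0<ρ = ℝ.*-pos ℝ.½-pos (ℝ.+-pos ℝ.0<1 0<r)

      0<1-r : ℝ.0# ℝ.< 1ℝ ℝ.- r
      0<1-r = mean<1 0<1-normSq

      0<1-ρ : ℝ.0# ℝ.< 1ℝ ℝ.- ρ
      0<1-ρ = mean<1 0<1-r

      ∣p∣<r : ∣ p ∣< r
      ∣p∣<r = 0<r ,ᵐ ℝ.0<y-x⇒x<y (ℝ.<-respʳ-≈
        (ℝ.trans
          (ℝ.solve 2 (λ h n →
            h :* (con (+ 1) :- n) :* (h :* (con (+ 1) :- n)) :=
            h :* (con (+ 1) :+ n) :* (h :* (con (+ 1) :+ n)) :- (h :+ h) :* (h :+ h) :* n)
            ℝ.refl ½ (normSq p))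
          (ℝ.+-congˡ (ℝ.-‿cong (ℝ.trans (ℝ.*-congʳ
            (ℝ.trans (ℝ.*-cong one one) (ℝ.*-identityˡ 1ℝ))) (ℝ.*-identityˡ _)))))
        (ℝ.*-pos 0<h[1-n] 0<h[1-n]))
        where 0<h[1-n] = ℝ.*-pos ℝ.½-pos 0<1-normSq

      r#0 = ℝ.#-sym (ℝ.<⇒# 0<r)

      t δ : ℝ.Carrier
      t = ρ ℝ.* ℝ.inv r#0
      δ = ½ ℝ.* (t ℝ.- 1ℝ)

      t*r≈ρ : t ℝ.* r ℝ.≈ ρ
      t*r≈ρ = ℝ.trans (ℝ.*-assoc _ _ _)
        (ℝ.trans (ℝ.*-congˡ (ℝ.inv-inverse r#0)) (ℝ.*-identityʳ ρ))

      0<t-1 : ℝ.0# ℝ.< t ℝ.- 1ℝ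
      0<t-1 = ℝ.*-cancelʳ-pos (ℝ.<-respʳ-≈
        (ℝ.sym (ℝ.trans (ℝ.solve 2 (λ t r → (t :- con (+ 1)) :* r := t :* r :- r) ℝ.refl t r)
          (ℝ.trans (ℝ.+-cong t*r≈ρ (ℝ.-‿cong (ℝ.sym (ℝ.half+half r))))
            (ℝ.solve 2 (λ h r → h :* (con (+ 1) :+ r) :- (h :* r :+ h :* r) := h :* (con (+ 1) :- r))
              ℝ.refl ½ r))))
        (ℝ.*-pos ℝ.½-pos 0<1-r)) 0<r

      0<δ : ℝ.0# ℝ.< δ
      0<δ = ℝ.*-pos ℝ.½-pos 0<t-1

      x-bound : ∀ {e s} j → ∣ p ∣< s → ∣ x j ∣< e → ∀ k → ∣ x (k ℕ.+ j) ∣< e ℝ.* s ^ʳ k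
      x-bound {e} j ∣p∣<s ∣x∣<e zero = ∣∣-cong ℂ-Ring.refl (ℝ.sym (ℝ.*-identityʳ e)) ∣x∣<e
      x-bound {e} {s} j ∣p∣<s ∣x∣<e (suc k) = ∣∣-cong
        (ℂS.solve 3 (λ p a q → p ℂS.:* (a ℂS.:* q) ℂS.:= a ℂS.:* (p ℂS.:* q)) ℂ-Ring.refl p a (p ^ (k ℕ.+ j)))
        (ℝ.solve 3 (λ s e q → s :* (e :* q) := e :* (s :* q)) ℝ.refl s e (s ^ʳ k))
        (∣∣-* ∣p∣<s (x-bound j ∣p∣<s ∣x∣<e k))

      1^n≈1 : ∀ n → 1ℝ ^ʳ n ℝ.≈ 1ℝ
      1^n≈1 zero    = ℝ.refl
      1^n≈1 (suc n) = ℝ.trans (ℝ.*-identityˡ _) (1^n≈1 n)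

      A : ℝ.Carrier
      A = 1ℝ ℝ.+ normSq (x 0)

      small : ∃[ J ] A ℝ.* r ^ʳ J ℝ.< δ
      small = ℝ.geometric-null 0<r (ℝ.0<y-x⇒x<y 0<1-r) (∣_∣<_.0<r (∣z∣<1+normSq (x 0))) 0<δ

      J : ℕ
      J = proj₁ small

      ∣xJ∣<δ : ∣ x J ∣< δ
      ∣xJ∣<δ = ∣∣-weaken (proj₂ small)
        (≡.subst (λ j → ∣ x j ∣< A ℝ.* r ^ʳ J) (ℕ.+-identityʳ J)
          (x-bound 0 ∣p∣<r (∣z∣<1+normSq (x 0)) J))

      K : ℝ.Carrier
      K = 1ℝ ℝ.+ normSq (P J)

      factor-bound : ∀ k → ∣ 1ℂ - x (k ℕ.+ J) ∣< t
      factor-bound k = ∣∣-cong ℂ-Ring.refl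
        (ℝ.trans (ℝ.+-assoc _ _ _) (ℝ.trans (ℝ.+-congˡ (ℝ.half+half _))
          (ℝ.solve 1 (λ t → con (+ 1) :+ (t :- con (+ 1)) := t) ℝ.refl t)))
        (∣∣-+ (∣1∣< 1<1+δ) (∣∣-neg (∣∣-cong ℂ-Ring.refl
          (ℝ.trans (ℝ.*-congˡ (1^n≈1 k)) (ℝ.*-identityʳ δ)) (x-bound J ∣p∣<1 ∣xJ∣<δ k))))
        where
        1<1+δ : 1ℝ ℝ.< 1ℝ ℝ.+ δ
        1<1+δ = ℝ.<-resp (ℝ.+-identityˡ 1ℝ) (ℝ.+-comm δ 1ℝ) (ℝ.+-monoˡ-< 1ℝ 0<δ)

      P-bound : ∀ k → ∣ P (k ℕ.+ J) ∣< K ℝ.* t ^ʳ k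
      P-bound zero    = ∣∣-cong ℂ-Ring.refl (ℝ.sym (ℝ.*-identityʳ K)) (∣z∣<1+normSq (P J))
      P-bound (suc k) = ∣∣-cong ℂ-Ring.refl
        (ℝ.solve 3 (λ K t q → K :* q :* t := K :* (t :* q)) ℝ.refl K t (t ^ʳ k))
        (∣∣-* (P-bound k) (factor-bound k))

      t^*r^≈ρ^ : ∀ k → t ^ʳ k ℝ.* r ^ʳ k ℝ.≈ ρ ^ʳ k
      t^*r^≈ρ^ zero    = ℝ.*-identityˡ 1ℝ
      t^*r^≈ρ^ (suc k) = ℝ.trans
        (ℝ.solve 4 (λ t r p q → t :* p :* (r :* q) := t :* r :* (p :* q)) ℝ.refl t r _ _)
        (ℝ.*-cong t*r≈ρ (t^*r^≈ρ^ k))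

      step-bound : ∀ k → ∣ P (suc k ℕ.+ J) - P (k ℕ.+ J) ∣< K ℝ.* δ ℝ.* ρ ^ʳ k
      step-bound k = ∣∣-cong
        (ℂS.solve 2 (λ P x → ℂS.:- (P ℂS.:* x) ℂS.:= P ℂS.:* (ℂS.con (+ 1) ℂS.:- x) ℂS.:- P)
          ℂ-Ring.refl (P (k ℕ.+ J)) (x (k ℕ.+ J)))
        (ℝ.trans
          (ℝ.solve 4 (λ K d p q → K :* p :* (d :* q) := K :* d :* (p :* q)) ℝ.refl K δ _ _)
          (ℝ.*-congˡ (t^*r^≈ρ^ k)))
        (∣∣-neg (∣∣-* (P-bound k) (x-bound J ∣p∣<r ∣xJ∣<δ k)))

      1-ρ#0 = ℝ.#-sym (ℝ.<⇒# 0<1-ρ)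

      M : ℝ.Carrier
      M = K ℝ.* δ ℝ.* ℝ.inv 1-ρ#0

      0<M : ℝ.0# ℝ.< M
      0<M = ℝ.*-pos (ℝ.*-pos (∣_∣<_.0<r (∣z∣<1+normSq (P J))) 0<δ) (ℝ.inv-pos 0<1-ρ)

      M-split : ∀ k → M ℝ.* ρ ^ʳ suc k ℝ.+ K ℝ.* δ ℝ.* ρ ^ʳ k ℝ.≈ M ℝ.* ρ ^ʳ k
      M-split k = ℝ.trans
        (ℝ.+-congˡ (ℝ.*-congʳ (ℝ.sym (ℝ.trans (ℝ.*-assoc _ _ _)
          (ℝ.trans (ℝ.*-congˡ (ℝ.inv-inverse 1-ρ#0)) (ℝ.*-identityʳ _))))))
        (ℝ.solve 3 (λ M ρ q → M :* (ρ :* q) :+ M :* (con (+ 1) :- ρ) :* q := M :* q) ℝ.refl M ρ (ρ ^ʳ k))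

      tail-bound : ∀ m k → ∣ P (m ℕ.+ (k ℕ.+ J)) - P (k ℕ.+ J) ∣< M ℝ.* ρ ^ʳ k
      tail-bound zero    k = ∣∣-cong (ℂ-Ring.sym (ℂ-Ring.-‿inverseʳ _)) ℝ.refl
        (∣0∣< (ℝ.*-pos 0<M (ℝ.^-pos 0<ρ k)))
      tail-bound (suc m) k = ≡.subst (λ i → ∣ P i - P (k ℕ.+ J) ∣< M ℝ.* ρ ^ʳ k)
        (ℕ.+-suc m (k ℕ.+ J))
        (∣∣-cong
          (ℂS.solve 3 (λ x y z → (x ℂS.:- y) ℂS.:+ (y ℂS.:- z) ℂS.:= x ℂS.:- z) ℂ-Ring.refl _ _ _)
          (M-split k)
          (∣∣-+ (tail-bound m (suc k)) (step-bound k)))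

    converges : ∃[ l ] poch a p ⟶ l
    converges = complete P λ 0<ε →
      let (k , lt) = ℝ.geometric-null 0<ρ (ℝ.0<y-x⇒x<y 0<1-ρ) 0<M 0<ε
      in k ℕ.+ J , λ {n} N≤n → ∣∣-weaken lt
           (≡.subst (λ i → ∣ P i - P (k ℕ.+ J) ∣< M ℝ.* ρ ^ʳ k) (ℕ.m∸n+n≡m N≤n)
             (tail-bound (n ∸ (k ℕ.+ J)) k))

  -- Only the characterisation as a limit matters, so the proof of convergence
  -- is kept from unfolding.
  abstract
    pochLimit : ∀ a p → ∣ p ∣< 1ℝ → ∃[ l ] poch a p ⟶ l
    pochLimit a p ∣p∣<1 = PochConvergence.converges a p ∣p∣<1

  -- (a; p)_∞
  poch∞ : (a p : ℂ) → ∣ p ∣< 1ℝ → ℂ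
  poch∞ a p ∣p∣<1 = proj₁ (pochLimit a p ∣p∣<1)

  poch⟶poch∞ : ∀ a p (∣p∣<1 : ∣ p ∣< 1ℝ) → poch a p ⟶ poch∞ a p ∣p∣<1
  poch⟶poch∞ a p ∣p∣<1 = proj₂ (pochLimit a p ∣p∣<1)

  module Limits where
    open Modulus

    ⟶-cong : ∀ {s t l m} → (∀ n → s n ≈ t n) → l ≈ m → s ⟶ l → t ⟶ m
    ⟶-cong s≈t l≈m s⟶l 0<ε = let (N , h) = s⟶l 0<ε in N , λ {n} N≤n →
      ∣∣-cong (ℂ-Ring.+-cong (s≈t n) (ℂ-Ring.-‿cong l≈m)) ℝ.refl (h N≤n)

    ⟶-shift : ∀ {s l} k → s ⟶ l → (λ n → s (k ℕ.+ n)) ⟶ l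
    ⟶-shift k s⟶l 0<ε = let (N , h) = s⟶l 0<ε in N , λ {n} N≤n →
      h (ℕ.≤-trans N≤n (ℕ.m≤n+m n k))

    ⟶-*ˡ : ∀ {s l} z → s ⟶ l → (λ n → z * s n) ⟶ z * l
    ⟶-*ˡ {s} {l} z s⟶l {ε} 0<ε =
      let (N , h) = s⟶l (ℝ.*-pos (ℝ.inv-pos 0<C) 0<ε) in N , λ {n} N≤n → ∣∣-cong
        (ℂ-Solver.solve 3 (λ z s l → z ℂ-Solver.:* (s ℂ-Solver.:- l) ℂ-Solver.:=
                            z ℂ-Solver.:* s ℂ-Solver.:- z ℂ-Solver.:* l) ℂ-Ring.refl z (s n) l)
        (ℝ.trans (ℝ.sym (ℝ.*-assoc _ _ _)) (ℝ.trans (ℝ.*-congʳ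
          (ℝ.trans (ℝ.*-comm _ _) (ℝ.inv-inverse _))) (ℝ.*-identityˡ ε)))
        (∣∣-* (∣z∣<1+normSq z) (h N≤n))
      where 0<C = ∣_∣<_.0<r (∣z∣<1+normSq z)

    ⟶-unique : ∀ {s l m} → s ⟶ l → s ⟶ m → l ≈ m
    ⟶-unique {s} {l} {m} s⟶l s⟶m =
      proj₁ (ℝ.tight _ _) (λ l#m → [ apart re< close , apart re< close′ ]′ (differ (ℝ.#⇒< l#m))) ,ⁱ
      proj₁ (ℝ.tight _ _) (λ l#m → [ apart im< close , apart im< close′ ]′ (differ (ℝ.#⇒< l#m)))
      where
      close : ∀ {ε} → ℝ.0# ℝ.< ε → ∣ m - l ∣< ε
      close {ε} 0<ε =
        let (M , hM) = s⟶l (ℝ.*-pos ℝ.½-pos 0<ε)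
            (N , hN) = s⟶m (ℝ.*-pos ℝ.½-pos 0<ε)
        in ∣∣-cong
          (ℂ-Solver.solve 3 (λ s l m → (s ℂ-Solver.:- l) ℂ-Solver.:+ ℂ-Solver.:- (s ℂ-Solver.:- m)
                              ℂ-Solver.:= m ℂ-Solver.:- l) ℂ-Ring.refl (s (M ℕ.⊔ N)) l m)
          (ℝ.half+half ε)
          (∣∣-+ (hM (ℕ.m≤m⊔n M N)) (∣∣-neg (hN (ℕ.m≤n⊔m M N))))

      close′ : ∀ {ε} → ℝ.0# ℝ.< ε → ∣ l - m ∣< ε
      close′ 0<ε = ∣∣-cong
        (ℂ-Solver.solve 2 (λ l m → ℂ-Solver.:- (m ℂ-Solver.:- l) ℂ-Solver.:= l ℂ-Solver.:- m)
          ℂ-Ring.refl l m) ℝ.refl (∣∣-neg (close 0<ε))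

      differ : ∀ {x y} → x ℝ.< y ⊎ y ℝ.< x → ℝ.0# ℝ.< y ℝ.- x ⊎ ℝ.0# ℝ.< x ℝ.- y
      differ = Sum.map ℝ.x<y⇒0<y-x ℝ.x<y⇒0<y-x

      apart : {f : ℂ → ℝ.Carrier} → (∀ {z r} → ∣ z ∣< r → f z ℝ.< r) → ∀ {z} →
              (∀ {ε} → ℝ.0# ℝ.< ε → ∣ z ∣< ε) → ¬ (ℝ.0# ℝ.< f z)
      apart f< h lt = ℝ.<-irrefl ℝ.refl (f< (h lt))

  open Limits

  poch-split : ∀ a p m n → poch a p (m ℕ.+ n) ≈ poch a p m * poch (a * p ^ m) p n
  poch-split a p m zero = ℂ-Ring.trans
    (ℂ-Ring.reflexive (≡.cong (poch a p) (ℕ.+-identityʳ m))) (ℂ-Ring.sym (ℂ-Ring.*-identityʳ _))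
  poch-split a p m (suc n) = ℂ-Ring.trans
    (ℂ-Ring.reflexive (≡.cong (poch a p) (ℕ.+-suc m n)))
    (ℂ-Ring.trans
      (ℂ-Ring.*-cong (poch-split a p m n) (ℂ-Ring.+-congˡ (ℂ-Ring.-‿cong
        (ℂ-Ring.trans (ℂ-Ring.*-congˡ (^-homo-* p m n)) (ℂ-Ring.sym (ℂ-Ring.*-assoc _ _ _))))))
      (ℂ-Ring.*-assoc _ _ _))

  poch-cong : ∀ {a b} p → a ≈ b → ∀ n → poch a p n ≈ poch b p n
  poch-cong p a≈b zero    = ℂ-Ring.refl
  poch-cong p a≈b (suc n) = ℂ-Ring.*-cong (poch-cong p a≈b n)
    (ℂ-Ring.+-congˡ (ℂ-Ring.-‿cong (ℂ-Ring.*-congʳ a≈b)))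

  poch∞-cong : ∀ {a b} p ∣p∣<1 → a ≈ b → poch∞ a p ∣p∣<1 ≈ poch∞ b p ∣p∣<1
  poch∞-cong {a} {b} p ∣p∣<1 a≈b = ⟶-unique
    (⟶-cong (poch-cong p a≈b) ℂ-Ring.refl (poch⟶poch∞ a p ∣p∣<1)) (poch⟶poch∞ b p ∣p∣<1)

  poch∞-split : ∀ a p ∣p∣<1 n → poch∞ a p ∣p∣<1 ≈ poch a p n * poch∞ (a * p ^ n) p ∣p∣<1
  poch∞-split a p ∣p∣<1 n = ⟶-unique
    (⟶-cong (poch-split a p n) ℂ-Ring.refl (⟶-shift n (poch⟶poch∞ a p ∣p∣<1)))
    (⟶-*ˡ (poch a p n) (poch⟶poch∞ (a * p ^ n) p ∣p∣<1))

  module QSeries (q : ℂ) (q≠0 : q ≠0) (∣q∣<1 : ∣ q ∣< 1ℝ) where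
    open Modulus

    -- For n ∈ ℤ, (a; q)_n = (a; q)_∞ / (a qⁿ; q)_∞ is kept as the fraction
    -- pochNum a n / pochDen a n left after cancelling the factors common to the
    -- two infinite products (see pochNum/pochDen), so that it also makes sense
    -- when both products vanish.
    pochNum : ℂ → ℤ → ℂ
    pochNum a (+ n)    = poch a q n
    pochNum a -[1+ n ] = 1ℂ

    pochDen : ℂ → ℤ → ℂ
    pochDen a (+ n)    = 1ℂ
    pochDen a -[1+ n ] = poch (a * q ^ℤ -[1+ n ] [ q≠0 ]) q (suc n)

    pochNum/pochDen : ∀ a n →
      pochNum a n * poch∞ (a * q ^ℤ n [ q≠0 ]) q ∣q∣<1 ≈ pochDen a n * poch∞ a q ∣q∣<1
    pochNum/pochDen a (+ n)    = ℂ-Ring.trans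
      (ℂ-Ring.sym (poch∞-split a q ∣q∣<1 n)) (ℂ-Ring.sym (ℂ-Ring.*-identityˡ _))
    pochNum/pochDen a -[1+ n ] = ℂ-Ring.trans (ℂ-Ring.*-identityˡ _) (ℂ-Ring.trans
      (poch∞-split a′ q ∣q∣<1 (suc n))
      (ℂ-Ring.*-congˡ (poch∞-cong q ∣q∣<1 (ℂ-Ring.trans (ℂ-Ring.*-assoc _ _ _)
        (ℂ-Ring.trans (ℂ-Ring.*-congˡ (inverse^ (suc n))) (ℂ-Ring.*-identityʳ a))))))
      where
      a′ = a * q ^ℤ -[1+ n ] [ q≠0 ]

      inverse^ : ∀ k → recip q q≠0 ^ k * q ^ k ≈ 1ℂ
      inverse^ zero    = ℂ-Ring.*-identityˡ 1ℂ
      inverse^ (suc k) = ℂ-Ring.trans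
        (ℂ-Solver.solve 4 (λ x y u v → x ℂ-Solver.:* u ℂ-Solver.:* (y ℂ-Solver.:* v) ℂ-Solver.:=
                            x ℂ-Solver.:* y ℂ-Solver.:* (u ℂ-Solver.:* v)) ℂ-Ring.refl _ _ _ _)
        (ℂ-Ring.trans (ℂ-Ring.*-cong (recip-inverse q q≠0) (inverse^ k)) (ℂ-Ring.*-identityˡ 1ℂ))

    -- (a₁, …, aₘ; q)_n and its variants: products over the list of parameters
    ∏ : (ℂ → ℂ) → List ℂ → ℂ
    ∏ f []       = 1ℂ
    ∏ f (a ∷ as) = f a * ∏ f as

    ⟨_⟩∞ : List ℂ → ℂ
    ⟨ as ⟩∞ = ∏ (λ a → poch∞ a q ∣q∣<1) as

    ⟨_⟩_ : List ℂ → ℕ → ℂ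
    ⟨ as ⟩ n = ∏ (λ a → poch a q n) as

    ⟨_⟩ⁿ ⟨_⟩ᵈ : List ℂ → ℤ → ℂ
    ⟨ as ⟩ⁿ n = ∏ (λ a → pochNum a n) as
    ⟨ as ⟩ᵈ n = ∏ (λ a → pochDen a n) as

    1-q^≠0 : ∀ n → 1ℂ - q ^ suc n ≠0
    1-q^≠0 n = ∣z∣<1⇒1-z≠0 (∣z∣<1⇒∣z^1+n∣<1 ∣q∣<1 n)

    1-q≠0 : 1ℂ - q ≠0
    1-q≠0 = ∣z∣<1⇒1-z≠0 ∣q∣<1

    ∣q²∣<1 : ∣ q ^ 2 ∣< 1ℝ
    ∣q²∣<1 = ∣z∣<1⇒∣z^1+n∣<1 ∣q∣<1 1

    -- (1 - q²ⁿ⁻¹) / ((1 - qⁿ⁻¹) (1 - qⁿ)) for n = 2 + k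
    factor : ℕ → ℂ
    factor k = (1ℂ - q ^ (2 ℕ.* n ∸ 1)) / ((1ℂ - q ^ (n ∸ 1)) * (1ℂ - q ^ n))
                 [ *-≠0 (1-q^≠0 k) (1-q^≠0 (suc k)) ]
      where n = 2 ℕ.+ k

    module Parameters (b c d : ℂ) (b≠0 : b ≠0) (c≠0 : c ≠0) (d≠0 : d ≠0) where
      bc≠0  = *-≠0 b≠0 c≠0
      bd≠0  = *-≠0 b≠0 d≠0
      cd≠0  = *-≠0 c≠0 d≠0
      bcd≠0 = *-≠0 bc≠0 d≠0

      upper lower₁ lower₂ : List ℂ
      upper  = b ∷ c ∷ d ∷ []
      lower₁ = q / b [ b≠0 ] ∷ q / c [ c≠0 ] ∷ q / d [ d≠0 ] ∷ []
      lower₂ = 1ℂ / b [ b≠0 ] ∷ 1ℂ / c [ c≠0 ] ∷ 1ℂ / d [ d≠0 ] ∷ []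

      -- The denominator of (b, c, d; q)_n / (q/b, q/c, q/d; q)_n
      den₁ : ℤ → ℂ
      den₁ n = ⟨ upper ⟩ᵈ n * ⟨ lower₁ ⟩ⁿ n

      term₁ : (∀ n → den₁ n ≠0) → ℤ → ℂ
      term₁ den≠0 n = (⟨ upper ⟩ⁿ n * ⟨ lower₁ ⟩ᵈ n) / den₁ n [ den≠0 n ]
                      * (q / (b * c * d) [ bcd≠0 ]) ^ℤ n [ *-≠0 q≠0 (recip-≠0 bcd≠0) ]

      -- The series over n ≥ 2 is indexed by k = n - 2.
      term₂ : (∀ k → ⟨ lower₂ ⟩ (2 ℕ.+ k) ≠0) → ℕ → ℂ
      term₂ den≠0 k = factor k * (⟨ upper ⟩ n / ⟨ lower₂ ⟩ n [ den≠0 k ])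
                      * (1ℂ / (b * c * d) [ bcd≠0 ]) ^ n
        where n = 2 ℕ.+ k

      C₀ : (1ℂ - q) * (1ℂ - b) * (1ℂ - c) * (1ℂ - d) ≠0 → ℂ
      C₀ den≠0 =
        (2ℂ * b * c * d * q - b * c * d - b * c * q - b * d * q - c * d * q + b + c + d + q - 2ℂ)
        / ((1ℂ - q) * (1ℂ - b) * (1ℂ - c) * (1ℂ - d)) [ den≠0 ]

    term₃ : ∀ b (b≠0 : b ≠0) → (∀ k → poch (1ℂ / b [ b≠0 ]) q (2 ℕ.+ k) ^ 3 ≠0) → ℕ → ℂ
    term₃ b b≠0 den≠0 k =
      factor k * (poch b q n ^ 3 / poch (1ℂ / b [ b≠0 ]) q n ^ 3 [ den≠0 k ])
      * (1ℂ / b [ b≠0 ]) ^ (3 ℕ.* n)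
      where n = 2 ℕ.+ k

    term₄ : ℕ → ℂ
    term₄ k = factor k * (- 1ℂ) ^ n * q ^ (3 ℕ.* n ℕ.* (n ∸ 1) ℕ./ 2)
      where n = 2 ℕ.+ k

{-# OPTIONS --safe #-}

-- With β = 1/b, γ = 1/c, δ = 1/d, both series are instances of the very-well-poised ₆φ₅ series S(a)
-- with parameters a, b, c, d: (1) is a = 1, where the terms of index n and -n of the bilateral series
-- combine, and (2) is the limit a → 1/q, whose singular terms n = 0, 1 make up C₀.  A telescoping
-- identity gives
--   (1 - aqβ)(1 - aqγ)(1 - aqδ)(1 - aqβγδ) S(a) = (1 - aq)(1 - aqβγ)(1 - aqβδ)(1 - aqγδ) S(aq).
-- Iterated from a = 1, where S(q^M) → 1, it evaluates S(1); used once with a = 1/q, it reduces (2) to S(1).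
-- Since the parameters enter only through β, γ, δ, the limit b, c, d → ∞ is the case β = γ = δ = 0.
module Submission where

open import Defs
open import Algebra.Bundles using (CommutativeRing; Semiring)
import Algebra.Definitions.RawSemiring as RawSemiringDefinitions
import Algebra.Properties.CommutativeSemiring.Exp as CommutativeSemiringExp
import Algebra.Properties.Semiring.Exp as SemiringExp
open import Data.Integer.Base as ℤ using (ℤ; +_; -[1+_])
open import Data.List.Base using (List; []; _∷_)
open import Data.Nat.Base as ℕ using (ℕ; zero; suc; _∸_) renaming (_+_ to _+ℕ_)
import Data.Nat.DivMod as ℕ
import Data.Nat.Divisibility as ℕ
import Data.Nat.Properties as ℕ
import Data.Nat.Solver
open import Data.Product.Base using (_×_; _,_; proj₁; proj₂; ∃-syntax)
open import Data.Sum.Base using (_⊎_; inj₁; inj₂; [_,_]′)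
import Level
open import Relation.Binary.PropositionalEquality as ≡ using (_≡_)
import Relation.Binary.Reasoning.Setoid as SetoidReasoning
open import Relation.Nullary.Negation.Core using (contradiction)

module ℕSolver = Data.Nat.Solver.+-*-Solver

module Analysis {c ℓ₁ ℓ₂} (ℛ : RealNumbers c ℓ₁ ℓ₂) where
  open Complex ℛ
  open Modulus
  open Limits

  module ℝ where
    open RealNumbers ℛ public
    open OrderedField ℛ public
    open ℤSolver commutativeRing public
    open RawSemiringDefinitions (Semiring.rawSemiring (CommutativeRing.semiring commutativeRing)) public
      using (_^_)

  open CommutativeRing ℂ-commutativeRing public
    using (refl; sym; trans; reflexive; setoid; +-cong; +-congˡ; +-congʳ; -‿cong; -‿inverseʳ
          ; +-identityˡ; +-identityʳ; *-cong; *-congˡ; *-congʳ; *-assoc; *-comm; *-identityˡ; *-identityʳ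
          ; zeroˡ; zeroʳ)
  open ℤSolver ℂ-commutativeRing public
    using (solve; con; _:+_; _:*_; _:-_; :-_; _:=_)

  private variable
    z w : ℂ
    l m : ℂ
    s t f : ℕ → ℂ

  open SetoidReasoning setoid

  -- Division and apartness

  ≠0-cong : z ≈ w → z ≠0 → w ≠0
  ≠0-cong z≈w (nonzero p) = nonzero (ℝ.<-respʳ-≈ (normSq-cong z≈w) p)

  *-≠0⁻ˡ : z * w ≠0 → z ≠0
  *-≠0⁻ˡ {z} {w} (nonzero p) = [ (λ <0 → contradiction <0 (normSq≮0 z)) , nonzero ]′
    (ℝ.#⇒< (ℝ.x*y#0⇒x#0 (ℝ.#-sym (ℝ.<⇒# (ℝ.<-respʳ-≈ (normSq-* z w) p)))))

  *-≠0⁻ʳ : z * w ≠0 → w ≠0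
  *-≠0⁻ʳ p = *-≠0⁻ˡ (≠0-cong (*-comm _ _) p)

  recip-inverseʳ : ∀ z (z≠0 : z ≠0) → z * recip z z≠0 ≈ 1ℂ
  recip-inverseʳ z z≠0 = trans (*-comm _ _) (recip-inverse z z≠0)

  *-cancelˡ-≠0 : z ≠0 → z * l ≈ z * m → l ≈ m
  *-cancelˡ-≠0 {z} {l} {m} z≠0 eq = begin
    l                          ≈⟨ *-identityˡ l ⟨
    1ℂ * l                     ≈⟨ *-congʳ (recip-inverse z z≠0) ⟨
    recip z z≠0 * z * l        ≈⟨ *-assoc _ _ _ ⟩
    recip z z≠0 * (z * l)      ≈⟨ *-congˡ eq ⟩
    recip z z≠0 * (z * m)      ≈⟨ *-assoc _ _ _ ⟨
    recip z z≠0 * z * m        ≈⟨ *-congʳ (recip-inverse z z≠0) ⟩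
    1ℂ * m                     ≈⟨ *-identityˡ m ⟩
    m                          ∎

  /-unique : ∀ {z w l} (w≠0 : w ≠0) → w * l ≈ z → z / w [ w≠0 ] ≈ l
  /-unique {z} {w} {l} w≠0 eq = *-cancelˡ-≠0 w≠0 (begin
    w * (z * recip w w≠0)  ≈⟨ solve 3 (λ w z r → w :* (z :* r) := z :* (w :* r)) refl w z _ ⟩
    z * (w * recip w w≠0)  ≈⟨ *-congˡ (recip-inverseʳ w w≠0) ⟩
    z * 1ℂ                 ≈⟨ *-identityʳ z ⟩
    z                      ≈⟨ eq ⟨
    w * l                  ∎)

  -- Limits

  x<x+y : ∀ {x y} → ℝ.0# ℝ.< y → x ℝ.< x ℝ.+ y
  x<x+y {x} {y} 0<y = ℝ.<-resp (ℝ.+-identityˡ x) (ℝ.+-comm y x) (ℝ.+-monoˡ-< x 0<y)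

  y<x+y : ∀ {x y} → ℝ.0# ℝ.< x → y ℝ.< x ℝ.+ y
  y<x+y {x} {y} 0<x = ℝ.<-respʳ-≈ (ℝ.+-comm y x) (x<x+y 0<x)

  ⟶-const : ∀ z → (λ _ → z) ⟶ z
  ⟶-const z 0<ε = 0 , λ _ → ∣∣-cong (sym (-‿inverseʳ z)) ℝ.refl (∣0∣< 0<ε)

  ⟶-+ : s ⟶ l → t ⟶ m → (λ n → s n + t n) ⟶ l + m
  ⟶-+ {s} {l} {t} {m} s⟶l t⟶m {ε} 0<ε =
    let (M , hM) = s⟶l (ℝ.*-pos ℝ.½-pos 0<ε)
        (N , hN) = t⟶m (ℝ.*-pos ℝ.½-pos 0<ε)
    in M ℕ.⊔ N , λ {n} le → ∣∣-cong
      (solve 4 (λ s l t m → (s :- l) :+ (t :- m) := s :+ t :- (l :+ m)) refl (s n) l (t n) m)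
      (ℝ.half+half ε)
      (∣∣-+ (hM (ℕ.≤-trans (ℕ.m≤m⊔n M N) le)) (hN (ℕ.≤-trans (ℕ.m≤n⊔m M N) le)))

  ⟶-neg : s ⟶ l → (λ n → - s n) ⟶ - l
  ⟶-neg {s} {l} s⟶l 0<ε = let (N , h) = s⟶l 0<ε in N , λ {n} le → ∣∣-cong
    (solve 2 (λ s l → :- (s :- l) := :- s :- :- l) refl (s n) l) ℝ.refl (∣∣-neg (h le))

  ⟶-- : s ⟶ l → t ⟶ m → (λ n → s n - t n) ⟶ l - m
  ⟶-- s⟶l t⟶m = ⟶-+ s⟶l (⟶-neg t⟶m)

  ⟶-subsequence : ∀ (φ : ℕ → ℕ) → (∀ n → n ℕ.≤ φ n) → s ⟶ l → (λ n → s (φ n)) ⟶ l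
  ⟶-subsequence φ n≤φn s⟶l 0<ε = let (N , h) = s⟶l 0<ε in
    N , λ {n} le → h (ℕ.≤-trans le (n≤φn n))

  Bounded : (ℕ → ℂ) → Set _
  Bounded s = ∃[ B ] (∀ n → ∣ s n ∣< B)

  bounded-prefix : ∀ (s : ℕ → ℂ) N → ∃[ B ] ℝ.0# ℝ.< B × (∀ {n} → n ℕ.< N → ∣ s n ∣< B)
  bounded-prefix s zero = ℝ.1# , ℝ.0<1 , λ ()
  bounded-prefix s (suc N) = let (B , 0<B , h) = bounded-prefix s N in
    B ℝ.+ C , ℝ.+-pos 0<B 0<C , λ n<1+N →
      [ (λ n<N → ∣∣-weaken (x<x+y 0<C) (h n<N))
      , (λ n≡N → ∣∣-weaken (y<x+y 0<B) (≡.subst (λ i → ∣ s i ∣< C) (≡.sym n≡N) (∣z∣<1+normSq (s N))))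
      ]′ (ℕ.m≤n⇒m<n∨m≡n (ℕ.≤-pred n<1+N))
    where
    C = 1ℝ ℝ.+ normSq (s N)
    0<C = ∣_∣<_.0<r (∣z∣<1+normSq (s N))

  ∣∣-recentre : ∀ {ε} → ∣ z - w ∣< ε → ∣ z ∣< ε ℝ.+ (1ℝ ℝ.+ normSq w)
  ∣∣-recentre {z} {w} lt = ∣∣-cong (solve 2 (λ z w → z :- w :+ w := z) refl z w) ℝ.refl
    (∣∣-+ lt (∣z∣<1+normSq w))

  ⟶⇒bounded : s ⟶ l → Bounded s
  ⟶⇒bounded {s} {l} s⟶l =
    let (N , h)        = s⟶l ℝ.0<1
        (B , 0<B , hB) = bounded-prefix s N
    in B ℝ.+ C , λ n →
      [ (λ n<N → ∣∣-weaken (x<x+y 0<C) (hB n<N))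
      , (λ N≤n → ∣∣-weaken (y<x+y 0<B) (∣∣-recentre (h N≤n)))
      ]′ (ℕ.<-≤-connex n N)
    where
    C = ℝ.1# ℝ.+ (1ℝ ℝ.+ normSq l)
    0<C = ℝ.+-pos ℝ.0<1 (∣_∣<_.0<r (∣z∣<1+normSq l))

  bounded-* : Bounded s → Bounded t → Bounded (λ n → s n * t n)
  bounded-* (_ , hs) (_ , ht) = _ , λ n → ∣∣-* (hs n) (ht n)

  x*y⁻¹*y≈x : ∀ {x y} (0<y : ℝ.0# ℝ.< y) → x ℝ.* ℝ.inv (ℝ.#-sym (ℝ.<⇒# 0<y)) ℝ.* y ℝ.≈ x
  x*y⁻¹*y≈x 0<y = ℝ.trans (ℝ.*-assoc _ _ _) (ℝ.trans (ℝ.*-congˡ (ℝ.inv-inverse _)) (ℝ.*-identityʳ _))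

  null-* : s ⟶ 0ℂ → Bounded t → (λ n → s n * t n) ⟶ 0ℂ
  null-* {s} {t} s⟶0 (B , hB) {ε} 0<ε =
    let (N , h) = s⟶0 (ℝ.*-pos 0<ε (ℝ.inv-pos 0<B)) in N , λ {n} le → ∣∣-cong
      (solve 2 (λ s t → (s :- con (+ 0)) :* t := s :* t :- con (+ 0)) refl (s n) (t n))
      (x*y⁻¹*y≈x 0<B) (∣∣-* (h le) (hB n))
    where 0<B = ∣_∣<_.0<r (hB 0)

  ⟶⇒null : s ⟶ l → (λ n → s n - l) ⟶ 0ℂ
  ⟶⇒null {s} {l} s⟶l = ⟶-cong (λ _ → refl) (-‿inverseʳ l) (⟶-- s⟶l (⟶-const l))

  ⟶-* : s ⟶ l → t ⟶ m → (λ n → s n * t n) ⟶ l * m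
  ⟶-* {s} {l} {t} {m} s⟶l t⟶m = ⟶-cong
    (λ n → solve 4 (λ s l t m → (s :- l) :* t :+ l :* t := s :* t) refl (s n) l (t n) m)
    (+-identityˡ _)
    (⟶-+ (null-* (⟶⇒null s⟶l) (⟶⇒bounded t⟶m)) (⟶-*ˡ l t⟶m))

  ∣recip∣<2 : (z≠0 : z ≠0) → ∣ z - 1ℂ ∣< ℝ.½ → ∣ recip z z≠0 ∣< ℝ.1# ℝ.+ ℝ.1#
  ∣recip∣<2 {z} z≠0 near = 0<2 ,ᵐ ℝ.*-cancelʳ-< (_≠0.0<normSq z≠0)
    (ℝ.<-resp 1≈ (ℝ.*-comm _ _) (ℝ.*-monoˡ-< (ℝ.*-pos 0<2 0<2) ½²<normSq))
    where
    open ℝ using () renaming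
      (solve to solveℝ; con to conℝ; _:+_ to _⊕_; _:*_ to _⊗_; _:-_ to _⊖_; :-_ to ⊝_; _:=_ to _⊜_)
    0<2 = ℝ.+-pos ℝ.0<1 ℝ.0<1

    ½<re : ℝ.½ ℝ.< re z
    ½<re = ℝ.0<y-x⇒x<y (ℝ.<-respʳ-≈
      (ℝ.trans (solveℝ 2 (λ h a → h ⊖ (⊝ (a ⊕ ⊝ conℝ (+ 1))) ⊜ h ⊕ h ⊖ conℝ (+ 1) ⊕ (a ⊖ h)) ℝ.refl ℝ.½ (re z))
        (ℝ.trans (ℝ.+-congʳ (ℝ.trans (ℝ.+-congʳ ℝ.½+½≈1) (ℝ.-‿inverseʳ ℝ.1#))) (ℝ.+-identityˡ _)))
      (ℝ.x<y⇒0<y-x (re< (∣∣-neg near))))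

    ½²<normSq : ℝ.½ ℝ.* ℝ.½ ℝ.< normSq z
    ½²<normSq = ℝ.0<y-x⇒x<y (ℝ.<-respʳ-≈
      (solveℝ 3 (λ h a b → a ⊖ h ⊕ b ⊜ a ⊕ b ⊖ h) ℝ.refl (ℝ.½ ℝ.* ℝ.½) (re z ℝ.* re z) (im z ℝ.* im z))
      (ℝ.pos+nonneg (ℝ.x<y⇒0<y-x (ℝ.*-mono-< ½≮0 ½<re ½≮0 ½<re)) (ℝ.x*x≮0 (im z))))
      where ½≮0 = ℝ.<-asym ℝ.½-pos

    1≈ : ℝ.½ ℝ.* ℝ.½ ℝ.* ((ℝ.1# ℝ.+ ℝ.1#) ℝ.* (ℝ.1# ℝ.+ ℝ.1#)) ℝ.≈ normSq (recip z z≠0) ℝ.* normSq z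
    1≈ = ℝ.trans (solveℝ 1 (λ h → h ⊗ h ⊗ ((conℝ (+ 1) ⊕ conℝ (+ 1)) ⊗ (conℝ (+ 1) ⊕ conℝ (+ 1)))
                              ⊜ (h ⊕ h) ⊗ (h ⊕ h)) ℝ.refl ℝ.½)
      (ℝ.trans (ℝ.*-cong ℝ.½+½≈1 ℝ.½+½≈1)
      (ℝ.trans (solveℝ 0 (conℝ (+ 1) ⊗ conℝ (+ 1) ⊜ conℝ (+ 1) ⊗ conℝ (+ 1) ⊕ conℝ (+ 0) ⊗ conℝ (+ 0)) ℝ.refl)
      (ℝ.trans (normSq-cong (sym (recip-inverse z z≠0))) (normSq-* (recip z z≠0) z))))

  ⟶-recip : (s≠0 : ∀ n → s n ≠0) → s ⟶ 1ℂ → (λ n → recip (s n) (s≠0 n)) ⟶ 1ℂ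
  ⟶-recip {s} s≠0 s⟶1 {ε} 0<ε =
    let (M , hM) = s⟶1 (ℝ.*-pos ℝ.½-pos 0<ε)
        (N , hN) = s⟶1 ℝ.½-pos
    in M ℕ.⊔ N , λ {n} le → ∣∣-cong
      (trans (solve 2 (λ r s → r :* :- (s :- con (+ 1)) := r :- r :* s) refl (recip (s n) (s≠0 n)) (s n))
        (+-congˡ (-‿cong (recip-inverse (s n) (s≠0 n)))))
      (ℝ.trans (ℝ.trans (ℝ.distribʳ _ ℝ.1# ℝ.1#) (ℝ.+-cong (ℝ.*-identityˡ _) (ℝ.*-identityˡ _))) (ℝ.half+half ε))
      (∣∣-* (∣recip∣<2 (s≠0 n) (hN (ℕ.≤-trans (ℕ.m≤n⊔m M N) le)))
        (∣∣-neg (hM (ℕ.≤-trans (ℕ.m≤m⊔n M N) le))))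

  ∣limit∣< : ∀ {B ε} → s ⟶ l → (∀ n → ∣ s n ∣< B) → ℝ.0# ℝ.< ε → ∣ l ∣< B ℝ.+ ε
  ∣limit∣< {s} {l} s⟶l hB 0<ε = let (N , h) = s⟶l 0<ε in ∣∣-cong
    (solve 2 (λ s l → s :+ :- (s :- l) := l) refl (s N) l) ℝ.refl (∣∣-+ (hB N) (∣∣-neg (h ℕ.≤-refl)))

  -- Geometric domination

  ∣z∣<1⇒∣z∣<r<1 : ∣ z ∣< 1ℝ → ∃[ r ] ∣ z ∣< r × r ℝ.< ℝ.1#
  ∣z∣<1⇒∣z∣<r<1 {z} (_ ,ᵐ n<1) = r , (0<r ,ᵐ n<r²) , r<1
    where
    open ℝ using () renaming
      (solve to solveℝ; con to conℝ; _:+_ to _⊕_; _:*_ to _⊗_; _:-_ to _⊖_; _:=_ to _⊜_)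
    n = normSq z
    r = ℝ.½ ℝ.* (ℝ.1# ℝ.+ n)
    0<r = ℝ.*-pos ℝ.½-pos (ℝ.pos+nonneg ℝ.0<1 (normSq≮0 z))
    0<½[1-n] : ℝ.0# ℝ.< ℝ.½ ℝ.* (ℝ.1# ℝ.- n)
    0<½[1-n] = ℝ.*-pos ℝ.½-pos (ℝ.x<y⇒0<y-x (ℝ.<-respʳ-≈ (ℝ.*-identityˡ ℝ.1#) n<1))

    -- r is the mean of 1 and n, and r² - n = (½ (1 - n))².
    n<r² : n ℝ.< r ℝ.* r
    n<r² = ℝ.0<y-x⇒x<y (ℝ.<-respʳ-≈
      (ℝ.trans
        (solveℝ 2 (λ h n → h ⊗ (conℝ (+ 1) ⊖ n) ⊗ (h ⊗ (conℝ (+ 1) ⊖ n))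
          ⊜ h ⊗ (conℝ (+ 1) ⊕ n) ⊗ (h ⊗ (conℝ (+ 1) ⊕ n)) ⊖ (h ⊕ h) ⊗ (h ⊕ h) ⊗ n) ℝ.refl ℝ.½ n)
        (ℝ.+-congˡ (ℝ.-‿cong (ℝ.trans (ℝ.*-congʳ
          (ℝ.trans (ℝ.*-cong ℝ.½+½≈1 ℝ.½+½≈1) (ℝ.*-identityˡ ℝ.1#))) (ℝ.*-identityˡ n)))))
      (ℝ.*-pos 0<½[1-n] 0<½[1-n]))
    r<1 : r ℝ.< ℝ.1#
    r<1 = ℝ.0<y-x⇒x<y (ℝ.<-respʳ-≈
      (ℝ.trans (solveℝ 2 (λ h n → h ⊗ (conℝ (+ 1) ⊖ n) ⊜ (h ⊕ h) ⊖ h ⊗ (conℝ (+ 1) ⊕ n)) ℝ.refl ℝ.½ n)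
        (ℝ.+-congʳ ℝ.½+½≈1))
      0<½[1-n])

  record Geometric (f : ℕ → ℂ) : Set (c Level.⊔ ℓ₁ Level.⊔ ℓ₂) where
    constructor geometric
    field
      {ρ K} : ℝ.Carrier
      0<ρ   : ℝ.0# ℝ.< ρ
      ρ<1   : ρ ℝ.< ℝ.1#
      bound : ∀ n → ∣ f n ∣< K ℝ.* ρ ℝ.^ n

    0<K : ℝ.0# ℝ.< K
    0<K = ℝ.<-respʳ-≈ (ℝ.*-identityʳ K) (∣_∣<_.0<r (bound 0))

  geometric-cong : (∀ n → s n ≈ t n) → Geometric s → Geometric t
  geometric-cong s≈t (geometric 0<ρ ρ<1 bound) =
    geometric 0<ρ ρ<1 (λ n → ∣∣-cong (s≈t n) ℝ.refl (bound n))

  geometric-bounded-* : Geometric s → Bounded t → Geometric (λ n → s n * t n)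
  geometric-bounded-* (geometric {ρ} {K} 0<ρ ρ<1 bound) (B , h) = geometric {K = K ℝ.* B} 0<ρ ρ<1
    λ n → ∣∣-cong refl
      (ℝ.solve 3 (λ K p B → K ℝ.:* p ℝ.:* B ℝ.:= K ℝ.:* B ℝ.:* p) ℝ.refl K (ρ ℝ.^ n) B)
      (∣∣-* (bound n) (h n))

  ∣ratio∣<⇒bound : ∀ {f r : ℕ → ℂ} {K ρ} → (∀ n → f (suc n) ≈ r n * f n) → (∀ n → ∣ r n ∣< ρ) →
                   ∣ f 0 ∣< K → ∀ n → ∣ f n ∣< K ℝ.* ρ ℝ.^ n
  ∣ratio∣<⇒bound step r< f0< zero    = ∣∣-cong refl (ℝ.sym (ℝ.*-identityʳ _)) f0<
  ∣ratio∣<⇒bound step r< f0< (suc n) = ∣∣-cong (sym (step n))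
    (ℝ.solve 3 (λ K ρ p → ρ ℝ.:* (K ℝ.:* p) ℝ.:= K ℝ.:* (ρ ℝ.:* p)) ℝ.refl _ _ _)
    (∣∣-* (r< n) (∣ratio∣<⇒bound step r< f0< n))

  geometric-suc⁻ : Geometric (λ n → f (suc n)) → Geometric f
  geometric-suc⁻ {f} g@(geometric {ρ} {K} 0<ρ ρ<1 bound) = geometric 0<ρ ρ<1 bound′
    where
    K/ρ = K ℝ.* ℝ.inv (ℝ.#-sym (ℝ.<⇒# 0<ρ))
    C = ℝ.1# ℝ.+ normSq (f 0)
    0<C = ∣_∣<_.0<r (∣z∣<1+normSq (f 0))
    bound′ : ∀ n → ∣ f n ∣< (K/ρ ℝ.+ C) ℝ.* ρ ℝ.^ n
    bound′ zero = ∣∣-weaken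
      (ℝ.<-respʳ-≈ (ℝ.sym (ℝ.*-identityʳ _)) (y<x+y (ℝ.*-pos (Geometric.0<K g) (ℝ.inv-pos 0<ρ))))
      (∣z∣<1+normSq (f 0))
    bound′ (suc n) = ∣∣-weaken
      (ℝ.<-resp
        (ℝ.trans (ℝ.sym (ℝ.*-assoc K/ρ ρ (ρ ℝ.^ n))) (ℝ.*-congʳ (x*y⁻¹*y≈x 0<ρ))) ℝ.refl
        (ℝ.*-monoˡ-< (ℝ.^-pos 0<ρ (suc n)) (x<x+y 0<C)))
      (bound n)

  geometric-shift⁻ : ∀ N → Geometric (λ n → f (N +ℕ n)) → Geometric f
  geometric-shift⁻ zero    g = g
  geometric-shift⁻ {f} (suc N) g = geometric-suc⁻ (geometric-shift⁻ {λ n → f (suc n)} N g)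

  abstract
    ratio-test : ∀ {f r : ℕ → ℂ} {e} → (∀ n → f (suc n) ≈ r n * f n) → r ⟶ e → ∣ e ∣< 1ℝ → Geometric f
    ratio-test {f} {r} {e} step r⟶e ∣e∣<1 = conclude (∣z∣<1⇒∣z∣<r<1 ∣e∣<1)
      where
      conclude : ∃[ ρ₀ ] ∣ e ∣< ρ₀ × ρ₀ ℝ.< ℝ.1# → Geometric f
      conclude (ρ₀ , ∣e∣<ρ₀ , ρ₀<1) = eventually (r⟶e 0<gap)
        where
        gap : ℝ.Carrier
        gap = ℝ.½ ℝ.* (ℝ.1# ℝ.- ρ₀)

        0<gap : ℝ.0# ℝ.< gap
        0<gap = ℝ.*-pos ℝ.½-pos (ℝ.x<y⇒0<y-x ρ₀<1)

        ρ<1 : gap ℝ.+ ρ₀ ℝ.< ℝ.1#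
        ρ<1 = ℝ.<-respʳ-≈ (ℝ.solve 2 (λ x y → x ℝ.:- y ℝ.:+ y ℝ.:= x) ℝ.refl ℝ.1# ρ₀)
          (ℝ.+-monoˡ-< ρ₀ (½ε<ε (ℝ.x<y⇒0<y-x ρ₀<1)))

        eventually : ∃[ N ] (∀ {n} → N ℕ.≤ n → ∣ r n - e ∣< gap) → Geometric f
        eventually (N , close) = geometric-shift⁻ N
          (geometric (ℝ.+-pos 0<gap (∣_∣<_.0<r ∣e∣<ρ₀)) ρ<1
            (∣ratio∣<⇒bound
              (λ n → trans (reflexive (≡.cong f (ℕ.+-suc N n))) (step (N +ℕ n)))
              (λ n → ∣∣-cong (solve 2 (λ r e → r :- e :+ e := r) refl (r (N +ℕ n)) e) ℝ.refl
                (∣∣-+ (close (ℕ.m≤m+n N n)) ∣e∣<ρ₀))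
              (∣z∣<1+normSq (f (N +ℕ 0)))))

  module GeometricSeries {f : ℕ → ℂ} {ρ K} (0<ρ : ℝ.0# ℝ.< ρ) (ρ<1 : ρ ℝ.< ℝ.1#)
                         (bound : ∀ n → ∣ f n ∣< K ℝ.* ρ ℝ.^ n) where
    open ℝ using () renaming
      (solve to solveℝ; con to conℝ; _:+_ to _⊕_; _:*_ to _⊗_; _:-_ to _⊖_; _:=_ to _⊜_)

    0<1-ρ = ℝ.x<y⇒0<y-x ρ<1

    C : ℝ.Carrier
    C = K ℝ.* ℝ.inv (ℝ.#-sym (ℝ.<⇒# 0<1-ρ))

    0<C : ℝ.0# ℝ.< C
    0<C = ℝ.*-pos (Geometric.0<K (geometric 0<ρ ρ<1 bound)) (ℝ.inv-pos 0<1-ρ)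

    -- The exact geometric bound has 1 - ρᵐ for 2 - ρᵐ, which fails to be strict at m = 0.
    ∣tail∣< : ∀ k m → ∣ partialSum f (m +ℕ k) - partialSum f k ∣<
              C ℝ.* ρ ℝ.^ k ℝ.* (ℝ.1# ℝ.+ ℝ.1# ℝ.- ρ ℝ.^ m)
    ∣tail∣< k zero = ∣∣-cong (sym (-‿inverseʳ _))
      (solveℝ 1 (λ x → x ⊜ x ⊗ (conℝ (+ 1) ⊕ conℝ (+ 1) ⊖ conℝ (+ 1))) ℝ.refl _)
      (∣0∣< (ℝ.*-pos 0<C (ℝ.^-pos 0<ρ k)))
    ∣tail∣< k (suc m) = ∣∣-cong
      (solve 3 (λ x y z → x :- z :+ y := x :+ y :- z) refl _ _ _)
      (ℝ.trans
        (ℝ.+-congˡ (ℝ.trans (ℝ.*-congˡ (^-+ m)) (ℝ.*-congʳ (ℝ.sym (x*y⁻¹*y≈x 0<1-ρ)))))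
        (solveℝ 4 (λ C ρ p r → C ⊗ p ⊗ (conℝ (+ 1) ⊕ conℝ (+ 1) ⊖ r) ⊕ C ⊗ (conℝ (+ 1) ⊖ ρ) ⊗ (r ⊗ p)
          ⊜ C ⊗ p ⊗ (conℝ (+ 1) ⊕ conℝ (+ 1) ⊖ ρ ⊗ r)) ℝ.refl C ρ (ρ ℝ.^ k) (ρ ℝ.^ m)))
      (∣∣-+ (∣tail∣< k m) (bound (m +ℕ k)))
      where
      ^-+ : ∀ m → ρ ℝ.^ (m +ℕ k) ℝ.≈ ρ ℝ.^ m ℝ.* ρ ℝ.^ k
      ^-+ zero    = ℝ.sym (ℝ.*-identityˡ _)
      ^-+ (suc m) = ℝ.trans (ℝ.*-congˡ (^-+ m)) (ℝ.sym (ℝ.*-assoc _ _ _))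

    ∣tail∣<2C : ∀ k m → ∣ partialSum f (m +ℕ k) - partialSum f k ∣< (C ℝ.+ C) ℝ.* ρ ℝ.^ k
    ∣tail∣<2C k m = ∣∣-weaken
      (ℝ.0<y-x⇒x<y (ℝ.<-respʳ-≈
        (solveℝ 3 (λ C p r → C ⊗ p ⊗ r ⊜ (C ⊕ C) ⊗ p ⊖ C ⊗ p ⊗ (conℝ (+ 1) ⊕ conℝ (+ 1) ⊖ r)) ℝ.refl C (ρ ℝ.^ k) (ρ ℝ.^ m))
        (ℝ.*-pos (ℝ.*-pos 0<C (ℝ.^-pos 0<ρ k)) (ℝ.^-pos 0<ρ m))))
      (∣tail∣< k m)

    ∣partialSum∣<2C : ∀ n → ∣ partialSum f n ∣< C ℝ.+ C
    ∣partialSum∣<2C n = ∣∣-cong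
      (trans (reflexive (≡.cong (λ i → partialSum f i - 0ℂ) (ℕ.+-identityʳ n)))
        (solve 1 (λ x → x :- con (+ 0) := x) refl _))
      (ℝ.*-identityʳ _) (∣tail∣<2C 0 n)

    summable : Summable f
    summable = complete (partialSum f) λ 0<ε →
      let (k , lt) = ℝ.geometric-null 0<ρ ρ<1 (ℝ.+-pos 0<C 0<C) 0<ε
      in k , λ {n} k≤n → ∣∣-weaken lt
           (≡.subst (λ i → ∣ partialSum f i - partialSum f k ∣< _) (ℕ.m∸n+n≡m k≤n) (∣tail∣<2C k (n ∸ k)))

  ∣sum∣< : ∀ {f S ρ ε} → ℝ.0# ℝ.< ρ → (ρ<1 : ρ ℝ.< ℝ.1#) → ℝ.0# ℝ.< ε →
           (∀ n → ∣ f n ∣< ℝ.½ ℝ.* (ℝ.½ ℝ.* ε) ℝ.* (ℝ.1# ℝ.- ρ) ℝ.* ρ ℝ.^ n) → HasSum f S → ∣ S ∣< ε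
  ∣sum∣< {ε = ε} 0<ρ ρ<1 0<ε bound hs = ∣∣-cong refl
    (ℝ.trans (ℝ.+-congʳ (ℝ.trans (ℝ.+-cong C≈ C≈) (ℝ.half+half _))) (ℝ.half+half ε))
    (∣limit∣< hs ∣partialSum∣<2C (ℝ.*-pos ℝ.½-pos 0<ε))
    where
    open GeometricSeries 0<ρ ρ<1 bound
    C≈ : C ℝ.≈ ℝ.½ ℝ.* (ℝ.½ ℝ.* ε)
    C≈ = ℝ.trans (ℝ.solve 3 (λ x y i → x ℝ.:* y ℝ.:* i ℝ.:= x ℝ.:* i ℝ.:* y) ℝ.refl _ _ _) (x*y⁻¹*y≈x 0<1-ρ)

  module _ {x σ : ℕ → ℂ} {h core factor : ℕ → ℕ → ℂ} {R D}
           (h-step : ∀ M k → h M (suc k) ≈ x M * core M k * h M k)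
           (∣core∣<R : ∀ M k → ∣ core M k ∣< R) (∣factor∣<D : ∀ M k → ∣ factor M k ∣< D) where

    private
      ½<1 : ℝ.½ ℝ.< ℝ.1#
      ½<1 = ℝ.<-respʳ-≈ ℝ.½+½≈1 (x<x+y ℝ.½-pos)

      0<R = ∣_∣<_.0<r (∣core∣<R 0 0)
      0<D = ∣_∣<_.0<r (∣factor∣<D 0 0)

      ∣z-0∣<⇒∣z∣< : ∀ {z r} → ∣ z - 0ℂ ∣< r → ∣ z ∣< r
      ∣z-0∣<⇒∣z∣< {z} = ∣∣-cong (solve 1 (λ z → z :- con (+ 0) := z) refl z) ℝ.refl

      ∣term∣< : ∀ {K} M → ∣ x M ∣< ℝ.½ ℝ.* ℝ.inv (ℝ.#-sym (ℝ.<⇒# 0<R)) →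
                ∣ h M 0 ∣< K ℝ.* ℝ.inv (ℝ.#-sym (ℝ.<⇒# 0<D)) →
                ∀ k → ∣ factor M k * h M k ∣< K ℝ.* ℝ.½ ℝ.^ k
      ∣term∣< {K} M ∣x∣< ∣h0∣< k = ∣∣-cong (*-comm (h M k) (factor M k))
        (ℝ.trans (ℝ.solve 3 (λ a p d → a ℝ.:* p ℝ.:* d ℝ.:= a ℝ.:* d ℝ.:* p) ℝ.refl
            (K ℝ.* ℝ.inv (ℝ.#-sym (ℝ.<⇒# 0<D))) (ℝ.½ ℝ.^ k) D)
          (ℝ.*-congʳ (x*y⁻¹*y≈x 0<D)))
        (∣∣-* (∣ratio∣<⇒bound {h M} {λ k → x M * core M k} (h-step M)
            (λ k → ∣∣-cong refl (x*y⁻¹*y≈x 0<R) (∣∣-* ∣x∣< (∣core∣<R M k))) ∣h0∣< k)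
          (∣factor∣<D M k))

    sums-null : x ⟶ 0ℂ → (λ M → h M 0) ⟶ 0ℂ → (∀ M → HasSum (λ k → factor M k * h M k) (σ M)) → σ ⟶ 0ℂ
    sums-null x⟶0 h0⟶0 hasSum {ε} 0<ε = N₁ ℕ.⊔ N₂ , λ {M} le → ∣∣-cong
        (solve 1 (λ z → z := z :- con (+ 0)) refl (σ M)) ℝ.refl
        (∣sum∣< ℝ.½-pos ½<1 0<ε
          (∣term∣< M (∣z-0∣<⇒∣z∣< (proj₂ small-x (ℕ.≤-trans (ℕ.m≤m⊔n N₁ N₂) le)))
                     (∣z-0∣<⇒∣z∣< (proj₂ small-h (ℕ.≤-trans (ℕ.m≤n⊔m N₁ N₂) le))))
          (hasSum M))
      where
      0<K = ℝ.*-pos (ℝ.*-pos ℝ.½-pos (ℝ.*-pos ℝ.½-pos 0<ε)) (ℝ.x<y⇒0<y-x ½<1)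
      small-x = x⟶0 (ℝ.*-pos ℝ.½-pos (ℝ.inv-pos 0<R))
      small-h = h0⟶0 (ℝ.*-pos 0<K (ℝ.inv-pos 0<D))
      N₁ = proj₁ small-x
      N₂ = proj₁ small-h

  abstract
    geometric⇒summable : Geometric f → Summable f
    geometric⇒summable (geometric 0<ρ ρ<1 bound) = GeometricSeries.summable 0<ρ ρ<1 bound

  summable⇒null : ∀ {S} → HasSum f S → f ⟶ 0ℂ
  summable⇒null {f} {S} hs = ⟶-cong (λ n → solve 2 (λ p f → p :+ f :- p := f) refl (partialSum f n) (f n))
    (-‿inverseʳ S) (⟶-- (⟶-shift 1 hs) hs)

  geometric⇒null : Geometric f → f ⟶ 0ℂ
  geometric⇒null g = summable⇒null (proj₂ (geometric⇒summable g))

  ^-geometric : ∣ z ∣< 1ℝ → Geometric (z ^_)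
  ^-geometric {z} ∣z∣<1 = ratio-test (λ _ → refl) (⟶-const z) ∣z∣<1

  hasSum-+ : ∀ {S T} → HasSum s S → HasSum t T → HasSum (λ n → s n + t n) (S + T)
  hasSum-+ {s} {t} hs ht = ⟶-cong partialSum-+ refl (⟶-+ hs ht)
    where
    partialSum-+ : ∀ n → partialSum s n + partialSum t n ≈ partialSum (λ n → s n + t n) n
    partialSum-+ zero    = +-identityˡ 0ℂ
    partialSum-+ (suc n) = trans
      (solve 4 (λ p q x y → p :+ x :+ (q :+ y) := p :+ q :+ (x :+ y)) refl _ _ _ _)
      (+-congʳ (partialSum-+ n))

  partialSum-cong : (∀ n → s n ≈ t n) → ∀ n → partialSum s n ≈ partialSum t n
  partialSum-cong s≈t zero    = refl
  partialSum-cong s≈t (suc n) = +-cong (partialSum-cong s≈t n) (s≈t n)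

  partialSum-suc : ∀ (f : ℕ → ℂ) n → partialSum f (suc n) ≈ f 0 + partialSum (λ n → f (suc n)) n
  partialSum-suc f zero    = solve 1 (λ x → con (+ 0) :+ x := x :+ con (+ 0)) refl (f 0)
  partialSum-suc f (suc n) = trans (+-congʳ (partialSum-suc f n))
    (solve 3 (λ x p y → x :+ p :+ y := x :+ (p :+ y)) refl _ _ _)

  hasSum-suc⁻ : ∀ {S} → HasSum (λ n → f (suc n)) S → HasSum f (f 0 + S)
  hasSum-suc⁻ {f} {S} hs 0<ε = let (N , h) = ⟶-+ (⟶-const (f 0)) hs 0<ε in suc N , reindex h
    where
    reindex : ∀ {N ε} → (∀ {n} → N ℕ.≤ n → ∣ f 0 + partialSum (λ n → f (suc n)) n - (f 0 + S) ∣< ε) →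
              ∀ {n} → suc N ℕ.≤ n → ∣ partialSum f n - (f 0 + S) ∣< ε
    reindex h {suc n} (ℕ.s≤s N≤n) = ∣∣-cong (+-congʳ (sym (partialSum-suc f n))) ℝ.refl (h N≤n)

module Pochhammer {c ℓ₁ ℓ₂} (ℛ : RealNumbers c ℓ₁ ℓ₂) (p : Complex.ℂ ℛ)
                  (∣p∣<1 : Complex.∣_∣<_ ℛ p (Complex.1ℝ ℛ)) where
  open Complex ℛ
  open Modulus
  open Limits
  open Analysis ℛ
  open SetoidReasoning setoid

  ^-null : (p ^_) ⟶ 0ℂ
  ^-null = geometric⇒null (^-geometric ∣p∣<1)

  1-z*p^⟶1 : ∀ z → (λ n → 1ℂ - z * p ^ n) ⟶ 1ℂ
  1-z*p^⟶1 z = ⟶-cong (λ _ → refl) (solve 1 (λ z → con (+ 1) :- z :* con (+ 0) := con (+ 1)) refl z)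
    (⟶-- (⟶-const 1ℂ) (⟶-*ˡ z ^-null))

  poch∞-first : ∀ z → poch∞ z p ∣p∣<1 ≈ (1ℂ - z) * poch∞ (p * z) p ∣p∣<1
  poch∞-first z = trans (poch∞-split z p ∣p∣<1 1) (*-cong
    (solve 1 (λ z → con (+ 1) :* (con (+ 1) :- z :* con (+ 1)) := con (+ 1) :- z) refl z)
    (poch∞-cong p ∣p∣<1 (solve 2 (λ z p → z :* (p :* con (+ 1)) := p :* z) refl z p)))

  module _ (a : ℂ) (factor≠0 : ∀ n → 1ℂ - a * p ^ n ≠0) where
    private
      r : ℕ → ℂ
      r n = recip (1ℂ - a * p ^ n) (factor≠0 n)

      poch⁻¹ : ℕ → ℂ
      poch⁻¹ zero    = 1ℂ
      poch⁻¹ (suc n) = r n * poch⁻¹ n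

      difference : ℕ → ℂ
      difference n = a * p ^ n * r n * poch⁻¹ n

      poch-inverse : ∀ n → poch a p n * poch⁻¹ n ≈ 1ℂ
      poch-inverse zero    = *-identityˡ 1ℂ
      poch-inverse (suc n) = begin
        poch a p n * (1ℂ - a * p ^ n) * (r n * poch⁻¹ n)
          ≈⟨ solve 4 (λ P f r u → P :* f :* (r :* u) := r :* f :* (P :* u)) refl _ _ _ _ ⟩
        r n * (1ℂ - a * p ^ n) * (poch a p n * poch⁻¹ n)
          ≈⟨ *-cong (recip-inverse _ (factor≠0 n)) (poch-inverse n) ⟩
        1ℂ * 1ℂ  ≈⟨ *-identityˡ 1ℂ ⟩
        1ℂ       ∎

      poch⁻¹-sum : ∀ n → 1ℂ + partialSum difference n ≈ poch⁻¹ n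
      poch⁻¹-sum zero    = +-identityʳ 1ℂ
      poch⁻¹-sum (suc n) = begin
        1ℂ + (partialSum difference n + difference n)
          ≈⟨ solve 3 (λ o s d → o :+ (s :+ d) := o :+ s :+ d) refl _ _ _ ⟩
        1ℂ + partialSum difference n + difference n
          ≈⟨ +-congʳ (poch⁻¹-sum n) ⟩
        poch⁻¹ n + difference n
          ≈⟨ +-congʳ (trans (*-congʳ (recip-inverse _ (factor≠0 n))) (*-identityˡ _)) ⟨
        r n * (1ℂ - a * p ^ n) * poch⁻¹ n + difference n
          ≈⟨ solve 3 (λ r x u → r :* (con (+ 1) :- x) :* u :+ x :* r :* u := r :* u) refl _ _ _ ⟩
        r n * poch⁻¹ n  ∎

      difference-ratio : ∀ n → difference (suc n) ≈ (p * r (suc n)) * difference n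
      difference-ratio n = solve 6 (λ a p x s r u → a :* (p :* x) :* s :* (r :* u)
        := p :* s :* (a :* x :* r :* u)) refl a p (p ^ n) (r (suc n)) (r n) (poch⁻¹ n)

      difference-summable : Summable difference
      difference-summable = geometric⇒summable (ratio-test difference-ratio
        (⟶-*ˡ p (⟶-shift 1 (⟶-recip factor≠0 (1-z*p^⟶1 a))))
        (∣∣-cong (sym (*-identityʳ p)) ℝ.refl ∣p∣<1))

    -- The reciprocals of the partial products form a series passing the ratio test.
    poch∞-≠0 : poch∞ a p ∣p∣<1 ≠0
    poch∞-≠0 = *-≠0⁻ˡ (≠0-cong (sym (⟶-unique
      (⟶-* (poch⟶poch∞ a p ∣p∣<1) (⟶-+ (⟶-const 1ℂ) (proj₂ difference-summable)))
      (⟶-cong (λ n → sym (trans (*-congˡ (poch⁻¹-sum n)) (poch-inverse n))) refl (⟶-const 1ℂ)))) 1≠0)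

module WellPoised {c ℓ₁ ℓ₂} (ℛ : RealNumbers c ℓ₁ ℓ₂) (q : Complex.ℂ ℛ)
                  (∣q∣<1 : Complex.∣_∣<_ ℛ q (Complex.1ℝ ℛ)) (β γ δ : Complex.ℂ ℛ) where
  open Complex ℛ
  open Modulus
  open Limits
  open Analysis ℛ
  open Pochhammer ℛ q ∣q∣<1
  open SetoidReasoning setoid

  s₃ : ℂ
  s₃ = β * γ * δ

  U V C : ℂ → ℂ
  U x = (β - x) * (γ - x) * (δ - x)
  V x = (1ℂ - β * x) * (1ℂ - γ * x) * (1ℂ - δ * x)
  C x = (1ℂ - x * (β * γ)) * (1ℂ - x * (β * δ)) * (1ℂ - x * (γ * δ))

  V-cong : ∀ {x y} → x ≈ y → V x ≈ V y
  V-cong x≈y = *-cong (*-cong (f β) (f γ)) (f δ)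
    where
    f : ∀ z → 1ℂ - z * _ ≈ 1ℂ - z * _
    f z = +-congˡ (-‿cong (*-congˡ x≈y))

  key-identity : ∀ x w → (w - x * s₃) * V (x * w)
                         ≈ w * (1ℂ - x * w * w) * C x - x * U w * (1ℂ - x * x * s₃ * w)
  key-identity x w = solve 5 (λ x w β γ δ →
    (w :- x :* (β :* γ :* δ)) :*
      ((con (+ 1) :- β :* (x :* w)) :* (con (+ 1) :- γ :* (x :* w)) :* (con (+ 1) :- δ :* (x :* w))) :=
    w :* (con (+ 1) :- x :* w :* w) :*
      ((con (+ 1) :- x :* (β :* γ)) :* (con (+ 1) :- x :* (β :* δ)) :* (con (+ 1) :- x :* (γ :* δ)))
    :- x :* ((β :- w) :* (γ :- w) :* (δ :- w)) :* (con (+ 1) :- x :* x :* (β :* γ :* δ) :* w))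
    refl x w β γ δ

  -- The certificate of the telescoping: with x = aq, z = qⁿ⁻¹ and w = qⁿ it says that consecutive
  -- values of (1 - w)(1 - x²s₃z)h differ by a combination of the n-th terms for a and aq.
  telescoping : ∀ {x z w v κ h g} V₀ → v * V (x * w) ≈ 1ℂ → κ * (1ℂ - q * w) ≈ 1ℂ →
    g ≈ (1ℂ - x * z) * w * V₀ * v * h →
    V₀ * (1ℂ - x * s₃) * ((1ℂ - x * z * w) * h) - C x * ((1ℂ - x * w * w) * g)
    ≈ V₀ * ((1ℂ - w) * (1ℂ - x * x * s₃ * z) * h
            - (1ℂ - q * w) * (1ℂ - x * x * s₃ * w) * ((1ℂ - x * z) * x * U w * κ * v * h))
  telescoping {x} {z} {w} {v} {κ} {h} {g} V₀ v-inv κ-inv g≈ = begin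
    V₀ * (1ℂ - x * s₃) * ((1ℂ - x * z * w) * h) - C x * ((1ℂ - x * w * w) * g)
      ≈⟨ solve 8 (λ V₀ x s z w h c g →
           V₀ :* (con (+ 1) :- x :* s) :* ((con (+ 1) :- x :* z :* w) :* h) :- c :* ((con (+ 1) :- x :* w :* w) :* g) :=
           V₀ :* h :* ((con (+ 1) :- w) :* (con (+ 1) :- x :* x :* s :* z) :+ (con (+ 1) :- x :* z) :* (w :- x :* s))
             :- c :* ((con (+ 1) :- x :* w :* w) :* g)) refl V₀ x s₃ z w h (C x) g ⟩
    V₀ * h * ((1ℂ - w) * (1ℂ - x * x * s₃ * z) + (1ℂ - x * z) * (w - x * s₃))
      - C x * ((1ℂ - x * w * w) * g)
      ≈⟨ +-cong (*-congˡ (+-congˡ (*-congˡ w-xs₃≈))) (-‿cong (*-congˡ (*-congˡ g≈))) ⟩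
    V₀ * h * ((1ℂ - w) * (1ℂ - x * x * s₃ * z)
        + (1ℂ - x * z) * (v * (w * (1ℂ - x * w * w) * C x - x * U w * (1ℂ - x * x * s₃ * w))))
      - C x * ((1ℂ - x * w * w) * ((1ℂ - x * z) * w * V₀ * v * h))
      ≈⟨ solve 9 (λ V₀ h α y v w f c u → V₀ :* h :* (α :+ y :* (v :* (w :* f :* c :- u)))
             :- c :* (f :* (y :* w :* V₀ :* v :* h)) := V₀ :* (α :* h :- y :* u :* v :* h)) refl
           V₀ h ((1ℂ - w) * (1ℂ - x * x * s₃ * z)) (1ℂ - x * z) v w (1ℂ - x * w * w) (C x)
           (x * U w * (1ℂ - x * x * s₃ * w)) ⟩
    V₀ * ((1ℂ - w) * (1ℂ - x * x * s₃ * z) * h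
      - (1ℂ - x * z) * (x * U w * (1ℂ - x * x * s₃ * w)) * v * h)
      ≈⟨ *-congˡ (+-congˡ (-‿cong (solve 6 (λ y x u e v h →
           y :* (x :* u :* e) :* v :* h := e :* (y :* x :* u :* con (+ 1) :* v :* h)) refl _ _ _ _ _ _))) ⟩
    V₀ * ((1ℂ - w) * (1ℂ - x * x * s₃ * z) * h
      - (1ℂ - x * x * s₃ * w) * ((1ℂ - x * z) * x * U w * 1ℂ * v * h))
      ≈⟨ *-congˡ (+-congˡ (-‿cong (*-congˡ (*-congʳ (*-congʳ (*-congˡ (sym κ-inv))))))) ⟩
    V₀ * ((1ℂ - w) * (1ℂ - x * x * s₃ * z) * h
      - (1ℂ - x * x * s₃ * w) * ((1ℂ - x * z) * x * U w * (κ * (1ℂ - q * w)) * v * h))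
      ≈⟨ *-congˡ (+-congˡ (-‿cong
           (solve 8 (λ e y x u κ f v h → e :* (y :* x :* u :* (κ :* f) :* v :* h) :=
                                         f :* e :* (y :* x :* u :* κ :* v :* h)) refl _ _ _ _ _ _ _ _))) ⟩
    V₀ * ((1ℂ - w) * (1ℂ - x * x * s₃ * z) * h
      - (1ℂ - q * w) * (1ℂ - x * x * s₃ * w) * ((1ℂ - x * z) * x * U w * κ * v * h))  ∎
    where
    w-xs₃≈ : w - x * s₃ ≈ v * (w * (1ℂ - x * w * w) * C x - x * U w * (1ℂ - x * x * s₃ * w))
    w-xs₃≈ = begin
      w - x * s₃                       ≈⟨ *-identityˡ _ ⟨
      1ℂ * (w - x * s₃)                ≈⟨ *-congʳ v-inv ⟨
      v * V (x * w) * (w - x * s₃)     ≈⟨ *-assoc _ _ _ ⟩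
      v * (V (x * w) * (w - x * s₃))   ≈⟨ *-congˡ (trans (*-comm _ _) (key-identity x w)) ⟩
      v * (w * (1ℂ - x * w * w) * C x - x * U w * (1ℂ - x * x * s₃ * w))  ∎

  partialSum-telescope : ∀ A B D {t t⁺ g : ℕ → ℂ} →
    (∀ k → A * t k - B * t⁺ k ≈ D * (g k - g (suc k))) →
    ∀ n → A * partialSum t n - B * partialSum t⁺ n ≈ D * (g 0 - g n)
  partialSum-telescope A B D {g = g} step zero = solve 4 (λ A B D g →
    A :* con (+ 0) :- B :* con (+ 0) := D :* (g :- g)) refl A B D (g 0)
  partialSum-telescope A B D {t} {t⁺} {g} step (suc n) = begin
    A * (partialSum t n + t n) - B * (partialSum t⁺ n + t⁺ n)
      ≈⟨ solve 6 (λ A B p q x y → A :* (p :+ x) :- B :* (q :+ y) :=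
                                  A :* p :- B :* q :+ (A :* x :- B :* y)) refl A B _ _ _ _ ⟩
    A * partialSum t n - B * partialSum t⁺ n + (A * t n - B * t⁺ n)
      ≈⟨ +-cong (partialSum-telescope A B D step n) (step n) ⟩
    D * (g 0 - g n) + D * (g n - g (suc n))
      ≈⟨ solve 4 (λ D x y z → D :* (x :- y) :+ D :* (y :- z) := D :* (x :- z)) refl D _ _ _ ⟩
    D * (g 0 - g (suc n))  ∎

  ^-+ : ∀ m n → q ^ m * q ^ n ≈ q ^ (n +ℕ m)
  ^-+ m zero    = *-identityʳ _
  ^-+ m (suc n) = trans (solve 3 (λ x y z → x :* (y :* z) := y :* (x :* z)) refl _ _ _) (*-congˡ (^-+ m n))

  q^suc*q^suc : ∀ m n → q ^ suc m * q ^ suc n ≈ q ^ suc (suc n +ℕ m)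
  q^suc*q^suc m n = trans (*-assoc _ _ _) (*-congˡ (^-+ m (suc n)))

  U-⟶ : ∀ {s : ℕ → ℂ} → s ⟶ 0ℂ → (λ n → U (s n)) ⟶ s₃
  U-⟶ s⟶0 = ⟶-cong (λ _ → refl)
    (solve 3 (λ β γ δ → (β :- con (+ 0)) :* (γ :- con (+ 0)) :* (δ :- con (+ 0)) := β :* γ :* δ) refl β γ δ)
    (⟶-* (⟶-* (⟶-- (⟶-const β) s⟶0) (⟶-- (⟶-const γ) s⟶0)) (⟶-- (⟶-const δ) s⟶0))

  ^suc-null : (λ n → q ^ suc n) ⟶ 0ℂ
  ^suc-null = ⟶-shift 1 ^-null

  1-q^suc≠0 : ∀ n → 1ℂ - q ^ suc n ≠0
  1-q^suc≠0 n = ∣z∣<1⇒1-z≠0 (∣z∣<1⇒∣z^1+n∣<1 ∣q∣<1 n)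

  κ : ℕ → ℂ
  κ n = recip (1ℂ - q ^ suc n) (1-q^suc≠0 n)

  κ-inverse : ∀ n → κ n * (1ℂ - q ^ suc n) ≈ 1ℂ
  κ-inverse n = recip-inverse _ (1-q^suc≠0 n)

  κ⟶1 : κ ⟶ 1ℂ
  κ⟶1 = ⟶-recip 1-q^suc≠0 (1-z*p^⟶1 q)

  V⟶1 : (λ n → V (q ^ suc n)) ⟶ 1ℂ
  V⟶1 = ⟶-cong (λ _ → refl) (solve 0 (con (+ 1) :* con (+ 1) :* con (+ 1) := con (+ 1)) refl)
    (⟶-* (⟶-* (f β) (f γ)) (f δ))
    where
    f : ∀ z → (λ n → 1ℂ - z * q ^ suc n) ⟶ 1ℂ
    f z = ⟶-shift 1 (1-z*p^⟶1 z)

  -- B n = ∏_{j<n} U(qʲ), which is (b, c, d; q)_n / (b c d)ⁿ when β = 1/b, γ = 1/c, δ = 1/d.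
  B : ℕ → ℂ
  B zero    = 1ℂ
  B (suc n) = B n * U (q ^ n)

  -- pochV n = (qβ, qγ, qδ; q)_n
  pochV : ℕ → ℂ
  pochV zero    = 1ℂ
  pochV (suc n) = pochV n * V (q ^ suc n)

  module Series (∣qs₃∣<1 : ∣ q * s₃ ∣< 1ℝ) (V≠0 : ∀ n → V (q ^ suc n) ≠0) where

    v : ℕ → ℂ
    v n = recip (V (q ^ suc n)) (V≠0 n)

    v-inverse : ∀ n → v n * V (q ^ suc n) ≈ 1ℂ
    v-inverse n = recip-inverse _ (V≠0 n)

    v⟶1 : v ⟶ 1ℂ
    v⟶1 = ⟶-recip V≠0 V⟶1

    -- For a = q^M the term of index n = k + 1 of the very-well-poised series is T M k = (1 - aq²ⁿ) h M k.
    x : ℕ → ℂ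
    x M = q ^ suc M

    ratio h T G : ℕ → ℕ → ℂ
    ratio M k = (1ℂ - x M * q ^ k) * x M * U (q ^ suc k) * κ (suc k) * v (suc k +ℕ M)
    h M zero    = x M * U (q ^ 0) * κ 0 * v M
    h M (suc k) = ratio M k * h M k
    T M k = (1ℂ - x M * q ^ k * q ^ suc k) * h M k
    G M k = (1ℂ - q ^ suc k) * (1ℂ - x M * x M * s₃ * q ^ k) * h M k

    h-shift : ∀ M k → (1ℂ - x M) * h (suc M) k
                      ≈ (1ℂ - x M * q ^ k) * q ^ suc k * V (x M) * v (suc k +ℕ M) * h M k
    h-shift M zero = begin
      (1ℂ - x M) * (q * x M * U (q ^ 0) * κ 0 * v (suc M))
        ≈⟨ solve 5 (λ q x u κ v → (con (+ 1) :- x) :* (q :* x :* u :* κ :* v)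
             := (con (+ 1) :- x :* con (+ 1)) :* (q :* con (+ 1)) :* v :* con (+ 1) :* (x :* u :* κ))
             refl q (x M) (U (q ^ 0)) (κ 0) (v (suc M)) ⟩
      (1ℂ - x M * 1ℂ) * (q * 1ℂ) * v (suc M) * 1ℂ * (x M * U (q ^ 0) * κ 0)
        ≈⟨ *-congʳ (*-congˡ (v-inverse M)) ⟨
      (1ℂ - x M * 1ℂ) * (q * 1ℂ) * v (suc M) * (v M * V (x M)) * (x M * U (q ^ 0) * κ 0)
        ≈⟨ solve 6 (λ a b v w V h → a :* b :* v :* (w :* V) :* h := a :* b :* V :* v :* (h :* w))
             refl _ _ _ _ _ _ ⟩
      (1ℂ - x M * 1ℂ) * (q * 1ℂ) * V (x M) * v (suc M) * (x M * U (q ^ 0) * κ 0 * v M)  ∎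
    h-shift M (suc k) = begin
      (1ℂ - x M) * (ratio (suc M) k * h (suc M) k)
        ≈⟨ solve 3 (λ a r h → a :* (r :* h) := r :* (a :* h)) refl _ _ _ ⟩
      ratio (suc M) k * ((1ℂ - x M) * h (suc M) k)
        ≈⟨ *-congˡ (h-shift M k) ⟩
      (1ℂ - q * x M * q ^ k) * (q * x M) * U (q ^ suc k) * κ (suc k) * v (suc k +ℕ suc M)
        * ((1ℂ - x M * q ^ k) * q ^ suc k * V (x M) * v (suc k +ℕ M) * h M k)
        ≡⟨ ≡.cong (λ i → (1ℂ - q * x M * q ^ k) * (q * x M) * U (q ^ suc k) * κ (suc k) * v i
             * ((1ℂ - x M * q ^ k) * q ^ suc k * V (x M) * v (suc k +ℕ M) * h M k)) (ℕ.+-suc (suc k) M) ⟩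
      (1ℂ - q * x M * q ^ k) * (q * x M) * U (q ^ suc k) * κ (suc k) * v (suc (suc k) +ℕ M)
        * ((1ℂ - x M * q ^ k) * q ^ suc k * V (x M) * v (suc k +ℕ M) * h M k)
        ≈⟨ solve 9 (λ q x z u κ v⁺ V v h →
             (con (+ 1) :- q :* x :* z) :* (q :* x) :* u :* κ :* v⁺
               :* ((con (+ 1) :- x :* z) :* (q :* z) :* V :* v :* h) :=
             (con (+ 1) :- x :* (q :* z)) :* (q :* (q :* z)) :* V :* v⁺
               :* ((con (+ 1) :- x :* z) :* x :* u :* κ :* v :* h))
             refl q (x M) (q ^ k) (U (q ^ suc k)) (κ (suc k)) (v (suc (suc k) +ℕ M))
             (V (x M)) (v (suc k +ℕ M)) (h M k) ⟩
      (1ℂ - x M * q ^ suc k) * q ^ suc (suc k) * V (x M) * v (suc (suc k) +ℕ M) * h M (suc k)  ∎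

    F H : ℕ → ℂ
    F M = V (x M) * (1ℂ - x M * s₃)
    H M = C (x M) * (1ℂ - x M)

    step : ∀ M k → F M * T M k - H M * T (suc M) k ≈ V (x M) * (G M k - G M (suc k))
    step M k = trans (+-congˡ (-‿cong (solve 6 (λ c x q z w h →
        c :* (con (+ 1) :- x) :* ((con (+ 1) :- q :* x :* z :* w) :* h) :=
        c :* ((con (+ 1) :- x :* (q :* z) :* w) :* ((con (+ 1) :- x) :* h)))
        refl (C (x M)) (x M) q (q ^ k) (q ^ suc k) (h (suc M) k))))
      (telescoping (V (x M))
        (trans (*-congˡ (V-cong (q^suc*q^suc M k))) (v-inverse (suc k +ℕ M)))
        (κ-inverse (suc k)) (h-shift M k))

    base : ∀ M → F M - H M ≈ - (V (x M) * G M 0)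
    base M = begin
      V (x M) * (1ℂ - x M * s₃) - C (x M) * (1ℂ - x M)
        ≈⟨ +-congʳ (trans (*-comm _ _) (trans (*-congˡ (V-cong (sym (*-identityʳ (x M))))) (key-identity (x M) 1ℂ))) ⟩
      1ℂ * (1ℂ - x M * 1ℂ * 1ℂ) * C (x M) - x M * U 1ℂ * (1ℂ - x M * x M * s₃ * 1ℂ) - C (x M) * (1ℂ - x M)
        ≈⟨ solve 4 (λ x c u s → con (+ 1) :* (con (+ 1) :- x :* con (+ 1) :* con (+ 1)) :* c
             :- x :* u :* (con (+ 1) :- x :* x :* s :* con (+ 1)) :- c :* (con (+ 1) :- x) :=
             :- (con (+ 1) :* con (+ 1) :* (con (+ 1) :- x :* x :* s :* con (+ 1)) :* (x :* u)))
             refl (x M) (C (x M)) (U 1ℂ) s₃ ⟩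
      - (1ℂ * 1ℂ * (1ℂ - x M * x M * s₃ * 1ℂ) * (x M * U 1ℂ))
        ≈⟨ -‿cong (*-congʳ (*-congʳ (*-cong (κ-inverse 0) (v-inverse M)))) ⟨
      - (κ 0 * (1ℂ - q ^ 1) * (v M * V (x M)) * (1ℂ - x M * x M * s₃ * 1ℂ) * (x M * U 1ℂ))
        ≈⟨ -‿cong (solve 7 (λ κ f v V g x u → κ :* f :* (v :* V) :* g :* (x :* u) :=
             V :* (f :* g :* (x :* u :* κ :* v))) refl _ _ _ _ _ _ _) ⟩
      - (V (x M) * G M 0)  ∎

    partial-step : ∀ M n → F M * (1ℂ + partialSum (T M) n) - H M * (1ℂ + partialSum (T (suc M)) n)
                           ≈ - (V (x M) * G M n)
    partial-step M n = begin
      F M * (1ℂ + partialSum (T M) n) - H M * (1ℂ + partialSum (T (suc M)) n)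
        ≈⟨ solve 4 (λ F H s t → F :* (con (+ 1) :+ s) :- H :* (con (+ 1) :+ t) :=
             F :- H :+ (F :* s :- H :* t)) refl (F M) (H M) _ _ ⟩
      F M - H M + (F M * partialSum (T M) n - H M * partialSum (T (suc M)) n)
        ≈⟨ +-cong (base M) (partialSum-telescope (F M) (H M) (V (x M)) (step M) n) ⟩
      - (V (x M) * G M 0) + V (x M) * (G M 0 - G M n)
        ≈⟨ solve 3 (λ V g g′ → :- (V :* g) :+ V :* (g :- g′) := :- (V :* g′)) refl _ _ _ ⟩
      - (V (x M) * G M n)  ∎

    ∣xs₃∣<1 : ∀ M → ∣ x M * s₃ ∣< 1ℝ
    ∣xs₃∣<1 zero    = ∣∣-cong (*-congʳ (sym (*-identityʳ q))) ℝ.refl ∣qs₃∣<1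
    ∣xs₃∣<1 (suc M) = ∣∣-cong (sym (*-assoc _ _ _)) (ℝ.*-identityˡ _) (∣∣-* ∣q∣<1 (∣xs₃∣<1 M))

    v-shift⟶1 : ∀ M → (λ k → v (suc k +ℕ M)) ⟶ 1ℂ
    v-shift⟶1 M = ⟶-subsequence (λ k → suc k +ℕ M) (λ k → ℕ.≤-trans (ℕ.n≤1+n k) (ℕ.m≤m+n (suc k) M)) v⟶1

    ratio⟶ : ∀ M → ratio M ⟶ x M * s₃
    ratio⟶ M = ⟶-cong (λ _ → refl)
      (solve 2 (λ x s → con (+ 1) :* x :* s :* con (+ 1) :* con (+ 1) := x :* s) refl (x M) s₃)
      (⟶-* (⟶-* (⟶-* (⟶-* (1-z*p^⟶1 (x M)) (⟶-const (x M))) (U-⟶ ^suc-null))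
        (⟶-shift 1 κ⟶1)) (v-shift⟶1 M))

    h-geometric : ∀ M → Geometric (h M)
    h-geometric M = ratio-test (λ _ → refl) (ratio⟶ M) (∣xs₃∣<1 M)

    T-factor-bounded : ∀ M → Bounded (λ k → 1ℂ - x M * q ^ k * q ^ suc k)
    T-factor-bounded M = ⟶⇒bounded (⟶-- (⟶-const 1ℂ) (⟶-* (⟶-*ˡ (x M) ^-null) ^suc-null))

    abstract
      T-summable : ∀ M → Summable (T M)
      T-summable M = geometric⇒summable (geometric-cong (λ _ → *-comm _ _)
        (geometric-bounded-* (h-geometric M) (T-factor-bounded M)))

    G-null : ∀ M → G M ⟶ 0ℂ
    G-null M = ⟶-cong (λ _ → *-comm _ _) refl (null-* (geometric⇒null (h-geometric M))
      (⟶⇒bounded (⟶-* (1-z*p^⟶1 q) (1-z*p^⟶1 (x M * x M * s₃)))))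

    S : ℕ → ℂ
    S M = 1ℂ + proj₁ (T-summable M)

    ⟶S : ∀ M → (λ n → 1ℂ + partialSum (T M) n) ⟶ S M
    ⟶S M = ⟶-+ (⟶-const 1ℂ) (proj₂ (T-summable M))

    S-step : ∀ M → F M * S M ≈ H M * S (suc M)
    S-step M = begin
      F M * S M                                           ≈⟨ solve 2 (λ a b → a := a :- b :+ b) refl _ _ ⟩
      F M * S M - H M * S (suc M) + H M * S (suc M)       ≈⟨ +-congʳ difference≈0 ⟩
      0ℂ + H M * S (suc M)                                ≈⟨ +-identityˡ _ ⟩
      H M * S (suc M)                                     ∎
      where
      difference≈0 : F M * S M - H M * S (suc M) ≈ 0ℂ
      difference≈0 = ⟶-unique
        (⟶-- (⟶-*ˡ (F M) (⟶S M)) (⟶-*ˡ (H M) (⟶S (suc M))))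
        (⟶-cong (λ n → sym (partial-step M n)) (solve 1 (λ v → :- (v :* con (+ 0)) := con (+ 0)) refl (V (x M)))
          (⟶-neg (⟶-*ˡ (V (x M)) (G-null M))))

    -- ∣ratio M k∣ = O(∣q∣^M) uniformly in k, so that T M is eventually dominated by 2⁻ᵏ h M 0.
    ratio-core : ℕ → ℕ → ℂ
    ratio-core M k = (1ℂ - 1ℂ * q ^ (k +ℕ suc M)) * U (q ^ suc k) * κ (suc k) * v (suc k +ℕ M)

    ratio≈ : ∀ M k → x M * ratio-core M k ≈ ratio M k
    ratio≈ M k = trans
      (solve 5 (λ x y u κ v → x :* ((con (+ 1) :- con (+ 1) :* y) :* u :* κ :* v) :=
        (con (+ 1) :- y) :* x :* u :* κ :* v) refl _ _ _ _ _)
      (*-congʳ (*-congʳ (*-congʳ (*-congʳ (+-congˡ (-‿cong (sym (^-+ (suc M) k))))))))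

    abstract
      ratio-core-bounded : ∃[ R ] (∀ M k → ∣ ratio-core M k ∣< R)
      ratio-core-bounded =
        let (_ , b₁) = ⟶⇒bounded (1-z*p^⟶1 1ℂ)
            (_ , b₂) = ⟶⇒bounded (U-⟶ ^suc-null)
            (_ , b₃) = ⟶⇒bounded κ⟶1
            (_ , b₄) = ⟶⇒bounded v⟶1
        in _ , λ M k → ∣∣-* (∣∣-* (∣∣-* (b₁ (k +ℕ suc M)) (b₂ k)) (b₃ (suc k))) (b₄ (suc k +ℕ M))

    abstract
      T-factor-uniformly-bounded : ∃[ D ] (∀ M k → ∣ 1ℂ - x M * q ^ k * q ^ suc k ∣< D)
      T-factor-uniformly-bounded =
        let (_ , b) = ⟶⇒bounded (1-z*p^⟶1 1ℂ)
        in _ , λ M k → ∣∣-cong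
          (+-congˡ (-‿cong (trans (*-identityˡ _)
            (trans (sym (^-+ (k +ℕ suc M) (suc k))) (*-congʳ (sym (^-+ (suc M) k)))))))
          ℝ.refl (b (suc k +ℕ (k +ℕ suc M)))

    h0-null : (λ M → h M 0) ⟶ 0ℂ
    h0-null = ⟶-cong (λ M → solve 4 (λ x v u κ → x :* (v :* (u :* κ)) := x :* u :* κ :* v) refl _ _ _ _) refl
      (null-* ^suc-null (bounded-* (⟶⇒bounded v⟶1) (⟶⇒bounded (⟶-const (U (q ^ 0) * κ 0)))))

    S⟶1 : S ⟶ 1ℂ
    S⟶1 = ⟶-cong (λ _ → refl) (+-identityʳ 1ℂ) (⟶-+ (⟶-const 1ℂ) (sums-null
      {x} {h = h} {ratio-core} {λ M k → 1ℂ - x M * q ^ k * q ^ suc k}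
      (λ M k → *-congʳ (sym (ratio≈ M k))) (proj₂ ratio-core-bounded) (proj₂ T-factor-uniformly-bounded)
      ^suc-null h0-null (λ M → proj₂ (T-summable M))))

    F∏ H∏ : ℕ → ℂ
    F∏ M = poch (q * β) q M * poch (q * γ) q M * poch (q * δ) q M * poch (q * s₃) q M
    H∏ M = poch q q M * poch (q * (β * γ)) q M * poch (q * (β * δ)) q M * poch (q * (γ * δ)) q M

    F∏-S : ∀ M → F∏ M * S 0 ≈ H∏ M * S M
    F∏-S zero    = refl
    F∏-S (suc M) = begin
      F∏ (suc M) * S 0
        ≈⟨ *-congʳ (solve 8 (λ a b c d e f g h → a :* e :* (b :* f) :* (c :* g) :* (d :* h) :=
             e :* f :* g :* h :* (a :* b :* c :* d)) refl _ _ _ _ _ _ _ _) ⟩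
      (1ℂ - q * β * q ^ M) * (1ℂ - q * γ * q ^ M) * (1ℂ - q * δ * q ^ M) * (1ℂ - q * s₃ * q ^ M) * F∏ M * S 0
        ≈⟨ *-congʳ (*-congʳ (*-cong (*-cong (*-cong (rearrange β) (rearrange γ)) (rearrange δ)) (rearrange′ s₃))) ⟩
      F M * F∏ M * S 0                 ≈⟨ *-assoc _ _ _ ⟩
      F M * (F∏ M * S 0)               ≈⟨ *-congˡ (F∏-S M) ⟩
      F M * (H∏ M * S M)               ≈⟨ solve 3 (λ a b c → a :* (b :* c) := b :* (a :* c)) refl _ _ _ ⟩
      H∏ M * (F M * S M)               ≈⟨ *-congˡ (S-step M) ⟩
      H∏ M * (H M * S (suc M))         ≈⟨ *-assoc _ _ _ ⟨
      H∏ M * H M * S (suc M)           ≈⟨ *-congʳ (*-congˡ (*-congʳ (*-cong (*-cong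
        (rearrange′ (β * γ)) (rearrange′ (β * δ))) (rearrange′ (γ * δ))))) ⟨
      H∏ M * ((1ℂ - q * (β * γ) * q ^ M) * (1ℂ - q * (β * δ) * q ^ M) * (1ℂ - q * (γ * δ) * q ^ M)
        * (1ℂ - q * q ^ M)) * S (suc M)
        ≈⟨ *-congʳ (solve 8 (λ a b c d e f g h → a :* b :* c :* d :* (f :* g :* h :* e) :=
             a :* e :* (b :* f) :* (c :* g) :* (d :* h)) refl _ _ _ _ _ _ _ _) ⟩
      H∏ (suc M) * S (suc M)           ∎
      where
      rearrange : ∀ z → 1ℂ - q * z * q ^ M ≈ 1ℂ - z * x M
      rearrange z = solve 3 (λ q z y → con (+ 1) :- q :* z :* y := con (+ 1) :- z :* (q :* y)) refl q z (q ^ M)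
      rearrange′ : ∀ z → 1ℂ - q * z * q ^ M ≈ 1ℂ - x M * z
      rearrange′ z = solve 3 (λ q z y → con (+ 1) :- q :* z :* y := con (+ 1) :- q :* y :* z) refl q z (q ^ M)

    sum-formula :
      poch∞ (q * β) q ∣q∣<1 * poch∞ (q * γ) q ∣q∣<1 * poch∞ (q * δ) q ∣q∣<1 * poch∞ (q * s₃) q ∣q∣<1 * S 0
      ≈ poch∞ q q ∣q∣<1 * poch∞ (q * (β * γ)) q ∣q∣<1 * poch∞ (q * (β * δ)) q ∣q∣<1 * poch∞ (q * (γ * δ)) q ∣q∣<1
    sum-formula = trans (⟶-unique
      (⟶-* (product (q * β) (q * γ) (q * δ) (q * s₃)) (⟶-const (S 0)))
      (⟶-cong (λ M → sym (F∏-S M)) refl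
        (⟶-* (product q (q * (β * γ)) (q * (β * δ)) (q * (γ * δ))) S⟶1)))
      (*-identityʳ _)
      where
      product : ∀ a b c d → (λ M → poch a q M * poch b q M * poch c q M * poch d q M) ⟶
        poch∞ a q ∣q∣<1 * poch∞ b q ∣q∣<1 * poch∞ c q ∣q∣<1 * poch∞ d q ∣q∣<1
      product a b c d = ⟶-* (⟶-* (⟶-* (poch⟶poch∞ a q ∣q∣<1) (poch⟶poch∞ b q ∣q∣<1))
        (poch⟶poch∞ c q ∣q∣<1)) (poch⟶poch∞ d q ∣q∣<1)

    h-closed : ∀ k → (1ℂ - q ^ suc k) * h 0 k * pochV (suc k) ≈ q ^ suc k * B (suc k)
    h-closed zero = begin
      (1ℂ - q ^ 1) * (q ^ 1 * U (q ^ 0) * κ 0 * v 0) * (1ℂ * V (q ^ 1))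
        ≈⟨ solve 6 (λ f x u κ v V → f :* (x :* u :* κ :* v) :* (con (+ 1) :* V) :=
             κ :* f :* (v :* V) :* (x :* (con (+ 1) :* u))) refl _ _ _ _ _ _ ⟩
      κ 0 * (1ℂ - q ^ 1) * (v 0 * V (q ^ 1)) * (q ^ 1 * (1ℂ * U (q ^ 0)))
        ≈⟨ *-congʳ (*-cong (κ-inverse 0) (v-inverse 0)) ⟩
      1ℂ * 1ℂ * (q ^ 1 * (1ℂ * U (q ^ 0)))
        ≈⟨ trans (*-congʳ (*-identityˡ 1ℂ)) (*-identityˡ _) ⟩
      q ^ 1 * (1ℂ * U (q ^ 0))  ∎
    h-closed (suc k) = begin
      (1ℂ - q ^ suc (suc k)) * (ratio 0 k * h 0 k) * (pochV (suc k) * V (q ^ suc (suc k)))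
        ≡⟨ ≡.cong (λ i → (1ℂ - q ^ suc (suc k)) * ((1ℂ - x 0 * q ^ k) * x 0 * U (q ^ suc k) * κ (suc k) * v i
             * h 0 k) * (pochV (suc k) * V (q ^ suc (suc k)))) (ℕ.+-identityʳ (suc k)) ⟩
      (1ℂ - q ^ suc (suc k)) * ((1ℂ - x 0 * q ^ k) * x 0 * U (q ^ suc k) * κ (suc k) * v (suc k) * h 0 k)
        * (pochV (suc k) * V (q ^ suc (suc k)))
        ≈⟨ solve 9 (λ f g x u κ v h p V → f :* (g :* x :* u :* κ :* v :* h) :* (p :* V) :=
             κ :* f :* (v :* V) :* (x :* u :* (g :* h :* p))) refl _ _ _ _ _ _ _ _ _ ⟩
      κ (suc k) * (1ℂ - q ^ suc (suc k)) * (v (suc k) * V (q ^ suc (suc k)))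
        * (x 0 * U (q ^ suc k) * ((1ℂ - x 0 * q ^ k) * h 0 k * pochV (suc k)))
        ≈⟨ *-cong (*-cong (κ-inverse (suc k)) (v-inverse (suc k)))
             (*-congˡ (*-congʳ (*-congʳ (+-congˡ (-‿cong (*-congʳ (*-identityʳ q))))))) ⟩
      1ℂ * 1ℂ * (x 0 * U (q ^ suc k) * ((1ℂ - q ^ suc k) * h 0 k * pochV (suc k)))
        ≈⟨ *-congˡ (*-congˡ (h-closed k)) ⟩
      1ℂ * 1ℂ * (x 0 * U (q ^ suc k) * (q ^ suc k * B (suc k)))
        ≈⟨ solve 4 (λ q u y b → con (+ 1) :* con (+ 1) :* (q :* con (+ 1) :* u :* (y :* b)) :=
             q :* y :* (b :* u)) refl q _ _ _ ⟩
      q * q ^ suc k * (B (suc k) * U (q ^ suc k))  ∎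

    -- The case a = 1/q, x = 1: all terms with index n = k + 2 ≥ 2 have a common factor 1 - aq, divided out here.
    h′ T′ G′ : ℕ → ℂ
    h′ zero    = - (U (q ^ 1) * κ 0 * κ 1 * v 0)
    h′ (suc k) = (1ℂ - 1ℂ * q ^ suc k) * 1ℂ * U (q ^ suc (suc k)) * κ (suc (suc k)) * v (suc k) * h′ k
    T′ k = (1ℂ - 1ℂ * q ^ suc k * q ^ suc (suc k)) * h′ k
    G′ k = (1ℂ - q ^ suc (suc k)) * (1ℂ - 1ℂ * 1ℂ * s₃ * q ^ suc k) * h′ k

    U1≈-V1 : U 1ℂ ≈ - V 1ℂ
    U1≈-V1 = solve 3 (λ β γ δ →
      (β :- con (+ 1)) :* (γ :- con (+ 1)) :* (δ :- con (+ 1)) :=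
      :- ((con (+ 1) :- β :* con (+ 1)) :* (con (+ 1) :- γ :* con (+ 1)) :* (con (+ 1) :- δ :* con (+ 1))))
      refl β γ δ

    h≈h′ : ∀ k → h 0 (suc k) ≈ (1ℂ - 1ℂ * q ^ suc k) * q ^ suc (suc k) * V 1ℂ * v (suc k) * h′ k
    h≈h′ zero = begin
      (1ℂ - x 0 * 1ℂ) * x 0 * U (q ^ 1) * κ 1 * v 1 * (x 0 * U 1ℂ * κ 0 * v 0)
        ≈⟨ *-congˡ (*-congʳ (*-congʳ (*-congˡ U1≈-V1))) ⟩
      (1ℂ - x 0 * 1ℂ) * x 0 * U (q ^ 1) * κ 1 * v 1 * (x 0 * - V 1ℂ * κ 0 * v 0)
        ≈⟨ solve 7 (λ q u κ₁ v₁ V κ₀ v₀ →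
             (con (+ 1) :- q :* con (+ 1) :* con (+ 1)) :* (q :* con (+ 1)) :* u :* κ₁ :* v₁
               :* (q :* con (+ 1) :* :- V :* κ₀ :* v₀) :=
             (con (+ 1) :- con (+ 1) :* (q :* con (+ 1))) :* (q :* (q :* con (+ 1))) :* V :* v₁
               :* :- (u :* κ₀ :* κ₁ :* v₀)) refl q (U (q ^ 1)) (κ 1) (v 1) (V 1ℂ) (κ 0) (v 0) ⟩
      (1ℂ - 1ℂ * q ^ 1) * q ^ 2 * V 1ℂ * v 1 * - (U (q ^ 1) * κ 0 * κ 1 * v 0)  ∎
    h≈h′ (suc k) = begin
      ratio 0 (suc k) * h 0 (suc k)
        ≡⟨ ≡.cong (λ i → (1ℂ - x 0 * q ^ suc k) * x 0 * U (q ^ suc (suc k)) * κ (suc (suc k)) * v i * h 0 (suc k))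
             (ℕ.+-identityʳ (suc (suc k))) ⟩
      (1ℂ - x 0 * q ^ suc k) * x 0 * U (q ^ suc (suc k)) * κ (suc (suc k)) * v (suc (suc k)) * h 0 (suc k)
        ≈⟨ *-congˡ (h≈h′ k) ⟩
      (1ℂ - x 0 * q ^ suc k) * x 0 * U (q ^ suc (suc k)) * κ (suc (suc k)) * v (suc (suc k))
        * ((1ℂ - 1ℂ * q ^ suc k) * q ^ suc (suc k) * V 1ℂ * v (suc k) * h′ k)
        ≈⟨ solve 9 (λ q z u κ v⁺ f V v h →
             (con (+ 1) :- q :* con (+ 1) :* z) :* (q :* con (+ 1)) :* u :* κ :* v⁺ :* (f :* (q :* z) :* V :* v :* h) :=
             (con (+ 1) :- con (+ 1) :* (q :* z)) :* (q :* (q :* z)) :* V :* v⁺ :* (f :* con (+ 1) :* u :* κ :* v :* h))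
             refl q (q ^ suc k) (U (q ^ suc (suc k))) (κ (suc (suc k))) (v (suc (suc k)))
             (1ℂ - 1ℂ * q ^ suc k) (V 1ℂ) (v (suc k)) (h′ k) ⟩
      (1ℂ - 1ℂ * q ^ suc (suc k)) * q ^ suc (suc (suc k)) * V 1ℂ * v (suc (suc k)) * h′ (suc k)  ∎

    step′ : ∀ k → V 1ℂ * (1ℂ - 1ℂ * s₃) * T′ k - C 1ℂ * T 0 (suc k) ≈ V 1ℂ * (G′ k - G′ (suc k))
    step′ k = trans
      (+-congˡ (-‿cong (*-congˡ (*-congʳ (+-congˡ (-‿cong (*-congʳ
        (solve 2 (λ q z → q :* con (+ 1) :* z := con (+ 1) :* (q :* z)) refl q (q ^ suc k)))))))))
      (telescoping (V 1ℂ) (trans (*-congˡ (V-cong (*-identityˡ _))) (v-inverse (suc k)))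
        (κ-inverse (suc (suc k))) (h≈h′ k))

    -- For β = 1/b, γ = 1/c, δ = 1/d the numerator of C₀ is - b c d times this.
    C₀-numerator : ℂ
    C₀-numerator = 1ℂ - 2ℂ * q + q * (β + γ + δ) - (β * γ + β * δ + γ * δ) - (q - 2ℂ) * s₃

    C₀-numerator-identity : (1ℂ - 1ℂ * s₃) * C₀-numerator ≈ (1ℂ - q) * C 1ℂ - V 1ℂ * (q - 1ℂ * s₃)
    C₀-numerator-identity = solve 4 (λ q β γ δ →
      (con (+ 1) :- con (+ 1) :* (β :* γ :* δ)) :*
        (con (+ 1) :- (con (+ 1) :+ con (+ 1)) :* q :+ q :* (β :+ γ :+ δ) :- (β :* γ :+ β :* δ :+ γ :* δ)
          :- (q :- (con (+ 1) :+ con (+ 1))) :* (β :* γ :* δ)) :=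
      (con (+ 1) :- q) :* ((con (+ 1) :- con (+ 1) :* (β :* γ)) :* (con (+ 1) :- con (+ 1) :* (β :* δ))
          :* (con (+ 1) :- con (+ 1) :* (γ :* δ)))
        :- (con (+ 1) :- β :* con (+ 1)) :* (con (+ 1) :- γ :* con (+ 1)) :* (con (+ 1) :- δ :* con (+ 1))
          :* (q :- con (+ 1) :* (β :* γ :* δ))) refl q β γ δ

    module Boundary (C₀ : ℂ) (C₀≈ : (1ℂ - q) * V 1ℂ * C₀ ≈ C₀-numerator) where

      q-s₃≈ : q - 1ℂ * s₃ ≈ v 0 * (q * (1ℂ - q * q) * C 1ℂ - U q * (1ℂ - s₃ * q))
      q-s₃≈ = begin
        q - 1ℂ * s₃                              ≈⟨ *-identityˡ _ ⟨
        1ℂ * (q - 1ℂ * s₃)                       ≈⟨ *-congʳ (v-inverse 0) ⟨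
        v 0 * V (q ^ 1) * (q - 1ℂ * s₃)          ≈⟨ *-assoc _ _ _ ⟩
        v 0 * (V (q ^ 1) * (q - 1ℂ * s₃))        ≈⟨ *-congˡ (trans (*-comm _ _) (trans
          (*-congˡ (V-cong (solve 1 (λ q → q :* con (+ 1) := con (+ 1) :* q) refl q))) (key-identity 1ℂ q))) ⟩
        v 0 * (q * (1ℂ - 1ℂ * q * q) * C 1ℂ - 1ℂ * U q * (1ℂ - 1ℂ * 1ℂ * s₃ * q))
          ≈⟨ solve 5 (λ v q c u s →
               v :* (q :* (con (+ 1) :- con (+ 1) :* q :* q) :* c
                 :- con (+ 1) :* u :* (con (+ 1) :- con (+ 1) :* con (+ 1) :* s :* q)) :=
               v :* (q :* (con (+ 1) :- q :* q) :* c :- u :* (con (+ 1) :- s :* q))) refl (v 0) q (C 1ℂ) (U q) s₃ ⟩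
        v 0 * (q * (1ℂ - q * q) * C 1ℂ - U q * (1ℂ - s₃ * q))  ∎

      T00≈ : (1ℂ - q) * T 0 0 ≈ - ((1ℂ - q * q) * q * V 1ℂ * v 0)
      T00≈ = begin
        (1ℂ - q) * ((1ℂ - x 0 * 1ℂ * x 0) * (x 0 * U 1ℂ * κ 0 * v 0))
          ≈⟨ *-congˡ (*-congˡ (*-congʳ (*-congʳ (*-congˡ U1≈-V1)))) ⟩
        (1ℂ - q) * ((1ℂ - x 0 * 1ℂ * x 0) * (x 0 * - V 1ℂ * κ 0 * v 0))
          ≈⟨ solve 4 (λ q V κ v → (con (+ 1) :- q) :* ((con (+ 1) :- q :* con (+ 1) :* con (+ 1) :* (q :* con (+ 1)))
                 :* (q :* con (+ 1) :* :- V :* κ :* v)) :=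
               κ :* (con (+ 1) :- q :* con (+ 1)) :* :- ((con (+ 1) :- q :* q) :* q :* V :* v))
               refl q (V 1ℂ) (κ 0) (v 0) ⟩
        κ 0 * (1ℂ - q ^ 1) * - ((1ℂ - q * q) * q * V 1ℂ * v 0)
          ≈⟨ trans (*-congʳ (κ-inverse 0)) (*-identityˡ _) ⟩
        - ((1ℂ - q * q) * q * V 1ℂ * v 0)  ∎

      G′0≈ : (1ℂ - q) * G′ 0 ≈ - ((1ℂ - s₃ * q) * U q * v 0)
      G′0≈ = begin
        (1ℂ - q) * ((1ℂ - q ^ 2) * (1ℂ - 1ℂ * 1ℂ * s₃ * q ^ 1) * - (U (q ^ 1) * κ 0 * κ 1 * v 0))
          ≈⟨ solve 7 (λ q f s u κ₀ κ₁ v →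
               (con (+ 1) :- q) :* (f :* (con (+ 1) :- con (+ 1) :* con (+ 1) :* s :* (q :* con (+ 1)))
                 :* :- (u :* κ₀ :* κ₁ :* v)) :=
               κ₀ :* (con (+ 1) :- q :* con (+ 1)) :* (κ₁ :* f) :* :- ((con (+ 1) :- s :* q) :* u :* v))
               refl q (1ℂ - q ^ 2) s₃ (U (q ^ 1)) (κ 0) (κ 1) (v 0) ⟩
        κ 0 * (1ℂ - q ^ 1) * (κ 1 * (1ℂ - q ^ 2)) * - ((1ℂ - s₃ * q) * U (q ^ 1) * v 0)
          ≈⟨ *-cong (*-cong (κ-inverse 0) (κ-inverse 1)) (-‿cong (*-congʳ (*-congˡ
               (*-cong (*-cong (f β) (f γ)) (f δ))))) ⟩
        1ℂ * 1ℂ * - ((1ℂ - s₃ * q) * U q * v 0)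
          ≈⟨ trans (*-congʳ (*-identityˡ 1ℂ)) (*-identityˡ _) ⟩
        - ((1ℂ - s₃ * q) * U q * v 0)  ∎
        where
        f : ∀ z → z - q ^ 1 ≈ z - q
        f z = +-congˡ (-‿cong (*-identityʳ q))

      base′ : V 1ℂ * (1ℂ - 1ℂ * s₃) * C₀ ≈ C 1ℂ * (1ℂ + T 0 0) - V 1ℂ * G′ 0
      base′ = *-cancelˡ-≠0 (∣z∣<1⇒1-z≠0 ∣q∣<1) (begin
        (1ℂ - q) * (V 1ℂ * (1ℂ - 1ℂ * s₃) * C₀)
          ≈⟨ solve 4 (λ f V e c → f :* (V :* e :* c) := e :* (f :* V :* c)) refl _ _ _ _ ⟩
        (1ℂ - 1ℂ * s₃) * ((1ℂ - q) * V 1ℂ * C₀)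
          ≈⟨ trans (*-congˡ C₀≈) C₀-numerator-identity ⟩
        (1ℂ - q) * C 1ℂ - V 1ℂ * (q - 1ℂ * s₃)
          ≈⟨ +-congˡ (-‿cong (*-congˡ q-s₃≈)) ⟩
        (1ℂ - q) * C 1ℂ - V 1ℂ * (v 0 * (q * (1ℂ - q * q) * C 1ℂ - U q * (1ℂ - s₃ * q)))
          ≈⟨ solve 8 (λ f c V v q e u g → f :* c :- V :* (v :* (q :* e :* c :- u :* g)) :=
               f :* c :+ c :* :- (e :* q :* V :* v) :- V :* :- (g :* u :* v))
               refl (1ℂ - q) (C 1ℂ) (V 1ℂ) (v 0) q (1ℂ - q * q) (U q) (1ℂ - s₃ * q) ⟩
        (1ℂ - q) * C 1ℂ + C 1ℂ * - ((1ℂ - q * q) * q * V 1ℂ * v 0) - V 1ℂ * - ((1ℂ - s₃ * q) * U q * v 0)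
          ≈⟨ +-cong (+-congˡ (*-congˡ T00≈)) (-‿cong (*-congˡ G′0≈)) ⟨
        (1ℂ - q) * C 1ℂ + C 1ℂ * ((1ℂ - q) * T 0 0) - V 1ℂ * ((1ℂ - q) * G′ 0)
          ≈⟨ solve 5 (λ f c t V g → f :* c :+ c :* (f :* t) :- V :* (f :* g) :=
               f :* (c :* (con (+ 1) :+ t) :- V :* g)) refl _ _ _ _ _ ⟩
        (1ℂ - q) * (C 1ℂ * (1ℂ + T 0 0) - V 1ℂ * G′ 0)  ∎)

      partial-step′ : ∀ n → V 1ℂ * (1ℂ - 1ℂ * s₃) * (C₀ + partialSum T′ n)
                            ≈ C 1ℂ * (1ℂ + partialSum (T 0) (suc n)) - V 1ℂ * G′ n
      partial-step′ n = begin
        V 1ℂ * (1ℂ - 1ℂ * s₃) * (C₀ + partialSum T′ n)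
          ≈⟨ solve 5 (λ A c s B t → A :* (c :+ s) := A :* c :+ (A :* s :- B :* t) :+ B :* t) refl
               (V 1ℂ * (1ℂ - 1ℂ * s₃)) C₀ (partialSum T′ n) (C 1ℂ) (partialSum (λ k → T 0 (suc k)) n) ⟩
        V 1ℂ * (1ℂ - 1ℂ * s₃) * C₀
          + (V 1ℂ * (1ℂ - 1ℂ * s₃) * partialSum T′ n - C 1ℂ * partialSum (λ k → T 0 (suc k)) n)
          + C 1ℂ * partialSum (λ k → T 0 (suc k)) n
          ≈⟨ +-congʳ (+-cong base′ (partialSum-telescope (V 1ℂ * (1ℂ - 1ℂ * s₃)) (C 1ℂ) (V 1ℂ) step′ n)) ⟩
        C 1ℂ * (1ℂ + T 0 0) - V 1ℂ * G′ 0 + V 1ℂ * (G′ 0 - G′ n) + C 1ℂ * partialSum (λ k → T 0 (suc k)) n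
          ≈⟨ solve 6 (λ c t V g g′ s → c :* (con (+ 1) :+ t) :- V :* g :+ V :* (g :- g′) :+ c :* s :=
               c :* (con (+ 1) :+ (t :+ s)) :- V :* g′) refl
               (C 1ℂ) (T 0 0) (V 1ℂ) (G′ 0) (G′ n) (partialSum (λ k → T 0 (suc k)) n) ⟩
        C 1ℂ * (1ℂ + (T 0 0 + partialSum (λ k → T 0 (suc k)) n)) - V 1ℂ * G′ n
          ≈⟨ +-congʳ (*-congˡ (+-congˡ (partialSum-suc (T 0) n))) ⟨
        C 1ℂ * (1ℂ + partialSum (T 0) (suc n)) - V 1ℂ * G′ n  ∎

      T′-factor : ℕ → ℂ
      T′-factor k = 1ℂ - 1ℂ * q ^ suc k * q ^ suc (suc k)

      T′-factor≠0 : ∀ k → T′-factor k ≠0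
      T′-factor≠0 k = ≠0-cong
        (+-congˡ (-‿cong (trans (sym (q^suc*q^suc k (suc k))) (*-congʳ (sym (*-identityˡ _))))))
        (1-q^suc≠0 (suc (suc k) +ℕ k))

      T′-factor⟶1 : T′-factor ⟶ 1ℂ
      T′-factor⟶1 = ⟶-cong (λ _ → refl)
        (solve 0 (con (+ 1) :- con (+ 1) :* con (+ 0) :* con (+ 0) := con (+ 1)) refl)
        (⟶-- (⟶-const 1ℂ) (⟶-* (⟶-*ˡ 1ℂ ^suc-null) (⟶-shift 1 ^suc-null)))

      G′-null : T′ ⟶ 0ℂ → G′ ⟶ 0ℂ
      G′-null T′⟶0 = ⟶-cong
        (λ k → begin
          T′-factor k * h′ k * (recip (T′-factor k) (T′-factor≠0 k) * ((1ℂ - q ^ suc (suc k)) * (1ℂ - 1ℂ * 1ℂ * s₃ * q ^ suc k)))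
            ≈⟨ solve 4 (λ t h r e → t :* h :* (r :* e) := r :* t :* (e :* h)) refl _ _ _ _ ⟩
          recip (T′-factor k) (T′-factor≠0 k) * T′-factor k * G′ k
            ≈⟨ trans (*-congʳ (recip-inverse _ (T′-factor≠0 k))) (*-identityˡ _) ⟩
          G′ k  ∎) refl
        (null-* T′⟶0 (⟶⇒bounded (⟶-* (⟶-recip T′-factor≠0 T′-factor⟶1)
          (⟶-* (⟶-shift 1 (1-z*p^⟶1 q)) (⟶-shift 1 (1-z*p^⟶1 (1ℂ * 1ℂ * s₃)))))))

      boundary-formula : ∀ {S′} → HasSum T′ S′ → V 1ℂ * (1ℂ - 1ℂ * s₃) * (C₀ + S′) ≈ C 1ℂ * S 0
      boundary-formula hs = ⟶-unique
        (⟶-*ˡ (V 1ℂ * (1ℂ - 1ℂ * s₃)) (⟶-+ (⟶-const C₀) hs))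
        (⟶-cong (λ n → sym (partial-step′ n)) (solve 2 (λ s V → s :- V :* con (+ 0) := s) refl _ (V 1ℂ))
          (⟶-- (⟶-*ˡ (C 1ℂ) (⟶-shift 1 (⟶S 0))) (⟶-*ˡ (V 1ℂ) (G′-null (summable⇒null hs)))))

      boundary-∞ : ∀ {S′} → HasSum T′ S′ →
        poch∞ β q ∣q∣<1 * poch∞ γ q ∣q∣<1 * poch∞ δ q ∣q∣<1 * poch∞ s₃ q ∣q∣<1 * (C₀ + S′)
        ≈ poch∞ q q ∣q∣<1 * poch∞ (β * γ) q ∣q∣<1 * poch∞ (β * δ) q ∣q∣<1 * poch∞ (γ * δ) q ∣q∣<1
      boundary-∞ {S′} hs = begin
        P β * P γ * P δ * P s₃ * (C₀ + S′)
          ≈⟨ *-congʳ (*-cong (*-cong (*-cong (poch∞-first β) (poch∞-first γ)) (poch∞-first δ)) (poch∞-first s₃)) ⟩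
        (1ℂ - β) * P (q * β) * ((1ℂ - γ) * P (q * γ)) * ((1ℂ - δ) * P (q * δ)) * ((1ℂ - s₃) * P (q * s₃)) * (C₀ + S′)
          ≈⟨ solve 9 (λ β γ δ s a b c d X →
               (con (+ 1) :- β) :* a :* ((con (+ 1) :- γ) :* b) :* ((con (+ 1) :- δ) :* c) :* ((con (+ 1) :- s) :* d) :* X :=
               a :* b :* c :* d :* ((con (+ 1) :- β :* con (+ 1)) :* (con (+ 1) :- γ :* con (+ 1))
                 :* (con (+ 1) :- δ :* con (+ 1)) :* (con (+ 1) :- con (+ 1) :* s) :* X))
               refl β γ δ s₃ (P (q * β)) (P (q * γ)) (P (q * δ)) (P (q * s₃)) (C₀ + S′) ⟩
        P (q * β) * P (q * γ) * P (q * δ) * P (q * s₃) * (V 1ℂ * (1ℂ - 1ℂ * s₃) * (C₀ + S′))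
          ≈⟨ *-congˡ (boundary-formula hs) ⟩
        P (q * β) * P (q * γ) * P (q * δ) * P (q * s₃) * (C 1ℂ * S 0)
          ≈⟨ solve 3 (λ p c s → p :* (c :* s) := c :* (p :* s)) refl _ _ _ ⟩
        C 1ℂ * (P (q * β) * P (q * γ) * P (q * δ) * P (q * s₃) * S 0)
          ≈⟨ *-congˡ sum-formula ⟩
        C 1ℂ * (P q * P (q * (β * γ)) * P (q * (β * δ)) * P (q * (γ * δ)))
          ≈⟨ solve 7 (λ x y z p a b c →
               (con (+ 1) :- con (+ 1) :* x) :* (con (+ 1) :- con (+ 1) :* y) :* (con (+ 1) :- con (+ 1) :* z)
                 :* (p :* a :* b :* c) :=
               p :* ((con (+ 1) :- x) :* a) :* ((con (+ 1) :- y) :* b) :* ((con (+ 1) :- z) :* c))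
               refl (β * γ) (β * δ) (γ * δ) (P q) (P (q * (β * γ))) (P (q * (β * δ))) (P (q * (γ * δ))) ⟩
        P q * ((1ℂ - β * γ) * P (q * (β * γ))) * ((1ℂ - β * δ) * P (q * (β * δ))) * ((1ℂ - γ * δ) * P (q * (γ * δ)))
          ≈⟨ *-cong (*-cong (*-congˡ (poch∞-first (β * γ))) (poch∞-first (β * δ))) (poch∞-first (γ * δ)) ⟨
        P q * P (β * γ) * P (β * δ) * P (γ * δ)  ∎
        where
        P : ℂ → ℂ
        P a = poch∞ a q ∣q∣<1

      T′-summable : ∣ s₃ ∣< 1ℝ → Summable T′
      T′-summable ∣s₃∣<1 = geometric⇒summable (geometric-cong (λ _ → *-comm _ _)
        (geometric-bounded-* (ratio-test (λ _ → refl) ratio′⟶ ∣s₃∣<1) (⟶⇒bounded T′-factor⟶1)))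
        where
        ratio′⟶ : (λ k → (1ℂ - 1ℂ * q ^ suc k) * 1ℂ * U (q ^ suc (suc k)) * κ (suc (suc k)) * v (suc k)) ⟶ s₃
        ratio′⟶ = ⟶-cong (λ _ → refl)
          (solve 1 (λ s → con (+ 1) :* con (+ 1) :* s :* con (+ 1) :* con (+ 1) := s) refl s₃)
          (⟶-* (⟶-* (⟶-* (⟶-* (⟶-shift 1 (1-z*p^⟶1 1ℂ)) (⟶-const 1ℂ)) (U-⟶ (⟶-shift 1 ^suc-null)))
            (⟶-shift 2 κ⟶1)) (⟶-shift 1 v⟶1))

    h′-closed : ∀ k → (1ℂ - q ^ suc k) * (1ℂ - q ^ suc (suc k)) * (V 1ℂ * pochV (suc k)) * h′ k ≈ B (suc (suc k))
    h′-closed zero = begin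
      (1ℂ - q ^ 1) * (1ℂ - q ^ 2) * (V 1ℂ * (1ℂ * V (q ^ 1))) * - (U (q ^ 1) * κ 0 * κ 1 * v 0)
        ≈⟨ solve 8 (λ f g V W u κ₀ κ₁ v → f :* g :* (V :* (con (+ 1) :* W)) :* :- (u :* κ₀ :* κ₁ :* v) :=
             κ₀ :* f :* (κ₁ :* g) :* (v :* W) :* (:- V :* u)) refl _ _ _ _ _ _ _ _ ⟩
      κ 0 * (1ℂ - q ^ 1) * (κ 1 * (1ℂ - q ^ 2)) * (v 0 * V (q ^ 1)) * (- V 1ℂ * U (q ^ 1))
        ≈⟨ *-cong (*-cong (*-cong (κ-inverse 0) (κ-inverse 1)) (v-inverse 0)) (*-congʳ (sym U1≈-V1)) ⟩
      1ℂ * 1ℂ * 1ℂ * (U 1ℂ * U (q ^ 1))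
        ≈⟨ solve 2 (λ u w → con (+ 1) :* con (+ 1) :* con (+ 1) :* (u :* w) := con (+ 1) :* u :* w) refl _ _ ⟩
      1ℂ * U 1ℂ * U (q ^ 1)  ∎
    h′-closed (suc k) = begin
      (1ℂ - q ^ suc (suc k)) * (1ℂ - q ^ suc (suc (suc k))) * (V 1ℂ * (pochV (suc k) * V (q ^ suc (suc k))))
        * ((1ℂ - 1ℂ * q ^ suc k) * 1ℂ * U (q ^ suc (suc k)) * κ (suc (suc k)) * v (suc k) * h′ k)
        ≈⟨ solve 10 (λ f g V p W y u κ v h → f :* g :* (V :* (p :* W))
               :* ((con (+ 1) :- con (+ 1) :* y) :* con (+ 1) :* u :* κ :* v :* h) :=
             κ :* g :* (v :* W) :* ((con (+ 1) :- y) :* f :* (V :* p) :* h :* u)) refl _ _ _ _ _ _ _ _ _ _ ⟩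
      κ (suc (suc k)) * (1ℂ - q ^ suc (suc (suc k))) * (v (suc k) * V (q ^ suc (suc k)))
        * ((1ℂ - q ^ suc k) * (1ℂ - q ^ suc (suc k)) * (V 1ℂ * pochV (suc k)) * h′ k * U (q ^ suc (suc k)))
        ≈⟨ *-cong (*-cong (κ-inverse (suc (suc k))) (v-inverse (suc k))) (*-congʳ (h′-closed k)) ⟩
      1ℂ * 1ℂ * (B (suc (suc k)) * U (q ^ suc (suc k)))
        ≈⟨ trans (*-congʳ (*-identityˡ 1ℂ)) (*-identityˡ _) ⟩
      B (suc (suc k)) * U (q ^ suc (suc k))  ∎

module Translation {c ℓ₁ ℓ₂} (ℛ : RealNumbers c ℓ₁ ℓ₂) (q : Complex.ℂ ℛ)
                   (q≠0 : Complex._≠0 ℛ q) (∣q∣<1 : Complex.∣_∣<_ ℛ q (Complex.1ℝ ℛ)) where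
  open Complex ℛ
  open QSeries q q≠0 ∣q∣<1
  open Modulus
  open Limits
  open Analysis ℛ
  open Pochhammer ℛ q ∣q∣<1
  open SetoidReasoning setoid
  open CommutativeSemiringExp (CommutativeRing.commutativeSemiring ℂ-commutativeRing) using (^-distrib-*)
  open SemiringExp (CommutativeRing.semiring ℂ-commutativeRing) using (^-congˡ; ^-assocʳ)

  recip-unique : ∀ {w l} (w≠0 : w ≠0) → w * l ≈ 1ℂ → recip w w≠0 ≈ l
  recip-unique w≠0 eq = trans (sym (*-identityˡ _)) (/-unique w≠0 eq)

  -- z / w [ w≠0 ] with the division unfolded, so that it can be recognised without comparing proofs of w ≠0.
  /-unfolded : ∀ {z a b x} {x#0 : x ℝ.# ℝ.0#} w → re w ℝ.≈ a → im w ℝ.≈ b → x ℝ.≈ normSq w →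
               z * ((a ℝ.* ℝ.inv x#0) +i (ℝ.- b ℝ.* ℝ.inv x#0)) * w ≈ z
  /-unfolded {z} {a} {b} {x} {x#0} w re≈ im≈ x≈ = trans (*-assoc _ _ _) (trans (*-congˡ
    (ℝ.trans (ℝ.+-cong (ℝ.*-congʳ (ℝ.*-congʳ (ℝ.sym re≈))) (ℝ.-‿cong (ℝ.*-congʳ (ℝ.*-congʳ (ℝ.-‿cong (ℝ.sym im≈))))))
      (ℝ.trans (ℝ.solve 3 (λ a b n → a ℝ.:* n ℝ.:* a ℝ.:- ℝ.:- b ℝ.:* n ℝ.:* b ℝ.:= n ℝ.:* (a ℝ.:* a ℝ.:+ b ℝ.:* b))
              ℝ.refl (re w) (im w) _)
            (ℝ.trans (ℝ.*-congˡ (ℝ.sym x≈)) (ℝ.inv-inverse _))) ,ⁱ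
     ℝ.trans (ℝ.+-cong (ℝ.*-congʳ (ℝ.*-congʳ (ℝ.sym re≈))) (ℝ.*-congʳ (ℝ.*-congʳ (ℝ.-‿cong (ℝ.sym im≈)))))
       (ℝ.solve 3 (λ a b n → a ℝ.:* n ℝ.:* b ℝ.:+ ℝ.:- b ℝ.:* n ℝ.:* a ℝ.:= ℝ.con (+ 0)) ℝ.refl (re w) (im w) _)))
    (*-identityʳ z))

  factor-denominator : ∀ k → factor k * ((1ℂ - q ^ suc k) * (1ℂ - q ^ suc (suc k))) ≈ 1ℂ - q ^ (2 ℕ.* (2 +ℕ k) ∸ 1)
  factor-denominator k = /-unfolded ((1ℂ - q ^ suc k) * (1ℂ - q ^ suc (suc k))) ℝ.refl ℝ.refl ℝ.refl

  module BoundaryTerms (β γ δ : ℂ) where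
    open WellPoised ℛ q ∣q∣<1 β γ δ

    module UnilateralTerms (∣qs₃∣<1 : ∣ q * s₃ ∣< 1ℝ) (V≠0 : ∀ n → V (q ^ suc n) ≠0) where
      open Series ∣qs₃∣<1 V≠0

      factor≈T′ : ∀ k {L Y} → L ≠0 → V 1ℂ * pochV (suc k) ≈ L → B (suc (suc k)) ≈ L * Y → factor k * Y ≈ T′ k
      factor≈T′ k {L} {Y} L≠0 L≈ B≈LY = begin
        factor k * Y
          ≈⟨ *-congˡ (*-cancelˡ-≠0 L≠0 (begin
               L * Y                                                ≈⟨ B≈LY ⟨
               B (suc (suc k))                                      ≈⟨ h′-closed k ⟨
               A * (V 1ℂ * pochV (suc k)) * h′ k                    ≈⟨ *-congʳ (*-congˡ L≈) ⟩
               A * L * h′ k                                         ≈⟨ solve 3 (λ a l h → a :* l :* h := l :* (a :* h)) refl A L (h′ k) ⟩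
               L * (A * h′ k)                                       ∎)) ⟩
        factor k * (A * h′ k)
          ≈⟨ *-assoc _ _ _ ⟨
        factor k * A * h′ k
          ≈⟨ *-congʳ (factor-denominator k) ⟩
        (1ℂ - q ^ (2 ℕ.* (2 +ℕ k) ∸ 1)) * h′ k
          ≈⟨ *-congʳ (+-congˡ (-‿cong (begin
               q ^ (2 ℕ.* (2 +ℕ k) ∸ 1)               ≡⟨ ≡.cong (λ i → q ^ (suc k +ℕ suc (suc i))) (ℕ.+-identityʳ k) ⟩
               q ^ (suc k +ℕ suc (suc k))             ≈⟨ ^-+ (suc (suc k)) (suc k) ⟨
               q ^ suc (suc k) * q ^ suc k            ≈⟨ solve 2 (λ x y → x :* y := con (+ 1) :* y :* x) refl _ _ ⟩
               1ℂ * q ^ suc k * q ^ suc (suc k)       ∎))) ⟩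
        T′ k  ∎
        where
        A : ℂ
        A = (1ℂ - q ^ suc k) * (1ℂ - q ^ suc (suc k))

  module Inverses (b c d : ℂ) (b≠0 : b ≠0) (c≠0 : c ≠0) (d≠0 : d ≠0) where
    open Parameters b c d b≠0 c≠0 d≠0

    β γ δ : ℂ
    β = recip b b≠0
    γ = recip c c≠0
    δ = recip d d≠0

    open WellPoised ℛ q ∣q∣<1 β γ δ public

    bβ≈1 : b * β ≈ 1ℂ
    bβ≈1 = recip-inverseʳ b b≠0
    cγ≈1 : c * γ ≈ 1ℂ
    cγ≈1 = recip-inverseʳ c c≠0
    dδ≈1 : d * δ ≈ 1ℂ
    dδ≈1 = recip-inverseʳ d d≠0

    recip-* : ∀ {z w z′ w′} (zw≠0 : z * w ≠0) → z * z′ ≈ 1ℂ → w * w′ ≈ 1ℂ → recip (z * w) zw≠0 ≈ z′ * w′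
    recip-* zw≠0 p r = recip-unique zw≠0 (trans
      (solve 4 (λ z w z′ w′ → z :* w :* (z′ :* w′) := z :* z′ :* (w :* w′)) refl _ _ _ _)
      (trans (*-cong p r) (*-identityˡ 1ℂ)))

    bcd-inverse : b * c * d * s₃ ≈ 1ℂ
    bcd-inverse = begin
      b * c * d * (β * γ * δ)
        ≈⟨ solve 6 (λ b c d β γ δ → b :* c :* d :* (β :* γ :* δ) := b :* β :* (c :* γ) :* (d :* δ)) refl b c d β γ δ ⟩
      b * β * (c * γ) * (d * δ)  ≈⟨ *-cong (*-cong bβ≈1 cγ≈1) dδ≈1 ⟩
      1ℂ * 1ℂ * 1ℂ               ≈⟨ trans (*-congʳ (*-identityˡ 1ℂ)) (*-identityˡ 1ℂ) ⟩
      1ℂ                         ∎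

    recip-bcd : recip (b * c * d) bcd≠0 ≈ s₃
    recip-bcd = recip-unique bcd≠0 bcd-inverse

    recip-bc : recip (b * c) bc≠0 ≈ β * γ
    recip-bc = recip-* bc≠0 bβ≈1 cγ≈1
    recip-bd : recip (b * d) bd≠0 ≈ β * δ
    recip-bd = recip-* bd≠0 bβ≈1 dδ≈1
    recip-cd : recip (c * d) cd≠0 ≈ γ * δ
    recip-cd = recip-* cd≠0 cγ≈1 dδ≈1

    B≈ : ∀ n → B n ≈ ⟨ upper ⟩ n * s₃ ^ n
    B≈ zero    = solve 0 (con (+ 1) := con (+ 1) :* (con (+ 1) :* (con (+ 1) :* con (+ 1))) :* con (+ 1)) refl
    B≈ (suc n) = begin
      B n * U (q ^ n)
        ≈⟨ *-cong (B≈ n) (*-cong (*-cong (factor≈ bβ≈1) (factor≈ cγ≈1)) (factor≈ dδ≈1)) ⟩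
      poch b q n * (poch c q n * (poch d q n * 1ℂ)) * s₃ ^ n
        * ((1ℂ - b * q ^ n) * β * ((1ℂ - c * q ^ n) * γ) * ((1ℂ - d * q ^ n) * δ))
        ≈⟨ solve 10 (λ B C D s x y z β γ δ →
             B :* (C :* (D :* con (+ 1))) :* s :* (x :* β :* (y :* γ) :* (z :* δ)) :=
             B :* x :* (C :* y :* (D :* z :* con (+ 1))) :* (β :* γ :* δ :* s))
             refl (poch b q n) (poch c q n) (poch d q n) (s₃ ^ n)
             (1ℂ - b * q ^ n) (1ℂ - c * q ^ n) (1ℂ - d * q ^ n) β γ δ ⟩
      ⟨ upper ⟩ (suc n) * s₃ ^ suc n  ∎
      where
      factor≈ : ∀ {z ζ y} → z * ζ ≈ 1ℂ → ζ - y ≈ (1ℂ - z * y) * ζ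
      factor≈ {z} {ζ} {y} zζ≈1 = begin
        ζ - y               ≈⟨ +-congˡ (-‿cong (trans (*-congʳ zζ≈1) (*-identityˡ y))) ⟨
        ζ - z * ζ * y       ≈⟨ solve 3 (λ z ζ y → ζ :- z :* ζ :* y := (con (+ 1) :- z :* y) :* ζ) refl z ζ y ⟩
        (1ℂ - z * y) * ζ    ∎

    module Bilateral (∣q/bcd∣<1 : ∣ q / (b * c * d) [ bcd≠0 ] ∣< 1ℝ) (den≠0 : ∀ n → den₁ n ≠0) where

      pochV≈den₁ : ∀ n → pochV n ≈ den₁ (+ n)
      pochV≈den₁ zero    = solve 0 (con (+ 1) := con (+ 1) :* (con (+ 1) :* (con (+ 1) :* con (+ 1)))
        :* (con (+ 1) :* (con (+ 1) :* (con (+ 1) :* con (+ 1))))) refl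
      pochV≈den₁ (suc n) = begin
        pochV n * V (q ^ suc n)
          ≈⟨ *-congʳ (pochV≈den₁ n) ⟩
        den₁ (+ n) * V (q * q ^ n)
          ≈⟨ solve 8 (λ B C D β γ δ q y →
               con (+ 1) :* (con (+ 1) :* (con (+ 1) :* con (+ 1))) :* (B :* (C :* (D :* con (+ 1))))
                 :* ((con (+ 1) :- β :* (q :* y)) :* (con (+ 1) :- γ :* (q :* y)) :* (con (+ 1) :- δ :* (q :* y))) :=
               con (+ 1) :* (con (+ 1) :* (con (+ 1) :* con (+ 1))) :* (B :* (con (+ 1) :- q :* β :* y)
                 :* (C :* (con (+ 1) :- q :* γ :* y) :* (D :* (con (+ 1) :- q :* δ :* y) :* con (+ 1)))))
               refl (poch (q * β) q n) (poch (q * γ) q n) (poch (q * δ) q n) β γ δ q (q ^ n) ⟩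
        den₁ (+ suc n)  ∎

      V≠0 : ∀ n → V (q ^ suc n) ≠0
      V≠0 n = *-≠0⁻ʳ (≠0-cong (sym (pochV≈den₁ (suc n))) (den≠0 (+ suc n)))

      open Series (∣∣-cong (*-congˡ recip-bcd) ℝ.refl ∣q/bcd∣<1) V≠0

      -- The terms of index n and -n with n = k + 1 ≥ 1.
      term₊ term₋ : ℕ → ℂ
      term₊ k = h 0 k * (1ℂ - q ^ suc k)
      term₋ k = h 0 k * ((1ℂ - q ^ suc k) * q ^ suc k)

      pochV-term₊ : ∀ k → pochV (suc k) * term₊ k ≈ q ^ suc k * B (suc k)
      pochV-term₊ k = trans (solve 3 (λ p h f → p :* (h :* f) := f :* h :* p) refl _ _ _) (h-closed k)

      argument^ : ∀ n → (q / (b * c * d) [ bcd≠0 ]) ^ n ≈ q ^ n * s₃ ^ n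
      argument^ n = trans (^-congˡ n (*-congˡ recip-bcd)) (^-distrib-* q s₃ n)

      term₁-0 : term₁ den≠0 (+ 0) ≈ 1ℂ
      term₁-0 = trans (*-identityʳ _) (/-unique (den≠0 (+ 0))
        (solve 0 (con (+ 1) :* (con (+ 1) :* (con (+ 1) :* con (+ 1))) :* (con (+ 1) :* (con (+ 1) :* (con (+ 1) :* con (+ 1)))) :* con (+ 1)
          := con (+ 1) :* (con (+ 1) :* (con (+ 1) :* con (+ 1))) :* (con (+ 1) :* (con (+ 1) :* (con (+ 1) :* con (+ 1))))) refl))

      term₁-+ : ∀ k → term₁ den≠0 (+ suc k) ≈ term₊ k
      term₁-+ k = trans
        (solve 3 (λ a r x → a :* r :* x := a :* x :* r) refl _ _ _)
        (/-unique (den≠0 (+ suc k)) (begin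
          den₁ (+ suc k) * term₊ k       ≈⟨ *-congʳ (pochV≈den₁ (suc k)) ⟨
          pochV (suc k) * term₊ k        ≈⟨ pochV-term₊ k ⟩
          q ^ suc k * B (suc k)          ≈⟨ *-congˡ (B≈ (suc k)) ⟩
          q ^ suc k * (⟨ upper ⟩ (suc k) * s₃ ^ suc k)
            ≈⟨ solve 3 (λ x u y → x :* (u :* y) := u :* (con (+ 1) :* (con (+ 1) :* (con (+ 1) :* con (+ 1)))) :* (x :* y)) refl _ _ _ ⟩
          ⟨ upper ⟩ (suc k) * ⟨ lower₁ ⟩ᵈ (+ suc k) * (q ^ suc k * s₃ ^ suc k)
            ≈⟨ *-congˡ (argument^ (suc k)) ⟨
          ⟨ upper ⟩ (suc k) * ⟨ lower₁ ⟩ᵈ (+ suc k) * (q / (b * c * d) [ bcd≠0 ]) ^ suc k  ∎))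

      p : ℂ
      p = recip q q≠0

      p^*q^≈1 : ∀ n → p ^ n * q ^ n ≈ 1ℂ
      p^*q^≈1 n = trans (sym (^-distrib-* p q n)) (trans (^-congˡ n (recip-inverse q q≠0)) (1^ n))
        where
        1^ : ∀ n → 1ℂ ^ n ≈ 1ℂ
        1^ zero    = refl
        1^ (suc n) = trans (*-identityˡ _) (1^ n)

      poch-p^suc : ∀ a n → poch (a * p ^ suc n) q (suc n) ≈ (1ℂ - a * p ^ suc n) * poch (a * p ^ n) q n
      poch-p^suc a n = trans (poch-split (a * p ^ suc n) q 1 n) (*-cong
        (solve 1 (λ z → con (+ 1) :* (con (+ 1) :- z :* con (+ 1)) := con (+ 1) :- z) refl _)
        (poch-cong q (begin
          a * (p * p ^ n) * (q * 1ℂ)   ≈⟨ solve 4 (λ a p x q → a :* (p :* x) :* (q :* con (+ 1)) := p :* q :* (a :* x)) refl a p (p ^ n) q ⟩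
          p * q * (a * p ^ n)          ≈⟨ trans (*-congʳ (recip-inverse q q≠0)) (*-identityˡ _) ⟩
          a * p ^ n                    ∎) n))

      -- (b, c, d; q)_{-n} = 1 / (b q⁻ⁿ, c q⁻ⁿ, d q⁻ⁿ; q)_n, and likewise for the lower parameters.
      upper₋ lower₋ : ℕ → ℂ
      upper₋ n = poch (b * p ^ n) q n * poch (c * p ^ n) q n * poch (d * p ^ n) q n
      lower₋ n = poch (q * β * p ^ n) q n * poch (q * γ * p ^ n) q n * poch (q * δ * p ^ n) q n

      upper-factor : ∀ {z ζ} n → z * ζ ≈ 1ℂ → 1ℂ - z * p ^ suc n ≈ - (z * p ^ suc n) * (1ℂ - ζ * q ^ suc n)
      upper-factor {z} {ζ} n zζ≈1 = begin
        1ℂ - z * p ^ suc n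
          ≈⟨ +-congʳ (trans (*-cong zζ≈1 (p^*q^≈1 (suc n))) (*-identityˡ 1ℂ)) ⟨
        z * ζ * (p ^ suc n * q ^ suc n) - z * p ^ suc n
          ≈⟨ solve 4 (λ z ζ P Q → z :* ζ :* (P :* Q) :- z :* P := :- (z :* P) :* (con (+ 1) :- ζ :* Q)) refl _ _ _ _ ⟩
        - (z * p ^ suc n) * (1ℂ - ζ * q ^ suc n)  ∎

      lower-factor : ∀ ζ n → 1ℂ - q * ζ * p ^ suc n ≈ - (p ^ n) * (ζ - q ^ n)
      lower-factor ζ n = begin
        1ℂ - q * ζ * (p * p ^ n)
          ≈⟨ +-cong (p^*q^≈1 n) (-‿cong (solve 4 (λ p q ζ P → p :* q :* (ζ :* P) := q :* ζ :* (p :* P)) refl p q ζ (p ^ n))) ⟨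
        p ^ n * q ^ n - p * q * (ζ * p ^ n)
          ≈⟨ +-congˡ (-‿cong (trans (*-congʳ (recip-inverse q q≠0)) (*-identityˡ _))) ⟩
        p ^ n * q ^ n - ζ * p ^ n
          ≈⟨ solve 3 (λ P Q ζ → P :* Q :- ζ :* P := :- P :* (ζ :- Q)) refl _ _ _ ⟩
        - (p ^ n) * (ζ - q ^ n)  ∎

      reflection : ∀ n → upper₋ n * (q ^ n * q ^ n * B n) ≈ lower₋ n * (p * (b * c * d)) ^ n * pochV n
      reflection zero = solve 0 (con (+ 1) :* con (+ 1) :* con (+ 1) :* (con (+ 1) :* con (+ 1) :* con (+ 1)) :=
        con (+ 1) :* con (+ 1) :* con (+ 1) :* con (+ 1) :* con (+ 1)) refl
      reflection (suc n) = begin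
        upper₋ (suc n) * (q * q ^ n * (q * q ^ n) * (B n * U (q ^ n)))
          ≈⟨ *-congʳ (*-cong (*-cong (upper-step bβ≈1) (upper-step cγ≈1)) (upper-step dδ≈1)) ⟩
        - (b * (p * P)) * vb * ub * (- (c * (p * P)) * vc * uc) * (- (d * (p * P)) * vd * ud)
          * (q * q ^ n * (q * q ^ n) * (B n * U (q ^ n)))
          ≈⟨ *-congʳ (solve 10 (λ b c d pP vb vc vd ub uc ud →
               :- (b :* pP) :* vb :* ub :* (:- (c :* pP) :* vc :* uc) :* (:- (d :* pP) :* vd :* ud) :=
               :- (b :* c :* d :* pP :* pP :* pP :* (vb :* vc :* vd) :* (ub :* uc :* ud)))
               refl b c d (p * P) vb vc vd ub uc ud) ⟩
        - (b * c * d * (p * P) * (p * P) * (p * P) * V (q ^ suc n) * upper₋ n)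
          * (q * q ^ n * (q * q ^ n) * (B n * U (q ^ n)))
          ≈⟨ solve 9 (λ e p P V u q Q B U →
               :- (e :* (p :* P) :* (p :* P) :* (p :* P) :* V :* u) :* (q :* Q :* (q :* Q) :* (B :* U)) :=
               :- (p :* q :* (p :* q) :* (p :* P :* P :* P) :* e :* V :* U :* (u :* (Q :* Q :* B))))
               refl (b * c * d) p P (V (q ^ suc n)) (upper₋ n) q (q ^ n) (B n) (U (q ^ n)) ⟩
        - (p * q * (p * q) * (p * P * P * P) * (b * c * d) * V (q ^ suc n) * U (q ^ n)
          * (upper₋ n * (q ^ n * q ^ n * B n)))
          ≈⟨ -‿cong (*-cong (*-congʳ (*-congʳ (*-congʳ (*-congʳ (*-cong pq≈1 pq≈1))))) (reflection n)) ⟩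
        - (1ℂ * 1ℂ * (p * P * P * P) * (b * c * d) * V (q ^ suc n) * U (q ^ n)
          * (lower₋ n * (p * (b * c * d)) ^ n * pochV n))
          ≈⟨ solve 8 (λ p P e V U l X w →
               :- (con (+ 1) :* con (+ 1) :* (p :* P :* P :* P) :* e :* V :* U :* (l :* X :* w)) :=
               :- (P :* P :* P :* U :* l) :* (p :* e :* X) :* (w :* V))
               refl p P (b * c * d) (V (q ^ suc n)) (U (q ^ n)) (lower₋ n) ((p * (b * c * d)) ^ n) (pochV n) ⟩
        - (P * P * P * U (q ^ n) * lower₋ n) * (p * (b * c * d)) ^ suc n * pochV (suc n)
          ≈⟨ *-congʳ (*-congʳ (solve 7 (λ P ub uc ud lb lc ld →
               :- (P :* P :* P :* (ub :* uc :* ud) :* (lb :* lc :* ld)) :=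
               :- P :* ub :* lb :* (:- P :* uc :* lc) :* (:- P :* ud :* ld))
               refl P (β - q ^ n) (γ - q ^ n) (δ - q ^ n) _ _ _)) ⟩
        - P * (β - q ^ n) * poch (q * β * p ^ n) q n * (- P * (γ - q ^ n) * poch (q * γ * p ^ n) q n)
          * (- P * (δ - q ^ n) * poch (q * δ * p ^ n) q n) * (p * (b * c * d)) ^ suc n * pochV (suc n)
          ≈⟨ *-congʳ (*-congʳ (*-cong (*-cong (lower-step β) (lower-step γ)) (lower-step δ))) ⟨
        lower₋ (suc n) * (p * (b * c * d)) ^ suc n * pochV (suc n)  ∎
        where
        P vb vc vd ub uc ud : ℂ
        P = p ^ n
        vb = 1ℂ - β * q ^ suc n
        vc = 1ℂ - γ * q ^ suc n
        vd = 1ℂ - δ * q ^ suc n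
        ub = poch (b * p ^ n) q n
        uc = poch (c * p ^ n) q n
        ud = poch (d * p ^ n) q n

        pq≈1 : p * q ≈ 1ℂ
        pq≈1 = recip-inverse q q≠0

        upper-step : ∀ {z ζ} → z * ζ ≈ 1ℂ → poch (z * p ^ suc n) q (suc n)
                     ≈ - (z * p ^ suc n) * (1ℂ - ζ * q ^ suc n) * poch (z * p ^ n) q n
        upper-step {z} zζ≈1 = trans (poch-p^suc z n) (*-congʳ (upper-factor n zζ≈1))

        lower-step : ∀ ζ → poch (q * ζ * p ^ suc n) q (suc n) ≈ - (p ^ n) * (ζ - q ^ n) * poch (q * ζ * p ^ n) q n
        lower-step ζ = trans (poch-p^suc (q * ζ) n) (*-congʳ (lower-factor ζ n))

      recip-argument : ∀ (argument≠0 : q / (b * c * d) [ bcd≠0 ] ≠0) →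
        recip (q / (b * c * d) [ bcd≠0 ]) argument≠0 ≈ p * (b * c * d)
      recip-argument argument≠0 = recip-unique argument≠0 (begin
        q / (b * c * d) [ bcd≠0 ] * (p * (b * c * d))
          ≈⟨ solve 4 (λ q r p e → q :* r :* (p :* e) := p :* q :* (r :* e)) refl q (recip (b * c * d) bcd≠0) p (b * c * d) ⟩
        p * q * (recip (b * c * d) bcd≠0 * (b * c * d))
          ≈⟨ *-cong (recip-inverse q q≠0) (recip-inverse (b * c * d) bcd≠0) ⟩
        1ℂ * 1ℂ  ≈⟨ *-identityˡ 1ℂ ⟩
        1ℂ       ∎)

      pochV≠0 : ∀ n → pochV n ≠0
      pochV≠0 n = ≠0-cong (sym (pochV≈den₁ n)) (den≠0 (+ n))

      upper₋-term₋ : ∀ k → upper₋ (suc k) * term₋ k ≈ lower₋ (suc k) * (p * (b * c * d)) ^ suc k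
      upper₋-term₋ k = *-cancelˡ-≠0 (pochV≠0 (suc k)) (begin
        pochV (suc k) * (upper₋ (suc k) * term₋ k)
          ≈⟨ solve 5 (λ w u h f x → w :* (u :* (h :* (f :* x))) := u :* (x :* (w :* (h :* f)))) refl _ _ _ _ _ ⟩
        upper₋ (suc k) * (q ^ suc k * (pochV (suc k) * term₊ k))
          ≈⟨ *-congˡ (*-congˡ (pochV-term₊ k)) ⟩
        upper₋ (suc k) * (q ^ suc k * (q ^ suc k * B (suc k)))
          ≈⟨ *-congˡ (*-assoc _ _ _) ⟨
        upper₋ (suc k) * (q ^ suc k * q ^ suc k * B (suc k))
          ≈⟨ reflection (suc k) ⟩
        lower₋ (suc k) * (p * (b * c * d)) ^ suc k * pochV (suc k)
          ≈⟨ *-comm _ _ ⟩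
        pochV (suc k) * (lower₋ (suc k) * (p * (b * c * d)) ^ suc k)  ∎)

      term₁-- : ∀ k → term₁ den≠0 -[1+ k ] ≈ term₋ k
      term₁-- k = trans
        (solve 3 (λ a r x → a :* r :* x := a :* x :* r) refl _ _ _)
        (/-unique (den≠0 -[1+ k ]) (begin
          den₁ -[1+ k ] * term₋ k
            ≈⟨ *-congʳ (solve 3 (λ x y z → x :* (y :* (z :* con (+ 1))) :* (con (+ 1) :* (con (+ 1) :* (con (+ 1) :* con (+ 1))))
                 := x :* y :* z) refl _ _ _) ⟩
          upper₋ (suc k) * term₋ k
            ≈⟨ upper₋-term₋ k ⟩
          lower₋ (suc k) * (p * (b * c * d)) ^ suc k
            ≈⟨ *-cong (solve 3 (λ x y z → con (+ 1) :* (con (+ 1) :* (con (+ 1) :* con (+ 1))) :* (x :* (y :* (z :* con (+ 1))))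
                 := x :* y :* z) refl _ _ _) (^-congˡ (suc k) (recip-argument _)) ⟨
          ⟨ upper ⟩ⁿ -[1+ k ] * ⟨ lower₁ ⟩ᵈ -[1+ k ]
            * (q / (b * c * d) [ bcd≠0 ]) ^ℤ -[1+ k ] [ *-≠0 q≠0 (recip-≠0 bcd≠0) ]  ∎))

      term₊-summable : Summable term₊
      term₊-summable = geometric⇒summable (geometric-bounded-* (h-geometric 0)
        (⟶⇒bounded (1-z*p^⟶1 q)))

      term₋-summable : Summable term₋
      term₋-summable = geometric⇒summable (geometric-bounded-* (h-geometric 0)
        (⟶⇒bounded (⟶-* (1-z*p^⟶1 q) ^suc-null)))

      S₊ S₋ : ℂ
      S₊ = proj₁ term₊-summable
      S₋ = proj₁ term₋-summable

      S₊+S₋ : 1ℂ + S₊ + S₋ ≈ S 0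
      S₊+S₋ = trans (solve 3 (λ o a b → o :+ a :+ b := o :+ (a :+ b)) refl 1ℂ S₊ S₋) (+-congˡ (⟶-unique
        (hasSum-+ (proj₂ term₊-summable) (proj₂ term₋-summable))
        (⟶-cong (partialSum-cong (λ k → solve 3 (λ q x h →
            (con (+ 1) :- q :* con (+ 1) :* x :* (q :* x)) :* h :=
            h :* (con (+ 1) :- q :* x) :+ h :* ((con (+ 1) :- q :* x) :* (q :* x))) refl q (q ^ k) (h 0 k)))
          refl (proj₂ (T-summable 0)))))

      numerator denominator : ℂ
      numerator   = ⟨ q ∷ q / (b * c) [ bc≠0 ] ∷ q / (b * d) [ bd≠0 ] ∷ q / (c * d) [ cd≠0 ] ∷ [] ⟩∞
      denominator = ⟨ q / b [ b≠0 ] ∷ q / c [ c≠0 ] ∷ q / d [ d≠0 ] ∷ q / (b * c * d) [ bcd≠0 ] ∷ [] ⟩∞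

      bilateral-sum : (rhs≠0 : denominator ≠0) → HasBilateralSum (term₁ den≠0) (numerator / denominator [ rhs≠0 ])
      bilateral-sum rhs≠0 = 1ℂ + S₊ , S₋ ,
        ⟶-cong (λ _ → refl) (+-congʳ term₁-0) (hasSum-suc⁻ {λ n → term₁ den≠0 (+ n)}
          (⟶-cong (partialSum-cong (λ k → sym (term₁-+ k))) refl (proj₂ term₊-summable))) ,
        ⟶-cong (partialSum-cong (λ k → sym (term₁-- k))) refl (proj₂ term₋-summable) ,
        trans S₊+S₋ (sym (/-unique rhs≠0 (begin
          denominator * S 0
            ≈⟨ *-congʳ (*-congˡ (*-congˡ (*-congˡ (*-congʳ (poch∞-cong q ∣q∣<1 (*-congˡ recip-bcd)))))) ⟩
          P (q * β) * (P (q * γ) * (P (q * δ) * (P (q * s₃) * 1ℂ))) * S 0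
            ≈⟨ solve 5 (λ x y z w s → x :* (y :* (z :* (w :* con (+ 1)))) :* s := x :* y :* z :* w :* s) refl _ _ _ _ _ ⟩
          P (q * β) * P (q * γ) * P (q * δ) * P (q * s₃) * S 0
            ≈⟨ sum-formula ⟩
          P q * P (q * (β * γ)) * P (q * (β * δ)) * P (q * (γ * δ))
            ≈⟨ solve 4 (λ x y z w → x :* y :* z :* w := x :* (y :* (z :* (w :* con (+ 1))))) refl _ _ _ _ ⟩
          P q * (P (q * (β * γ)) * (P (q * (β * δ)) * (P (q * (γ * δ)) * 1ℂ)))
            ≈⟨ *-congˡ (*-cong (P-cong recip-bc) (*-cong (P-cong recip-bd) (*-congʳ (P-cong recip-cd)))) ⟨
          numerator  ∎)))
        where
        P : ℂ → ℂ
        P a = poch∞ a q ∣q∣<1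
        P-cong : ∀ {x y} → x ≈ y → P (q * x) ≈ P (q * y)
        P-cong x≈y = poch∞-cong q ∣q∣<1 (*-congˡ x≈y)

    module Unilateral (∣q/bcd∣<1 : ∣ q / (b * c * d) [ bcd≠0 ] ∣< 1ℝ)
                      (C₀-den≠0 : (1ℂ - q) * (1ℂ - b) * (1ℂ - c) * (1ℂ - d) ≠0)
                      (den≠0 : ∀ k → ⟨ lower₂ ⟩ (2 +ℕ k) ≠0) where

      lower₂≈ : ∀ k → V 1ℂ * pochV k ≈ ⟨ lower₂ ⟩ (suc k)
      lower₂≈ zero = solve 3 (λ β γ δ →
        (con (+ 1) :- β :* con (+ 1)) :* (con (+ 1) :- γ :* con (+ 1)) :* (con (+ 1) :- δ :* con (+ 1)) :* con (+ 1) :=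
        con (+ 1) :* (con (+ 1) :- con (+ 1) :* β :* con (+ 1))
          :* (con (+ 1) :* (con (+ 1) :- con (+ 1) :* γ :* con (+ 1))
          :* (con (+ 1) :* (con (+ 1) :- con (+ 1) :* δ :* con (+ 1)) :* con (+ 1)))) refl β γ δ
      lower₂≈ (suc k) = begin
        V 1ℂ * (pochV k * V (q ^ suc k))    ≈⟨ *-assoc _ _ _ ⟨
        V 1ℂ * pochV k * V (q ^ suc k)      ≈⟨ *-congʳ (lower₂≈ k) ⟩
        ⟨ lower₂ ⟩ (suc k) * V (q ^ suc k)
          ≈⟨ solve 7 (λ B C D β γ δ y → B :* (C :* (D :* con (+ 1)))
                 :* ((con (+ 1) :- β :* y) :* (con (+ 1) :- γ :* y) :* (con (+ 1) :- δ :* y)) :=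
               B :* (con (+ 1) :- con (+ 1) :* β :* y) :* (C :* (con (+ 1) :- con (+ 1) :* γ :* y)
                 :* (D :* (con (+ 1) :- con (+ 1) :* δ :* y) :* con (+ 1))))
               refl (poch (1ℂ * β) q (suc k)) (poch (1ℂ * γ) q (suc k)) (poch (1ℂ * δ) q (suc k)) β γ δ (q ^ suc k) ⟩
        ⟨ lower₂ ⟩ (suc (suc k))  ∎

      V≠0 : ∀ n → V (q ^ suc n) ≠0
      V≠0 n = *-≠0⁻ʳ (*-≠0⁻ʳ (≠0-cong (sym (lower₂≈ (suc n))) (den≠0 n)))

      ∣qs₃∣<1 : ∣ q * s₃ ∣< 1ℝ
      ∣qs₃∣<1 = ∣∣-cong (*-congˡ recip-bcd) ℝ.refl ∣q/bcd∣<1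

      open Series ∣qs₃∣<1 V≠0 public

      V1≈ : V 1ℂ ≈ - (s₃ * ((1ℂ - b) * (1ℂ - c) * (1ℂ - d)))
      V1≈ = trans (*-cong (*-cong (factor≈ bβ≈1) (factor≈ cγ≈1)) (factor≈ dδ≈1))
        (solve 6 (λ b c d β γ δ → :- (β :* (con (+ 1) :- b)) :* :- (γ :* (con (+ 1) :- c)) :* :- (δ :* (con (+ 1) :- d)) :=
          :- (β :* γ :* δ :* ((con (+ 1) :- b) :* (con (+ 1) :- c) :* (con (+ 1) :- d)))) refl b c d β γ δ)
        where
        factor≈ : ∀ {z ζ} → z * ζ ≈ 1ℂ → 1ℂ - ζ * 1ℂ ≈ - (ζ * (1ℂ - z))
        factor≈ {z} {ζ} zζ≈1 = trans (+-congʳ (sym zζ≈1))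
          (solve 2 (λ z ζ → z :* ζ :- ζ :* con (+ 1) := :- (ζ :* (con (+ 1) :- z))) refl z ζ)

      C₀-num : ℂ
      C₀-num =
        2ℂ * b * c * d * q - b * c * d - b * c * q - b * d * q - c * d * q + b + c + d + q - 2ℂ

      s₃*C₀-num≈ : s₃ * C₀-num ≈ - C₀-numerator
      s₃*C₀-num≈ = begin
        s₃ * C₀-num
          ≈⟨ solve 7 (λ q b c d β γ δ →
               β :* γ :* δ :* ((con (+ 1) :+ con (+ 1)) :* b :* c :* d :* q :- b :* c :* d :- b :* c :* q :- b :* d :* q
                 :- c :* d :* q :+ b :+ c :+ d :+ q :- (con (+ 1) :+ con (+ 1))) :=
               b :* β :* (c :* γ) :* (d :* δ) :* ((con (+ 1) :+ con (+ 1)) :* q :- con (+ 1))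
                 :- q :* (c :* γ :* (d :* δ) :* β :+ b :* β :* (d :* δ) :* γ :+ b :* β :* (c :* γ) :* δ)
                 :+ (d :* δ :* (β :* γ) :+ c :* γ :* (β :* δ) :+ b :* β :* (γ :* δ))
                 :+ (q :- (con (+ 1) :+ con (+ 1))) :* (β :* γ :* δ)) refl q b c d β γ δ ⟩
        b * β * (c * γ) * (d * δ) * (2ℂ * q - 1ℂ)
          - q * (c * γ * (d * δ) * β + b * β * (d * δ) * γ + b * β * (c * γ) * δ)
          + (d * δ * (β * γ) + c * γ * (β * δ) + b * β * (γ * δ)) + (q - 2ℂ) * s₃
          ≈⟨ +-congʳ (+-cong (+-cong (*-congʳ (*-cong (*-cong bβ≈1 cγ≈1) dδ≈1))
               (-‿cong (*-congˡ (+-cong (+-cong (*-congʳ (*-cong cγ≈1 dδ≈1)) (*-congʳ (*-cong bβ≈1 dδ≈1)))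
                 (*-congʳ (*-cong bβ≈1 cγ≈1))))))
               (+-cong (+-cong (*-congʳ dδ≈1) (*-congʳ cγ≈1)) (*-congʳ bβ≈1))) ⟩
        1ℂ * 1ℂ * 1ℂ * (2ℂ * q - 1ℂ) - q * (1ℂ * 1ℂ * β + 1ℂ * 1ℂ * γ + 1ℂ * 1ℂ * δ)
          + (1ℂ * (β * γ) + 1ℂ * (β * δ) + 1ℂ * (γ * δ)) + (q - 2ℂ) * s₃
          ≈⟨ solve 4 (λ q β γ δ →
               con (+ 1) :* con (+ 1) :* con (+ 1) :* ((con (+ 1) :+ con (+ 1)) :* q :- con (+ 1))
                 :- q :* (con (+ 1) :* con (+ 1) :* β :+ con (+ 1) :* con (+ 1) :* γ :+ con (+ 1) :* con (+ 1) :* δ)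
                 :+ (con (+ 1) :* (β :* γ) :+ con (+ 1) :* (β :* δ) :+ con (+ 1) :* (γ :* δ))
                 :+ (q :- (con (+ 1) :+ con (+ 1))) :* (β :* γ :* δ) :=
               :- (con (+ 1) :- (con (+ 1) :+ con (+ 1)) :* q :+ q :* (β :+ γ :+ δ) :- (β :* γ :+ β :* δ :+ γ :* δ)
                 :- (q :- (con (+ 1) :+ con (+ 1))) :* (β :* γ :* δ))) refl q β γ δ ⟩
        - C₀-numerator  ∎

      C₀≈ : (1ℂ - q) * V 1ℂ * C₀ C₀-den≠0 ≈ C₀-numerator
      C₀≈ = begin
        (1ℂ - q) * V 1ℂ * (C₀-num * recip D C₀-den≠0)
          ≈⟨ *-congʳ (*-congˡ V1≈) ⟩
        (1ℂ - q) * - (s₃ * ((1ℂ - b) * (1ℂ - c) * (1ℂ - d))) * (C₀-num * recip D C₀-den≠0)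
          ≈⟨ solve 7 (λ e s x y z n r → e :* :- (s :* (x :* y :* z)) :* (n :* r) :=
               :- (s :* n) :* (r :* (e :* x :* y :* z))) refl
               (1ℂ - q) s₃ (1ℂ - b) (1ℂ - c) (1ℂ - d) C₀-num (recip D C₀-den≠0) ⟩
        - (s₃ * C₀-num) * (recip D C₀-den≠0 * D)
          ≈⟨ *-cong (-‿cong s₃*C₀-num≈) (recip-inverse D C₀-den≠0) ⟩
        - - C₀-numerator * 1ℂ
          ≈⟨ solve 1 (λ n → :- :- n :* con (+ 1) := n) refl C₀-numerator ⟩
        C₀-numerator  ∎
        where
        D : ℂ
        D = (1ℂ - q) * (1ℂ - b) * (1ℂ - c) * (1ℂ - d)

      open Boundary (C₀ C₀-den≠0) C₀≈ public
      open BoundaryTerms.UnilateralTerms β γ δ ∣qs₃∣<1 V≠0 public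

      argument≈ : 1ℂ / (b * c * d) [ bcd≠0 ] ≈ s₃
      argument≈ = trans (*-identityˡ _) recip-bcd

      term₂-quotient : ∀ k → ∃[ Q ] Q * ⟨ lower₂ ⟩ (2 +ℕ k) ≈ ⟨ upper ⟩ (2 +ℕ k) ×
        term₂ den≠0 k ≈ factor k * Q * (1ℂ / (b * c * d) [ bcd≠0 ]) ^ (2 +ℕ k)
      term₂-quotient k = _ , /-unfolded (⟨ lower₂ ⟩ (2 +ℕ k)) ℝ.refl ℝ.refl ℝ.refl , refl

      term₂≈T′ : ∀ k → term₂ den≠0 k ≈ T′ k
      term₂≈T′ k = let (Q , QL≈P , term₂≈) = term₂-quotient k in
        trans term₂≈ (trans (*-assoc _ _ _) (factor≈T′ k (den≠0 k) (lower₂≈ (suc k)) (begin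
          B (2 +ℕ k)                                   ≈⟨ B≈ (2 +ℕ k) ⟩
          ⟨ upper ⟩ (2 +ℕ k) * s₃ ^ (2 +ℕ k)           ≈⟨ *-cong (sym QL≈P) (^-congˡ (2 +ℕ k) (sym argument≈)) ⟩
          Q * ⟨ lower₂ ⟩ (2 +ℕ k) * (1ℂ / (b * c * d) [ bcd≠0 ]) ^ (2 +ℕ k)
            ≈⟨ solve 3 (λ r l s → r :* l :* s := l :* (r :* s)) refl _ _ _ ⟩
          ⟨ lower₂ ⟩ (2 +ℕ k) * (Q * (1ℂ / (b * c * d) [ bcd≠0 ]) ^ (2 +ℕ k))  ∎)))

      unilateral-sum :
        (rhs≠0 : ⟨ 1ℂ / b [ b≠0 ] ∷ 1ℂ / c [ c≠0 ] ∷ 1ℂ / d [ d≠0 ] ∷ 1ℂ / (b * c * d) [ bcd≠0 ] ∷ [] ⟩∞ ≠0) →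
        ∣ 1ℂ / (b * c * d) [ bcd≠0 ] ∣< 1ℝ ⊎ Summable (term₂ den≠0) →
        ∃[ S ] HasSum (term₂ den≠0) S ×
          C₀ C₀-den≠0 + S ≈
            ⟨ q ∷ 1ℂ / (b * c) [ bc≠0 ] ∷ 1ℂ / (b * d) [ bd≠0 ] ∷ 1ℂ / (c * d) [ cd≠0 ] ∷ [] ⟩∞
              / ⟨ 1ℂ / b [ b≠0 ] ∷ 1ℂ / c [ c≠0 ] ∷ 1ℂ / d [ d≠0 ] ∷ 1ℂ / (b * c * d) [ bcd≠0 ] ∷ [] ⟩∞ [ rhs≠0 ]
      unilateral-sum rhs≠0 convergence = S′ , hasSum ,
        sym (/-unique rhs≠0 (begin
          P (1ℂ * β) * (P (1ℂ * γ) * (P (1ℂ * δ) * (P (1ℂ * recip (b * c * d) bcd≠0) * 1ℂ))) * (C₀ C₀-den≠0 + S′)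
            ≈⟨ *-congʳ (*-cong (P-cong refl) (*-cong (P-cong refl) (*-cong (P-cong refl) (*-congʳ (P-cong recip-bcd))))) ⟩
          P β * (P γ * (P δ * (P s₃ * 1ℂ))) * (C₀ C₀-den≠0 + S′)
            ≈⟨ solve 5 (λ x y z w s → x :* (y :* (z :* (w :* con (+ 1)))) :* s := x :* y :* z :* w :* s) refl _ _ _ _ _ ⟩
          P β * P γ * P δ * P s₃ * (C₀ C₀-den≠0 + S′)
            ≈⟨ boundary-∞ (⟶-cong (partialSum-cong term₂≈T′) refl hasSum) ⟩
          P q * P (β * γ) * P (β * δ) * P (γ * δ)
            ≈⟨ solve 4 (λ x y z w → x :* y :* z :* w := x :* (y :* (z :* (w :* con (+ 1))))) refl _ _ _ _ ⟩
          P q * (P (β * γ) * (P (β * δ) * (P (γ * δ) * 1ℂ)))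
            ≈⟨ *-congˡ (*-cong (P-cong recip-bc) (*-cong (P-cong recip-bd) (*-congʳ (P-cong recip-cd)))) ⟨
          P q * (P (1ℂ * recip (b * c) bc≠0) * (P (1ℂ * recip (b * d) bd≠0) * (P (1ℂ * recip (c * d) cd≠0) * 1ℂ)))  ∎))
        where
        P : ℂ → ℂ
        P a = poch∞ a q ∣q∣<1
        P-cong : ∀ {x y} → x ≈ y → P (1ℂ * x) ≈ P y
        P-cong x≈y = poch∞-cong q ∣q∣<1 (trans (*-identityˡ _) x≈y)

        term₂-summable : ∣ 1ℂ / (b * c * d) [ bcd≠0 ] ∣< 1ℝ ⊎ Summable (term₂ den≠0) → Summable (term₂ den≠0)
        term₂-summable (inj₂ summable) = summable
        term₂-summable (inj₁ ∣1/bcd∣<1) =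
          let (S , hs) = T′-summable (∣∣-cong argument≈ ℝ.refl ∣1/bcd∣<1)
          in S , ⟶-cong (partialSum-cong (λ k → sym (term₂≈T′ k))) refl hs

        S′ : ℂ
        S′ = proj₁ (term₂-summable convergence)
        hasSum : HasSum (term₂ den≠0) S′
        hasSum = proj₂ (term₂-summable convergence)

  double : ℕ → ℕ
  double zero    = 0
  double (suc n) = suc (suc (double n))

  n≤double : ∀ n → n ℕ.≤ double n
  n≤double zero    = ℕ.z≤n
  n≤double (suc n) = ℕ.s≤s (ℕ.≤-trans (n≤double n) (ℕ.n≤1+n _))

  poch-square : ∀ a n → poch (a * a) q (double n) ≈ poch a q n * poch (- a) q n * poch (q * (a * a)) (q ^ 2) n
  poch-square a zero    = solve 0 (con (+ 1) := con (+ 1) :* con (+ 1) :* con (+ 1)) refl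
  poch-square a (suc n) = begin
    poch (a * a) q (double n) * (1ℂ - a * a * q ^ double n) * (1ℂ - a * a * (q * q ^ double n))
      ≈⟨ *-cong (*-cong (poch-square a n) (+-congˡ (-‿cong (*-congˡ (q^double n)))))
           (+-congˡ (-‿cong (*-congˡ (*-congˡ (q^double n))))) ⟩
    poch a q n * poch (- a) q n * poch (q * (a * a)) (q ^ 2) n * (1ℂ - a * a * (q ^ n * q ^ n))
      * (1ℂ - a * a * (q * (q ^ n * q ^ n)))
      ≈⟨ solve 6 (λ A B C a q x →
           A :* B :* C :* (con (+ 1) :- a :* a :* (x :* x)) :* (con (+ 1) :- a :* a :* (q :* (x :* x))) :=
           A :* (con (+ 1) :- a :* x) :* (B :* (con (+ 1) :- :- a :* x)) :* (C :* (con (+ 1) :- q :* (a :* a) :* (x :* x))))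
           refl (poch a q n) (poch (- a) q n) (poch (q * (a * a)) (q ^ 2) n) a q (q ^ n) ⟩
    poch a q n * (1ℂ - a * q ^ n) * (poch (- a) q n * (1ℂ - - a * q ^ n))
      * (poch (q * (a * a)) (q ^ 2) n * (1ℂ - q * (a * a) * (q ^ n * q ^ n)))
      ≈⟨ *-congˡ (*-congˡ (+-congˡ (-‿cong (*-congˡ (q²^ n))))) ⟨
    poch a q (suc n) * poch (- a) q (suc n) * poch (q * (a * a)) (q ^ 2) (suc n)  ∎
    where
    q^double : ∀ n → q ^ double n ≈ q ^ n * q ^ n
    q^double zero    = sym (*-identityˡ 1ℂ)
    q^double (suc n) = trans (*-congˡ (*-congˡ (q^double n)))
      (solve 2 (λ q x → q :* (q :* (x :* x)) := q :* x :* (q :* x)) refl q (q ^ n))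

    q²^ : ∀ n → (q ^ 2) ^ n ≈ q ^ n * q ^ n
    q²^ n = trans (^-congˡ n (*-congˡ (*-identityʳ q))) (^-distrib-* q q n)

  poch∞-square : ∀ a → poch∞ (a * a) q ∣q∣<1
                       ≈ poch∞ a q ∣q∣<1 * poch∞ (- a) q ∣q∣<1 * poch∞ (q * (a * a)) (q ^ 2) ∣q²∣<1
  poch∞-square a = ⟶-unique (⟶-subsequence double n≤double (poch⟶poch∞ (a * a) q ∣q∣<1))
    (⟶-cong (λ n → sym (poch-square a n)) refl
      (⟶-* (⟶-* (poch⟶poch∞ a q ∣q∣<1) (poch⟶poch∞ (- a) q ∣q∣<1)) (poch⟶poch∞ (q * (a * a)) (q ^ 2) ∣q²∣<1)))

  P : ℂ → ℂ
  P a = poch∞ a q ∣q∣<1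

  P≈1 : ∀ {a} → a ≈ 0ℂ → P a ≈ 1ℂ
  P≈1 {a} a≈0 = ⟶-unique (poch⟶poch∞ a q ∣q∣<1) (⟶-cong (λ n → sym (poch≈1 n)) refl (⟶-const 1ℂ))
    where
    poch≈1 : ∀ n → poch a q n ≈ 1ℂ
    poch≈1 zero    = refl
    poch≈1 (suc n) = trans (*-cong (poch≈1 n) (+-congˡ (-‿cong (*-congʳ a≈0))))
      (solve 1 (λ y → con (+ 1) :* (con (+ 1) :- con (+ 0) :* y) := con (+ 1)) refl (q ^ n))

  module Cube (b : ℂ) (b≠0 : b ≠0) (∣q/b³∣<1 : ∣ q / b ^ 3 [ ^-≠0 b≠0 3 ] ∣< 1ℝ)
              (1-b≠0 : (1ℂ - b) * (1ℂ - q) ≠0)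
              (den≠0 : ∀ k → poch (1ℂ / b [ b≠0 ]) q (2 +ℕ k) ^ 3 ≠0) where

    open Parameters b b b b≠0 b≠0 b≠0

    recip-cube : ∀ (b³≠0 : b ^ 3 ≠0) (bbb≠0 : b * b * b ≠0) → recip (b ^ 3) b³≠0 ≈ recip (b * b * b) bbb≠0
    recip-cube b³≠0 bbb≠0 = recip-unique b³≠0 (trans
      (*-congʳ (solve 1 (λ b → b :* (b :* (b :* con (+ 1))) := b :* b :* b) refl b)) (recip-inverseʳ (b * b * b) bbb≠0))

    ∣q/bbb∣<1 : ∣ q / (b * b * b) [ bcd≠0 ] ∣< 1ℝ
    ∣q/bbb∣<1 = ∣∣-cong {q / b ^ 3 [ ^-≠0 b≠0 3 ]} (*-congˡ (recip-cube (^-≠0 b≠0 3) bcd≠0)) ℝ.refl ∣q/b³∣<1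

    C₀-den≠0 : (1ℂ - q) * (1ℂ - b) * (1ℂ - b) * (1ℂ - b) ≠0
    C₀-den≠0 = *-≠0 (*-≠0 (*-≠0 (*-≠0⁻ʳ 1-b≠0) (*-≠0⁻ˡ 1-b≠0)) (*-≠0⁻ˡ 1-b≠0)) (*-≠0⁻ˡ 1-b≠0)

    open Inverses b b b b≠0 b≠0 b≠0
    open Unilateral ∣q/bbb∣<1 C₀-den≠0 den≠0

    argument³ : ∀ n → (1ℂ / b [ b≠0 ]) ^ (3 ℕ.* n) ≈ s₃ ^ n
    argument³ n = trans (sym (^-assocʳ (1ℂ / b [ b≠0 ]) 3 n))
      (^-congˡ n (solve 1 (λ β → con (+ 1) :* β :* (con (+ 1) :* β :* (con (+ 1) :* β :* con (+ 1))) := β :* β :* β) refl β))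

    term₃-quotient : ∀ k → ∃[ Q ] Q * poch (1ℂ / b [ b≠0 ]) q (2 +ℕ k) ^ 3 ≈ poch b q (2 +ℕ k) ^ 3 ×
      term₃ b b≠0 den≠0 k ≈ factor k * Q * (1ℂ / b [ b≠0 ]) ^ (3 ℕ.* (2 +ℕ k))
    term₃-quotient k = _ , /-unfolded (poch (1ℂ / b [ b≠0 ]) q (2 +ℕ k) ^ 3) ℝ.refl ℝ.refl ℝ.refl , refl

    term₃≈T′ : ∀ k → term₃ b b≠0 den≠0 k ≈ T′ k
    term₃≈T′ k = let (Q , QL≈P , term₃≈) = term₃-quotient k in
      trans term₃≈ (trans (*-assoc _ _ _) (factor≈T′ k (den≠0 k) (lower₂≈ (suc k)) (begin
        B (2 +ℕ k)                                   ≈⟨ B≈ (2 +ℕ k) ⟩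
        ⟨ upper ⟩ (2 +ℕ k) * s₃ ^ (2 +ℕ k)           ≈⟨ *-cong (sym QL≈P) (sym (argument³ (2 +ℕ k))) ⟩
        Q * ⟨ lower₂ ⟩ (2 +ℕ k) * (1ℂ / b [ b≠0 ]) ^ (3 ℕ.* (2 +ℕ k))
          ≈⟨ solve 3 (λ r l s → r :* l :* s := l :* (r :* s)) refl _ _ _ ⟩
        ⟨ lower₂ ⟩ (2 +ℕ k) * (Q * (1ℂ / b [ b≠0 ]) ^ (3 ℕ.* (2 +ℕ k)))  ∎)))

    βfactor≠0 : ∀ n → 1ℂ - β * q ^ n ≠0
    βfactor≠0 zero    = *-≠0⁻ˡ (*-≠0⁻ˡ (*-≠0⁻ˡ {V 1ℂ} (≠0-cong (sym (lower₂≈ 1)) (den≠0 0))))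
    βfactor≠0 (suc n) = *-≠0⁻ˡ (*-≠0⁻ˡ (V≠0 n))

    E : ℂ
    E = (- 2ℂ * b * q + b - q + 2ℂ) / ((1ℂ - b) * (1ℂ - q)) [ 1-b≠0 ]

    C₀≈-E : C₀ C₀-den≠0 ≈ - E
    C₀≈-E = /-unique {C₀-num} {(1ℂ - q) * (1ℂ - b) * (1ℂ - b) * (1ℂ - b)} C₀-den≠0 (begin
      (1ℂ - q) * (1ℂ - b) * (1ℂ - b) * (1ℂ - b) * - (e * recip D 1-b≠0)
        ≈⟨ solve 4 (λ x y e r → x :* y :* y :* y :* :- (e :* r) := r :* (y :* x) :* :- (y :* y :* e)) refl
             (1ℂ - q) (1ℂ - b) e (recip D 1-b≠0) ⟩
      recip D 1-b≠0 * D * - ((1ℂ - b) * (1ℂ - b) * e)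
        ≈⟨ trans (*-congʳ (recip-inverse D 1-b≠0)) (*-identityˡ _) ⟩
      - ((1ℂ - b) * (1ℂ - b) * e)
        ≈⟨ solve 2 (λ b q → :- ((con (+ 1) :- b) :* (con (+ 1) :- b)
               :* (:- (con (+ 1) :+ con (+ 1)) :* b :* q :+ b :- q :+ (con (+ 1) :+ con (+ 1)))) :=
             (con (+ 1) :+ con (+ 1)) :* b :* b :* b :* q :- b :* b :* b :- b :* b :* q :- b :* b :* q :- b :* b :* q
               :+ b :+ b :+ b :+ q :- (con (+ 1) :+ con (+ 1))) refl b q ⟩
      C₀-num  ∎)
      where
      e D : ℂ
      e = - 2ℂ * b * q + b - q + 2ℂ
      D = (1ℂ - b) * (1ℂ - q)

    M N : ℂ
    M = P (- 1ℂ / b [ b≠0 ])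
    N = poch∞ (q / b ^ 2 [ ^-≠0 b≠0 2 ]) (q ^ 2) ∣q²∣<1

    Pββ≈ : P (β * β) ≈ P β * M * N
    Pββ≈ = trans (poch∞-square β) (*-cong
      (*-congˡ (poch∞-cong q ∣q∣<1 (solve 1 (λ β → :- β := :- con (+ 1) :* β) refl β)))
      (poch∞-cong (q ^ 2) ∣q²∣<1 (*-congˡ (sym (recip-unique (^-≠0 b≠0 2) (begin
        b * (b * 1ℂ) * (β * β)   ≈⟨ solve 2 (λ b β → b :* (b :* con (+ 1)) :* (β :* β) := b :* β :* (b :* β)) refl b β ⟩
        b * β * (b * β)          ≈⟨ *-cong bβ≈1 bβ≈1 ⟩
        1ℂ * 1ℂ                  ≈⟨ *-identityˡ 1ℂ ⟩
        1ℂ                       ∎))))))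

    cube-sum : (rhs≠0 : P (1ℂ / b ^ 3 [ ^-≠0 b≠0 3 ]) ≠0) →
      ∣ 1ℂ / b ^ 3 [ ^-≠0 b≠0 3 ] ∣< 1ℝ ⊎ Summable (term₃ b b≠0 den≠0) →
      HasSum (term₃ b b≠0 den≠0) (P q * ((M ^ 3 * N ^ 3) / P (1ℂ / b ^ 3 [ ^-≠0 b≠0 3 ]) [ rhs≠0 ]) + E)
    cube-sum rhs≠0 convergence = ⟶-cong (partialSum-cong (λ k → sym (term₃≈T′ k))) S′≈ (proj₂ T′-sum)
      where
      1/b³≈s₃ : 1ℂ / b ^ 3 [ ^-≠0 b≠0 3 ] ≈ s₃
      1/b³≈s₃ = trans (*-identityˡ _) (trans (recip-cube (^-≠0 b≠0 3) bcd≠0) recip-bcd)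

      T′-sum : Summable T′
      T′-sum = [ (λ ∣1/b³∣<1 → T′-summable (∣∣-cong 1/b³≈s₃ ℝ.refl ∣1/b³∣<1))
               , (λ (S , hs) → S , ⟶-cong (partialSum-cong term₃≈T′) refl hs) ]′ convergence

      S′ R : ℂ
      S′ = proj₁ T′-sum
      R = P (1ℂ / b ^ 3 [ ^-≠0 b≠0 3 ])

      Pβ≠0 : P β ≠0
      Pβ≠0 = poch∞-≠0 β βfactor≠0

      C₀+S′≈ : C₀ C₀-den≠0 + S′ ≈ P q * ((M ^ 3 * N ^ 3) / R [ rhs≠0 ])
      C₀+S′≈ = *-cancelˡ-≠0 (*-≠0 (*-≠0 (*-≠0 Pβ≠0 Pβ≠0) Pβ≠0) rhs≠0) (begin
        P β * P β * P β * R * (C₀ C₀-den≠0 + S′)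
          ≈⟨ *-congʳ (*-congˡ (poch∞-cong q ∣q∣<1 1/b³≈s₃)) ⟩
        P β * P β * P β * P s₃ * (C₀ C₀-den≠0 + S′)
          ≈⟨ boundary-∞ (proj₂ T′-sum) ⟩
        P q * P (β * β) * P (β * β) * P (β * β)
          ≈⟨ *-cong (*-cong (*-congˡ Pββ≈) Pββ≈) Pββ≈ ⟩
        P q * (P β * M * N) * (P β * M * N) * (P β * M * N)
          ≈⟨ solve 4 (λ p x m n → p :* (x :* m :* n) :* (x :* m :* n) :* (x :* m :* n) :=
               x :* x :* x :* (con (+ 1) :* (p :* (m :* (m :* (m :* con (+ 1))) :* (n :* (n :* (n :* con (+ 1)))))))) refl
               (P q) (P β) M N ⟩
        P β * P β * P β * (1ℂ * (P q * (M ^ 3 * N ^ 3)))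
          ≈⟨ *-congˡ (*-congʳ (recip-inverseʳ R rhs≠0)) ⟨
        P β * P β * P β * (R * recip R rhs≠0 * (P q * (M ^ 3 * N ^ 3)))
          ≈⟨ solve 5 (λ x r i p m → x :* (r :* i :* (p :* m)) := x :* r :* (p :* (m :* i))) refl
               (P β * P β * P β) R (recip R rhs≠0) (P q) (M ^ 3 * N ^ 3) ⟩
        P β * P β * P β * R * (P q * (M ^ 3 * N ^ 3 * recip R rhs≠0))  ∎)

      S′≈ : S′ ≈ P q * ((M ^ 3 * N ^ 3) / R [ rhs≠0 ]) + E
      S′≈ = begin
        S′                         ≈⟨ solve 2 (λ s e → s := :- e :+ s :+ e) refl S′ E ⟩
        - E + S′ + E               ≈⟨ +-congʳ (+-congʳ C₀≈-E) ⟨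
        C₀ C₀-den≠0 + S′ + E       ≈⟨ +-congʳ C₀+S′≈ ⟩
        P q * ((M ^ 3 * N ^ 3) / R [ rhs≠0 ]) + E  ∎

  module Pentagonal where
    open WellPoised ℛ q ∣q∣<1 0ℂ 0ℂ 0ℂ

    s₃≈0 : s₃ ≈ 0ℂ
    s₃≈0 = solve 0 (con (+ 0) :* con (+ 0) :* con (+ 0) := con (+ 0)) refl

    ∣s₃∣<1 : ∣ s₃ ∣< 1ℝ
    ∣s₃∣<1 = ∣∣-cong (sym s₃≈0) ℝ.refl (∣0∣< ℝ.0<1)

    ∣qs₃∣<1 : ∣ q * s₃ ∣< 1ℝ
    ∣qs₃∣<1 = ∣∣-cong (sym (trans (*-congˡ s₃≈0) (zeroʳ q))) ℝ.refl (∣0∣< ℝ.0<1)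

    V≈1 : ∀ y → V y ≈ 1ℂ
    V≈1 y = solve 1 (λ y → (con (+ 1) :- con (+ 0) :* y) :* (con (+ 1) :- con (+ 0) :* y) :* (con (+ 1) :- con (+ 0) :* y)
      := con (+ 1)) refl y

    V≠0 : ∀ n → V (q ^ suc n) ≠0
    V≠0 n = ≠0-cong (sym (V≈1 (q ^ suc n))) 1≠0

    open Series ∣qs₃∣<1 V≠0
    open BoundaryTerms.UnilateralTerms 0ℂ 0ℂ 0ℂ ∣qs₃∣<1 V≠0

    pochV≈1 : ∀ n → V 1ℂ * pochV n ≈ 1ℂ
    pochV≈1 zero    = trans (*-identityʳ _) (V≈1 1ℂ)
    pochV≈1 (suc n) = trans (sym (*-assoc _ _ _))
      (trans (*-cong (pochV≈1 n) (V≈1 (q ^ suc n))) (*-identityˡ 1ℂ))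

    exponent : ℕ → ℕ
    exponent n = 3 ℕ.* n ℕ.* (n ∸ 1) ℕ./ 2

    exponent-suc : ∀ n → exponent (suc n) ≡ exponent n +ℕ (n +ℕ (n +ℕ n))
    exponent-suc zero    = ≡.refl
    exponent-suc (suc m) = ≡.trans
      (≡.cong (ℕ._/ 2) (ℕSolver.solve 1 (λ m →
        ℕSolver.con 3 ℕSolver.:* (ℕSolver.con 2 ℕSolver.:+ m) ℕSolver.:* (ℕSolver.con 1 ℕSolver.:+ m) ℕSolver.:=
        ℕSolver.con 3 ℕSolver.:* (ℕSolver.con 1 ℕSolver.:+ m) ℕSolver.:* m ℕSolver.:+
          ((ℕSolver.con 1 ℕSolver.:+ m) ℕSolver.:+ ((ℕSolver.con 1 ℕSolver.:+ m) ℕSolver.:+ (ℕSolver.con 1 ℕSolver.:+ m)))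
            ℕSolver.:* ℕSolver.con 2) ≡.refl m))
      (≡.trans (ℕ.+-distrib-/-∣ʳ (3 ℕ.* suc m ℕ.* m) (ℕ.divides-refl (suc m +ℕ (suc m +ℕ suc m))))
        (≡.cong (exponent (suc m) +ℕ_) (ℕ.m*n/n≡m (suc m +ℕ (suc m +ℕ suc m)) 2)))

    B≈ : ∀ n → B n ≈ (- 1ℂ) ^ n * q ^ exponent n
    B≈ zero    = sym (*-identityˡ 1ℂ)
    B≈ (suc n) = begin
      B n * U (q ^ n)
        ≈⟨ *-congʳ (B≈ n) ⟩
      (- 1ℂ) ^ n * q ^ exponent n * U (q ^ n)
        ≈⟨ solve 3 (λ s e y → s :* e :* ((con (+ 0) :- y) :* (con (+ 0) :- y) :* (con (+ 0) :- y)) :=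
             :- con (+ 1) :* s :* (y :* y :* y :* e)) refl ((- 1ℂ) ^ n) (q ^ exponent n) (q ^ n) ⟩
      - 1ℂ * (- 1ℂ) ^ n * (q ^ n * q ^ n * q ^ n * q ^ exponent n)
        ≈⟨ *-congˡ (begin
             q ^ n * q ^ n * q ^ n * q ^ exponent n
               ≈⟨ *-congʳ (trans (*-congʳ (^-+ n n)) (^-+ (n +ℕ n) n)) ⟩
             q ^ (n +ℕ (n +ℕ n)) * q ^ exponent n
               ≈⟨ ^-+ (n +ℕ (n +ℕ n)) (exponent n) ⟩
             q ^ (exponent n +ℕ (n +ℕ (n +ℕ n)))
               ≡⟨ ≡.cong (q ^_) (exponent-suc n) ⟨
             q ^ exponent (suc n)  ∎) ⟩
      (- 1ℂ) ^ suc n * q ^ exponent (suc n)  ∎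

    term₄≈T′ : ∀ k → term₄ k ≈ T′ k
    term₄≈T′ k = trans (*-assoc _ _ _)
      (factor≈T′ k 1≠0 (pochV≈1 (suc k)) (trans (B≈ (suc (suc k))) (sym (*-identityˡ _))))

    C₄ : ℂ
    C₄ = (1ℂ - 2ℂ * q) / (1ℂ - q) [ 1-q≠0 ]

    C₄≈ : (1ℂ - q) * V 1ℂ * C₄ ≈ C₀-numerator
    C₄≈ = begin
      (1ℂ - q) * V 1ℂ * ((1ℂ - 2ℂ * q) * recip (1ℂ - q) 1-q≠0)
        ≈⟨ solve 4 (λ f V e r → f :* V :* (e :* r) := V :* e :* (r :* f)) refl _ _ _ _ ⟩
      V 1ℂ * (1ℂ - 2ℂ * q) * (recip (1ℂ - q) 1-q≠0 * (1ℂ - q))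
        ≈⟨ *-cong (*-congʳ (V≈1 1ℂ)) (recip-inverse (1ℂ - q) 1-q≠0) ⟩
      1ℂ * (1ℂ - 2ℂ * q) * 1ℂ
        ≈⟨ solve 1 (λ q → con (+ 1) :* (con (+ 1) :- (con (+ 1) :+ con (+ 1)) :* q) :* con (+ 1) :=
             con (+ 1) :- (con (+ 1) :+ con (+ 1)) :* q :+ q :* (con (+ 0) :+ con (+ 0) :+ con (+ 0))
               :- (con (+ 0) :* con (+ 0) :+ con (+ 0) :* con (+ 0) :+ con (+ 0) :* con (+ 0))
               :- (q :- (con (+ 1) :+ con (+ 1))) :* (con (+ 0) :* con (+ 0) :* con (+ 0))) refl q ⟩
      C₀-numerator  ∎

    open Boundary C₄ C₄≈

    pentagonal-sum : HasSum term₄ (P q - C₄)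
    pentagonal-sum = ⟶-cong (partialSum-cong (λ k → sym (term₄≈T′ k))) S′≈ (proj₂ T′-sum)
      where
      T′-sum : Summable T′
      T′-sum = T′-summable ∣s₃∣<1
      S′ : ℂ
      S′ = proj₁ T′-sum

      C₄+S′≈ : C₄ + S′ ≈ P q
      C₄+S′≈ = begin
        C₄ + S′                                     ≈⟨ solve 1 (λ x → x := con (+ 1) :* con (+ 1) :* con (+ 1) :* con (+ 1) :* x) refl _ ⟩
        1ℂ * 1ℂ * 1ℂ * 1ℂ * (C₄ + S′)
          ≈⟨ *-congʳ (*-cong (*-cong (*-cong (P≈1 refl) (P≈1 refl)) (P≈1 refl)) (P≈1 s₃≈0)) ⟨
        P 0ℂ * P 0ℂ * P 0ℂ * P s₃ * (C₄ + S′)       ≈⟨ boundary-∞ (proj₂ T′-sum) ⟩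
        P q * P (0ℂ * 0ℂ) * P (0ℂ * 0ℂ) * P (0ℂ * 0ℂ)
          ≈⟨ *-cong (*-cong (*-congˡ (P≈1 (zeroˡ 0ℂ))) (P≈1 (zeroˡ 0ℂ))) (P≈1 (zeroˡ 0ℂ)) ⟩
        P q * 1ℂ * 1ℂ * 1ℂ                          ≈⟨ solve 1 (λ x → x :* con (+ 1) :* con (+ 1) :* con (+ 1) := x) refl _ ⟩
        P q                                         ∎

      S′≈ : S′ ≈ P q - C₄
      S′≈ = trans (solve 2 (λ s c → s := c :+ s :- c) refl S′ C₄) (+-congʳ C₄+S′≈)

theorem3p4 : ∀ {c ℓ₁ ℓ₂} (ℛ : RealNumbers c ℓ₁ ℓ₂) → let open Complex ℛ in
    (q : ℂ) (q≠0 : q ≠0) (∣q∣<1 : ∣ q ∣< 1ℝ) → let open QSeries q q≠0 ∣q∣<1 in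
    (∀ b c d (b≠0 : b ≠0) (c≠0 : c ≠0) (d≠0 : d ≠0) →
    let open Parameters b c d b≠0 c≠0 d≠0 in
    ∣ q / (b * c * d) [ bcd≠0 ] ∣< 1ℝ →
    (den≠0 : ∀ n → den₁ n ≠0)
    (rhs≠0 : ⟨ q / b [ b≠0 ] ∷ q / c [ c≠0 ] ∷ q / d [ d≠0 ] ∷ q / (b * c * d) [ bcd≠0 ] ∷ [] ⟩∞ ≠0) →
    HasBilateralSum (term₁ den≠0)
    (⟨ q ∷ q / (b * c) [ bc≠0 ] ∷ q / (b * d) [ bd≠0 ] ∷ q / (c * d) [ cd≠0 ] ∷ [] ⟩∞
    / ⟨ q / b [ b≠0 ] ∷ q / c [ c≠0 ] ∷ q / d [ d≠0 ] ∷ q / (b * c * d) [ bcd≠0 ] ∷ [] ⟩∞ [ rhs≠0 ]))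
    × (∀ b c d (b≠0 : b ≠0) (c≠0 : c ≠0) (d≠0 : d ≠0) →
    let open Parameters b c d b≠0 c≠0 d≠0 in
    ∣ q / (b * c * d) [ bcd≠0 ] ∣< 1ℝ →
    (C₀-den≠0 : (1ℂ - q) * (1ℂ - b) * (1ℂ - c) * (1ℂ - d) ≠0)
    (den≠0 : ∀ k → ⟨ lower₂ ⟩ (2 +ℕ k) ≠0)
    (rhs≠0 : ⟨ 1ℂ / b [ b≠0 ] ∷ 1ℂ / c [ c≠0 ] ∷ 1ℂ / d [ d≠0 ] ∷ 1ℂ / (b * c * d) [ bcd≠0 ] ∷ [] ⟩∞ ≠0) →
    ∣ 1ℂ / (b * c * d) [ bcd≠0 ] ∣< 1ℝ ⊎ Summable (term₂ den≠0) →
    ∃[ S ] HasSum (term₂ den≠0) S ×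
    C₀ C₀-den≠0 + S ≈
    ⟨ q ∷ 1ℂ / (b * c) [ bc≠0 ] ∷ 1ℂ / (b * d) [ bd≠0 ] ∷ 1ℂ / (c * d) [ cd≠0 ] ∷ [] ⟩∞
    / ⟨ 1ℂ / b [ b≠0 ] ∷ 1ℂ / c [ c≠0 ] ∷ 1ℂ / d [ d≠0 ] ∷ 1ℂ / (b * c * d) [ bcd≠0 ] ∷ [] ⟩∞ [ rhs≠0 ])
    × (∀ b (b≠0 : b ≠0) →
    ∣ q / b ^ 3 [ ^-≠0 b≠0 3 ] ∣< 1ℝ →
    (1-b≠0 : (1ℂ - b) * (1ℂ - q) ≠0)
    (den≠0 : ∀ k → poch (1ℂ / b [ b≠0 ]) q (2 +ℕ k) ^ 3 ≠0)
    (rhs≠0 : poch∞ (1ℂ / b ^ 3 [ ^-≠0 b≠0 3 ]) q ∣q∣<1 ≠0) →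
    ∣ 1ℂ / b ^ 3 [ ^-≠0 b≠0 3 ] ∣< 1ℝ ⊎ Summable (term₃ b b≠0 den≠0) →
    HasSum (term₃ b b≠0 den≠0)
    (poch∞ q q ∣q∣<1
    * ((poch∞ (- 1ℂ / b [ b≠0 ]) q ∣q∣<1 ^ 3 * poch∞ (q / b ^ 2 [ ^-≠0 b≠0 2 ]) (q ^ 2) ∣q²∣<1 ^ 3)
    / poch∞ (1ℂ / b ^ 3 [ ^-≠0 b≠0 3 ]) q ∣q∣<1 [ rhs≠0 ])
    + (- 2ℂ * b * q + b - q + 2ℂ) / ((1ℂ - b) * (1ℂ - q)) [ 1-b≠0 ]))
    × HasSum term₄ (poch∞ q q ∣q∣<1 - (1ℂ - 2ℂ * q) / (1ℂ - q) [ 1-q≠0 ])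
theorem3p4 ℛ q q≠0 ∣q∣<1 =
    (λ b c d b≠0 c≠0 d≠0 → Inverses.Bilateral.bilateral-sum b c d b≠0 c≠0 d≠0)
  , (λ b c d b≠0 c≠0 d≠0 → Inverses.Unilateral.unilateral-sum b c d b≠0 c≠0 d≠0)
  , Cube.cube-sum
  , Pentagonal.pentagonal-sum
  where open Translation ℛ q q≠0 ∣q∣<1
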